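{- Let $\chi$ be a nonprincipal primitive Dirichlet character with conductor $f_\chi$, let $r$ be a positive integer and let $b\ge 0$ be real. For $\theta>0$ set $$G_{2,\chi}(\theta,b,r)=r\sum_{n=0}^\infty\chi(n)e^{ -(n+b/r)^r\theta}.$$ Then for any nonnegative integer $N$, $$G_{2,\chi}(\theta,b,r)=-r\sum_{n=0}^{N}(-1)^n\frac{B_{rn+1,\bar\chi}\left(\frac br\right)}{(rn+1)\,n!}\,\theta^n+O(\theta^{N+1})\qquad\text{as }\theta\to0^+.$$
   Context: The principal character $\chi^0$ is the one with conductor $1$, i.e. $\chi^0(m)=1$ for all integers $m$; "nonprincipal" means $\chi\ne\chi^0$. A primitive character $\chi$ modulo $f_\chi$ is regarded as a function on $\mathbb Z$, periodic mod $f_\chi$ and zero on integers not coprime to $f_\chi$; $\bar\chi$ is its complex conjugate. For a primitive character $\chi$ modulo $f_\chi$, the generalized Bernoulli polynomials $B_{n,\chi}(x)$ are defined by (note the conjugate) $$\sum_{m=0}^{f_\chi-1}\frac{\bar\chi(m)\,t\,e^{(m+x)t}}{e^{f_\chi t}-1}=\sum_{n=0}^\infty B_{n,\chi}(x)\frac{t^n}{n!}\qquad(|t|<2\pi/f_\chi).$$ Thus $B_{n,\bar\chi}(x)$ is given by the same generating function with $\chi(m)$ in place of $\bar\chi(m)$. The implied constant in $O(\theta^{N+1})$ may depend on $N,\chi,b,r$. -}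

module Defs where

open import Algebra.Apartness.Bundles using (HeytingField)
open import Algebra.Apartness.Structures using (IsHeytingField)
open import Algebra.Bundles using (CommutativeRing)
open import Algebra.Core using (Op₁; Op₂)
open import Algebra.Structures using (IsCommutativeRing)
open import Data.Fin.Base using (Fin; zero; suc; toℕ; fromℕ; inject₁)
open import Data.Fin.Properties using (toℕ-fromℕ; toℕ-inject₁; toℕ≤pred[n])
open import Data.Integer.Base as ℤ using (ℤ)
import Data.Integer.Coprimality as ℤ
import Data.Integer.Divisibility as ℤ
import Data.Integer.Properties as ℤ
open import Data.Nat.Base as ℕ using (ℕ; zero; suc; NonZero; z≤n; s≤s; _!)
import Data.Nat.Divisibility as ℕ
import Data.Nat.Properties as ℕ
open import Data.Product.Base using (∃; _×_; _,_; proj₁; proj₂)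
open import Data.Sum.Base using (_⊎_; inj₁; inj₂; [_,_]′)
open import Function.Base using (_∘_)
open import Level using (Level; _⊔_) renaming (suc to lsuc)
open import Relation.Binary.Core using (Rel)
open import Relation.Binary.PropositionalEquality.Core as ≡ using (_≡_)
open import Relation.Binary.Structures using (IsStrictPartialOrder; IsEquivalence)
open import Relation.Nullary.Negation.Core using (¬_; contradiction)

------------------------------------------------------------------------
-- The real numbers: a Cauchy-complete Archimedean ordered field.
--
-- The library has no reals, so they are given by the axioms that
-- determine them up to isomorphism. Apartness is x < y ⊎ y < x; no
-- decidability is assumed, so both the classical reals and the Bishop
-- reals are models. Weak linearity of _<_ is cotransitivity of apartness.

record OrderedField c ℓ₁ ℓ₂ : Set (lsuc (c ⊔ ℓ₁ ⊔ ℓ₂)) where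
  infix  8 -_
  infixl 7 _*_
  infixl 6 _+_
  infix  4 _≈_ _<_ _≤_
  field
    ℝ     : Set c
    _≈_   : Rel ℝ ℓ₁
    _<_   : Rel ℝ ℓ₂
    _+_   : Op₂ ℝ
    _*_   : Op₂ ℝ
    -_    : Op₁ ℝ
    0#    : ℝ
    1#    : ℝ
    isStrictPartialOrder : IsStrictPartialOrder _≈_ _<_
    isHeytingField       : IsHeytingField _≈_ (λ x y → x < y ⊎ y < x) _+_ _*_ -_ 0# 1#
    +-monoˡ-<            : ∀ {x y} z → x < y → x + z < y + z
    *-pos                : ∀ {x y} → 0# < x → 0# < y → 0# < x * y

  open IsHeytingField isHeytingField public
    using (isCommutativeRing; #-cotrans; #⇒invertible; invertible⇒#; tight)

  ℝ-heytingField : HeytingField c ℓ₁ ℓ₂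
  ℝ-heytingField = record { isHeytingField = isHeytingField }

  ℝ-commutativeRing : CommutativeRing c ℓ₁
  ℝ-commutativeRing = record { isCommutativeRing = isCommutativeRing }

  open CommutativeRing ℝ-commutativeRing public using (_-_)
  open CommutativeRing ℝ-commutativeRing using (semiring; +-monoid)
  open import Algebra.Properties.Semiring.Exp semiring public using (_^_)
  open import Algebra.Properties.Semiring.Mult semiring public using () renaming (_×_ to _×ⁿ_)
  open import Algebra.Properties.Monoid.Sum +-monoid public using () renaming (sum to ∑ℝ)

  _≤_ : Rel ℝ ℓ₂
  x ≤ y = ¬ (y < x)

  fromℕ-ℝ : ℕ → ℝ
  fromℕ-ℝ n = n ×ⁿ 1#

  -- Quantifying over all ordered pairs (m , n) makes this a bound on the
  -- absolute value of the difference.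
  IsCauchy : (ℕ → ℝ) → Set (c ⊔ ℓ₂)
  IsCauchy s = ∀ ε → 0# < ε → ∃ λ N → ∀ m n → N ℕ.≤ m → N ℕ.≤ n → s m < s n + ε

  ConvergesTo : (ℕ → ℝ) → ℝ → Set (c ⊔ ℓ₂)
  ConvergesTo s l = ∀ ε → 0# < ε → ∃ λ N → ∀ n → N ℕ.≤ n → s n < l + ε × l < s n + ε

record RealField c ℓ₁ ℓ₂ : Set (lsuc (c ⊔ ℓ₁ ⊔ ℓ₂)) where
  field
    orderedField : OrderedField c ℓ₁ ℓ₂

  open OrderedField orderedField public

  field
    archimedean : ∀ x → ∃ λ n → x < fromℕ-ℝ n
    complete    : ∀ s → IsCauchy s → ∃ λ l → ConvergesTo s l

------------------------------------------------------------------------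

module Analysis {c ℓ₁ ℓ₂} (R : RealField c ℓ₁ ℓ₂) where

  open RealField R public

  private
    module ℝᵣ = CommutativeRing ℝ-commutativeRing
    module < = IsStrictPartialOrder isStrictPartialOrder
    open ℝᵣ using (refl; sym; trans; +-cong; +-congˡ; +-congʳ; *-cong; *-congˡ; *-congʳ)
    open import Algebra.Properties.Ring ℝᵣ.ring using (-‿distribˡ-*; -‿distribʳ-*; -0#≈0#)
    open import Algebra.Properties.AbelianGroup ℝᵣ.+-abelianGroup using (⁻¹-involutive; ⁻¹-∙-comm)
    open import Algebra.Properties.Semiring.Mult ℝᵣ.semiring using (×1-homo-*; ×-homo-+)
    open import Algebra.Properties.Monoid.Sum ℝᵣ.+-monoid using (sum-init-last; sum-cong-≗)
    open import Algebra.Solver.Ring.NaturalCoefficients.Default ℝᵣ.commutativeSemiring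
      using (solve; _:=_; _:+_; _:*_; con)
    open import Algebra.Apartness.Properties.HeytingCommutativeRing
      (HeytingField.heytingCommutativeRing ℝ-heytingField)
      using (1#0; x-0≈x; invertibleˡ⇒#)
    open import Relation.Binary.Reasoning.Setoid ℝᵣ.setoid

  module OrderProperties where

    <⇒≤ : ∀ {x y} → x < y → x ≤ y
    <⇒≤ p q = <.irrefl refl (<.trans p q)

    <-respˡ : ∀ {x y z} → x ≈ y → x < z → y < z
    <-respˡ = <.<-respˡ-≈

    <-respʳ : ∀ {x y z} → y ≈ z → x < y → x < z
    <-respʳ = <.<-respʳ-≈

    ≤-resp : ∀ {x x′ y y′} → x ≈ x′ → y ≈ y′ → x ≤ y → x′ ≤ y′
    ≤-resp p q x≤y r = x≤y (<-respˡ (sym q) (<-respʳ (sym p) r))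

    ≤-refl : ∀ {x} → x ≤ x
    ≤-refl = <.irrefl refl

    weaklyLinear : ∀ {x y} → x < y → ∀ z → x < z ⊎ z < y
    weaklyLinear x<y z with #-cotrans (inj₁ x<y) z
    ... | inj₁ (inj₁ x<z) = inj₁ x<z
    ... | inj₁ (inj₂ z<x) = inj₂ (<.trans z<x x<y)
    ... | inj₂ (inj₁ z<y) = inj₂ z<y
    ... | inj₂ (inj₂ y<z) = inj₁ (<.trans x<y y<z)

    ≤-<-trans : ∀ {x y z} → x ≤ y → y < z → x < z
    ≤-<-trans {x} x≤y y<z = [ (λ y<x → contradiction y<x x≤y) , (λ x<z → x<z) ]′ (weaklyLinear y<z x)

    <-≤-trans : ∀ {x y z} → x < y → y ≤ z → x < z
    <-≤-trans {z = z} x<y y≤z = [ (λ x<z → x<z) , (λ z<y → contradiction z<y y≤z) ]′ (weaklyLinear x<y z)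

    ≤-trans : ∀ {x y z} → x ≤ y → y ≤ z → x ≤ z
    ≤-trans x≤y y≤z z<x = x≤y (≤-<-trans y≤z z<x)

    +-cancelʳ-< : ∀ {x y} z → x + z < y + z → x < y
    +-cancelʳ-< {x} {y} z p = <-respˡ (lem x) (<-respʳ (lem y) (+-monoˡ-< (- z) p))
      where
      lem : ∀ x → (x + z) + - z ≈ x
      lem x = trans (ℝᵣ.+-assoc x z (- z)) (trans (+-congˡ (ℝᵣ.-‿inverseʳ z)) (ℝᵣ.+-identityʳ x))

    +-monoˡ-≤ : ∀ {x y} z → x ≤ y → x + z ≤ y + z
    +-monoˡ-≤ z x≤y p = x≤y (+-cancelʳ-< z p)

    +-monoʳ-≤ : ∀ {x y} z → x ≤ y → z + x ≤ z + y
    +-monoʳ-≤ z x≤y = ≤-resp (ℝᵣ.+-comm _ z) (ℝᵣ.+-comm _ z) (+-monoˡ-≤ z x≤y)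

    x≤x+y : ∀ {x y} → 0# ≤ y → x ≤ x + y
    x≤x+y {x} 0≤y = ≤-resp (ℝᵣ.+-identityʳ x) refl (+-monoʳ-≤ x 0≤y)

    +-nonneg : ∀ {x y} → 0# ≤ x → 0# ≤ y → 0# ≤ x + y
    +-nonneg 0≤x 0≤y = ≤-trans 0≤x (x≤x+y 0≤y)

    halve-nonneg : ∀ {x} → 0# ≤ x + x → 0# ≤ x
    halve-nonneg {x} 0≤2x x<0 =
      0≤2x (<.trans (+-monoˡ-< x x<0) (<-respˡ (sym (ℝᵣ.+-identityˡ x)) x<0))

    0#x*y⇒0<x : ∀ {x y} → 0# ≤ x → x * y < 0# → 0# < x
    0#x*y⇒0<x {x} {y} 0≤x xy<0 with #⇒invertible (inj₁ xy<0)
    ... | u , u*xy≈1 , _ = [ (λ x<0 → contradiction x<0 0≤x) , (λ 0<x → 0<x) ]′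
      (invertibleˡ⇒# (y * u , (begin
        y * u * (x - 0#)    ≈⟨ *-congˡ (x-0≈x x) ⟩
        y * u * x           ≈⟨ solve 3 (λ x y u → y :* u :* x := u :* (x :* y)) refl x y u ⟩
        u * (x * y)         ≈⟨ *-congˡ (x-0≈x (x * y)) ⟨
        u * (x * y - 0#)    ≈⟨ u*xy≈1 ⟩
        1#                  ∎)))

    *-nonneg : ∀ {x y} → 0# ≤ x → 0# ≤ y → 0# ≤ x * y
    *-nonneg {x} {y} 0≤x 0≤y xy<0 =
      <.irrefl refl (<.trans (*-pos 0<x 0<y) xy<0)
      where
      0<x = 0#x*y⇒0<x 0≤x xy<0
      0<y = 0#x*y⇒0<x 0≤y (<-respˡ (ℝᵣ.*-comm x y) xy<0)

    x<0⇒0<-x : ∀ {x} → x < 0# → 0# < - x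
    x<0⇒0<-x {x} x<0 = <-respˡ (ℝᵣ.-‿inverseʳ x) (<-respʳ (ℝᵣ.+-identityˡ (- x)) (+-monoˡ-< (- x) x<0))

    0<1 : 0# < 1#
    0<1 = [ (λ 1<0 → <-respʳ (begin
        - 1# * - 1#    ≈⟨ -‿distribˡ-* 1# (- 1#) ⟨
        - (1# * - 1#)  ≈⟨ ℝᵣ.-‿cong (ℝᵣ.*-identityˡ (- 1#)) ⟩
        - - 1#         ≈⟨ ⁻¹-involutive 1# ⟩
        1#             ∎) (*-pos (x<0⇒0<-x 1<0) (x<0⇒0<-x 1<0))) , (λ 0<1 → 0<1) ]′ 1#0

    0≤fromℕ : ∀ n → 0# ≤ fromℕ-ℝ n
    0≤fromℕ zero    = ≤-refl
    0≤fromℕ (suc n) = +-nonneg (<⇒≤ 0<1) (0≤fromℕ n)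

    0<fromℕ : ∀ n → 0# < fromℕ-ℝ (suc n)
    0<fromℕ n = <-≤-trans 0<1 (x≤x+y (0≤fromℕ n))

    fromℕ-mono : ∀ {m n} → m ℕ.≤ n → fromℕ-ℝ m ≤ fromℕ-ℝ n
    fromℕ-mono {n = n} z≤n = 0≤fromℕ n
    fromℕ-mono (s≤s p)     = +-monoʳ-≤ 1# (fromℕ-mono p)

    *-monoˡ-≤ : ∀ {x y z} → 0# ≤ z → x ≤ y → x * z ≤ y * z
    *-monoˡ-≤ {x} {y} {z} 0≤z x≤y = ≤-resp (ℝᵣ.+-identityʳ (x * z)) (begin
        x * z + (y - x) * z        ≈⟨ ℝᵣ.distribʳ z x (y - x) ⟨
        (x + (y - x)) * z          ≈⟨ *-congʳ (begin
          x + (y - x)                ≈⟨ solve 3 (λ x y n → x :+ (y :+ n) := y :+ (x :+ n)) refl x y (- x) ⟩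
          y + (x - x)                ≈⟨ +-congˡ (ℝᵣ.-‿inverseʳ x) ⟩
          y + 0#                     ≈⟨ ℝᵣ.+-identityʳ y ⟩
          y                          ∎) ⟩
        y * z                      ∎)
      (+-monoʳ-≤ (x * z) (*-nonneg (≤-resp (ℝᵣ.-‿inverseʳ x) refl (+-monoˡ-≤ (- x) x≤y)) 0≤z))

    invPos : ∀ {x} → 0# < x → ∃ λ y → x * y ≈ 1#
    invPos {x} 0<x with #⇒invertible (inj₂ 0<x)
    ... | y , _ , xy≈1 = y , trans (*-congʳ (sym (x-0≈x x))) xy≈1

    invPos-pos : ∀ {x y} → 0# < x → x * y ≈ 1# → 0# < y
    invPos-pos {x} {y} 0<x xy≈1 =
      [ (λ y<0 → contradiction (<-respʳ (begin
            x * - y          ≈⟨ -‿distribʳ-* x y ⟨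
            - (x * y)        ≈⟨ ℝᵣ.-‿cong xy≈1 ⟩
            - 1#             ∎) (*-pos 0<x (x<0⇒0<-x y<0)))
          (λ 0<-1 → <.irrefl refl (<.trans 0<1
             (<-respˡ (ℝᵣ.+-identityˡ 1#) (<-respʳ (ℝᵣ.-‿inverseˡ 1#) (+-monoˡ-< 1# 0<-1))))))
      , (λ 0<y → 0<y) ]′
      (invertibleˡ⇒# (x , trans (*-congˡ (x-0≈x y)) xy≈1))

  open OrderProperties

  recip : (n : ℕ) .{{_ : NonZero n}} → ℝ
  recip (suc n) = proj₁ (invPos (0<fromℕ n))

  infixl 7 _/ℕ_
  _/ℕ_ : ℝ → (n : ℕ) .{{_ : NonZero n}} → ℝ
  x /ℕ n = x * recip n

  fromℕ*recip : ∀ n .{{_ : NonZero n}} → fromℕ-ℝ n * recip n ≈ 1#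
  fromℕ*recip (suc n) = proj₂ (invPos (0<fromℕ n))

  0<recip : ∀ n .{{_ : NonZero n}} → 0# < recip n
  0<recip n@(suc n-1) = invPos-pos (0<fromℕ n-1) (fromℕ*recip n)

  -- The coefficients of e^{at} as a power series in t.
  expSeries : ℝ → ℕ → ℝ
  expSeries a n = _/ℕ_ (a ^ n) (n !) {{n ℕ.!≢0}}

  expPartialSum : ℝ → ℕ → ℝ
  expPartialSum x n = ∑ℝ {n} (λ i → expSeries x (toℕ i))

  module ExpConvergence where

    sum-snoc : ∀ (a : ℕ → ℝ) n → ∑ℝ {suc n} (a ∘ toℕ) ≈ ∑ℝ {n} (a ∘ toℕ) + a n
    sum-snoc a n = begin
      ∑ℝ {suc n} (a ∘ toℕ)                              ≈⟨ sum-init-last {n} (a ∘ toℕ) ⟩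
      ∑ℝ {n} (a ∘ toℕ ∘ inject₁) + a (toℕ (fromℕ n))    ≡⟨ ≡.cong₂ _+_
        (sum-cong-≗ {n} (λ i → ≡.cong a (toℕ-inject₁ i))) (≡.cong a (toℕ-fromℕ n)) ⟩
      ∑ℝ {n} (a ∘ toℕ) + a n                            ∎

    -- Bounded b a says |a| ≤ b, with the two slacks as witnesses.
    record Bounded (b a : ℝ) : Set (c ⊔ ℓ₁ ⊔ ℓ₂) where
      constructor bounded
      field
        upper lower     : ℝ
        0≤upper         : 0# ≤ upper
        0≤lower         : 0# ≤ lower
        a+upper≈b       : a + upper ≈ b
        lower≈a+b       : lower ≈ a + b

    open Bounded

    bounded-* : ∀ {b a d c} → Bounded b a → Bounded d c → Bounded (b * d) (a * c)
    bounded-* {b} {a} {d} {c} (bounded v u 0≤v 0≤u av≈b u≈) (bounded w s 0≤w 0≤s cw≈d s≈) =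
      bounded V U
        (halve-nonneg (≤-resp refl (trans (+-cong (*-congˡ s≈′) (*-congʳ u≈′))
          (solve 4 (λ a c v w →
             v :* (c :+ (c :+ w)) :+ (a :+ (a :+ v)) :* w :=
             (a :* w :+ v :* c :+ v :* w) :+ (a :* w :+ v :* c :+ v :* w)) refl a c v w))
          (+-nonneg (*-nonneg 0≤v 0≤s) (*-nonneg 0≤u 0≤w))))
        (halve-nonneg (≤-resp refl (trans (+-congʳ (*-cong u≈′ s≈′))
          (solve 4 (λ a c v w →
             (a :+ (a :+ v)) :* (c :+ (c :+ w)) :+ v :* w :=
             (a :* c :+ (a :* c :+ (a :* w :+ v :* c :+ v :* w))) :+
             (a :* c :+ (a :* c :+ (a :* w :+ v :* c :+ v :* w)))) refl a c v w))
          (+-nonneg (*-nonneg 0≤u 0≤s) (*-nonneg 0≤v 0≤w))))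
        ac+V≈bd
        (+-congˡ ac+V≈bd)
      where
      V U : ℝ
      V = a * w + v * c + v * w
      U = a * c + (a * c + V)
      s≈′ : s ≈ c + (c + w)
      s≈′ = trans s≈ (+-congˡ (sym cw≈d))
      u≈′ : u ≈ a + (a + v)
      u≈′ = trans u≈ (+-congˡ (sym av≈b))
      ac+V≈bd : a * c + V ≈ b * d
      ac+V≈bd = trans
        (solve 4 (λ a c v w → a :* c :+ (a :* w :+ v :* c :+ v :* w) := (a :+ v) :* (c :+ w)) refl a c v w)
        (*-cong av≈b cw≈d)

    bounded-self : ∀ {x} → 0# ≤ x → Bounded x x
    bounded-self 0≤x = bounded 0# (_ + _) ≤-refl (+-nonneg 0≤x 0≤x) (ℝᵣ.+-identityʳ _) refl

    bounded-^ : ∀ {b a} → Bounded b a → ∀ n → Bounded (b ^ n) (a ^ n)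
    bounded-^ p zero    = bounded-self (<⇒≤ 0<1)
    bounded-^ p (suc n) = bounded-* p (bounded-^ p n)

    bounded-resp : ∀ {b a a′} → a ≈ a′ → Bounded b a → Bounded b a′
    bounded-resp e (bounded v u 0≤v 0≤u p q) =
      bounded v u 0≤v 0≤u (trans (+-congʳ (sym e)) p) (trans q (+-congʳ e))

    bounded-mono : ∀ {b b′ a} → b ≤ b′ → Bounded b a → Bounded b′ a
    bounded-mono {b} {b′} {a} b≤b′ (bounded v u 0≤v 0≤u p q) =
      bounded (v + δ) (u + δ) (+-nonneg 0≤v 0≤δ) (+-nonneg 0≤u 0≤δ)
        (trans (sym (ℝᵣ.+-assoc a v δ)) (trans (+-congʳ p) b+δ≈b′))
        (trans (+-congʳ q) (trans (ℝᵣ.+-assoc a b δ) (+-congˡ b+δ≈b′)))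
      where
      δ : ℝ
      δ = b′ - b
      0≤δ : 0# ≤ δ
      0≤δ = ≤-resp (ℝᵣ.-‿inverseʳ b) refl (+-monoˡ-≤ (- b) b≤b′)
      b+δ≈b′ : b + δ ≈ b′
      b+δ≈b′ = trans (solve 3 (λ x y n → x :+ (y :+ n) := y :+ (x :+ n)) refl b b′ (- b))
        (trans (+-congˡ (ℝᵣ.-‿inverseʳ b)) (ℝᵣ.+-identityʳ b′))

    natBound : ∀ x → ∃ λ n → Bounded (fromℕ-ℝ n) x
    natBound x = m ℕ.+ n , bounded (M + N - x) (x + (M + N))
      (<⇒≤ (<-respˡ (ℝᵣ.-‿inverseʳ x) (+-monoˡ-< (- x)
        (<-≤-trans x<M (x≤x+y (0≤fromℕ n))))))
      (<⇒≤ (<-respˡ (ℝᵣ.-‿inverseˡ x) (<-respʳ (ℝᵣ.+-comm (M + N) x) (+-monoˡ-< x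
        (<-≤-trans -x<N (≤-resp refl (ℝᵣ.+-comm N M) (x≤x+y (0≤fromℕ m))))))))
      (trans (solve 3 (λ x k n → x :+ (k :+ n) := k :+ (x :+ n)) refl x (M + N) (- x))
        (trans (+-congˡ (ℝᵣ.-‿inverseʳ x)) (trans (ℝᵣ.+-identityʳ (M + N)) M+N≈)))
      (+-congˡ M+N≈)
      where
      m = proj₁ (archimedean x)
      n = proj₁ (archimedean (- x))
      x<M = proj₂ (archimedean x)
      -x<N = proj₂ (archimedean (- x))
      M N : ℝ
      M = fromℕ-ℝ m
      N = fromℕ-ℝ n
      M+N≈ : M + N ≈ fromℕ-ℝ (m ℕ.+ n)
      M+N≈ = sym (×-homo-+ 1# m n)

    fromℕ-^ : ∀ m n → fromℕ-ℝ (m ℕ.^ n) ≈ fromℕ-ℝ m ^ n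
    fromℕ-^ m zero    = ℝᵣ.+-identityʳ 1#
    fromℕ-^ m (suc n) = trans (×1-homo-* m (m ℕ.^ n)) (*-congˡ (fromℕ-^ m n))

    pow≤pow*! : ∀ a n → a ℕ.^ n ℕ.≤ a ℕ.^ a ℕ.* n !
    pow≤pow*! zero      zero    = s≤s z≤n
    pow≤pow*! a@(suc _) zero    = ℕ.≤-trans (ℕ.m^n>0 a a) (ℕ.≤-reflexive (≡.sym (ℕ.*-identityʳ _)))
    pow≤pow*! a (suc n) with ℕ.≤-total (suc n) a
    ... | inj₁ 1+n≤a = ℕ.≤-trans (ℕ.^-monoʳ-≤ a {{a≢0}} 1+n≤a)
                         (ℕ.m≤m*n (a ℕ.^ a) (suc n !) {{suc n ℕ.!≢0}})
      where
      a≢0 : NonZero a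
      a≢0 = ℕ.>-nonZero (ℕ.<-≤-trans (s≤s z≤n) 1+n≤a)
    ... | inj₂ a≤1+n = ℕ.≤-trans (ℕ.*-mono-≤ a≤1+n (pow≤pow*! a n))
                         (ℕ.≤-reflexive (lem (suc n) (a ℕ.^ a) (n !)))
      where
      lem : ∀ x y z → x ℕ.* (y ℕ.* z) ≡ y ℕ.* (x ℕ.* z)
      lem x y z = ≡.trans (≡.sym (ℕ.*-assoc x y z))
        (≡.trans (≡.cong (ℕ._* z) (ℕ.*-comm x y)) (ℕ.*-assoc y x z))

    n≤2^n : ∀ n → n ℕ.≤ 2 ℕ.^ n
    n≤2^n zero    = z≤n
    n≤2^n (suc n) = ℕ.≤-trans (ℕ.+-mono-≤ (ℕ.m^n>0 2 n) (n≤2^n n))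
      (ℕ.≤-reflexive (≡.cong (2 ℕ.^ n ℕ.+_) (≡.sym (ℕ.+-identityʳ (2 ℕ.^ n)))))

    h : ℝ
    h = recip 2

    h+h≈1 : h + h ≈ 1#
    h+h≈1 = trans (solve 1 (λ h → h :+ h := con 2 :* h) refl h)
      (trans (*-congʳ (+-congˡ (sym (ℝᵣ.+-identityʳ 1#)))) (fromℕ*recip 2))

    0<h^ : ∀ n → 0# < h ^ n
    0<h^ zero    = 0<1
    0<h^ (suc n) = *-pos (0<recip 2) (0<h^ n)

    ^-distrib-* : ∀ x y n → (x * y) ^ n ≈ x ^ n * y ^ n
    ^-distrib-* x y zero    = sym (ℝᵣ.*-identityˡ 1#)
    ^-distrib-* x y (suc n) = trans (*-congˡ (^-distrib-* x y n))
      (solve 4 (λ x y p q → x :* y :* (p :* q) := x :* p :* (y :* q)) refl x y (x ^ n) (y ^ n))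

    ^-cong : ∀ {x y} → x ≈ y → ∀ n → x ^ n ≈ y ^ n
    ^-cong e zero    = refl
    ^-cong e (suc n) = *-cong e (^-cong e n)

    h^n*2^n≈1 : ∀ n → h ^ n * fromℕ-ℝ (2 ℕ.^ n) ≈ 1#
    h^n*2^n≈1 n = begin
      h ^ n * fromℕ-ℝ (2 ℕ.^ n)  ≈⟨ *-congˡ (fromℕ-^ 2 n) ⟩
      h ^ n * fromℕ-ℝ 2 ^ n      ≈⟨ ^-distrib-* h (fromℕ-ℝ 2) n ⟨
      (h * fromℕ-ℝ 2) ^ n        ≈⟨ ^-cong (trans (ℝᵣ.*-comm h _) (fromℕ*recip 2)) n ⟩
      1# ^ n                     ≈⟨ 1^n n ⟩
      1#                         ∎
      where
      1^n : ∀ n → 1# ^ n ≈ 1#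
      1^n zero    = refl
      1^n (suc n) = trans (ℝᵣ.*-identityˡ _) (1^n n)

    -- |xⁿ/n!| ≤ D·2⁻ⁿ, because |2x|ⁿ ≤ D·n!.
    expSeries-bound : ∀ x → ∃ λ D → 0# ≤ D × (∀ n → Bounded (h ^ n * D) (expSeries x n))
    expSeries-bound x = D , 0≤fromℕ (a ℕ.^ a) , bound
      where
      y = x + x
      a = proj₁ (natBound y)
      D = fromℕ-ℝ (a ℕ.^ a)
      module _ (n : ℕ) where
        instance n!≢0 = n ℕ.!≢0
        k : ℝ
        k = recip (n !)
        0≤k : 0# ≤ k
        0≤k = <⇒≤ (0<recip (n !))
        le : fromℕ-ℝ a ^ n * k ≤ D
        le = ≤-resp (*-congʳ (fromℕ-^ a n))
          (trans (*-congʳ (×1-homo-* (a ℕ.^ a) (n !)))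
            (trans (ℝᵣ.*-assoc D _ k) (trans (*-congˡ (fromℕ*recip (n !))) (ℝᵣ.*-identityʳ D))))
          (*-monoˡ-≤ 0≤k (fromℕ-mono (pow≤pow*! a n)))
        hy≈x : h * y ≈ x
        hy≈x = trans (solve 2 (λ h x → h :* (x :+ x) := (h :+ h) :* x) refl h x)
          (trans (*-congʳ h+h≈1) (ℝᵣ.*-identityˡ x))
        bound : Bounded (h ^ n * D) (expSeries x n)
        bound = bounded-resp
          (begin
            h ^ n * (y ^ n * k)  ≈⟨ ℝᵣ.*-assoc _ _ k ⟨
            h ^ n * y ^ n * k    ≈⟨ *-congʳ (^-distrib-* h y n) ⟨
            (h * y) ^ n * k      ≈⟨ *-congʳ (^-cong hy≈x n) ⟩
            x ^ n * k            ∎)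
          (bounded-* (bounded-self (<⇒≤ (0<h^ n)))
            (bounded-mono le (bounded-* (bounded-^ (proj₂ (natBound y)) n) (bounded-self 0≤k))))

    module ExpCauchy (x : ℝ) where
      D : ℝ
      D = proj₁ (expSeries-bound x)
      0≤D : 0# ≤ D
      0≤D = proj₁ (proj₂ (expSeries-bound x))
      t s g e : ℕ → ℝ
      t = expSeries x
      s = expPartialSum x
      g n = h ^ n * D
      e n = g n + g n
      tb : ∀ n → Bounded (g n) (t n)
      tb = proj₂ (proj₂ (expSeries-bound x))

      0≤e : ∀ n → 0# ≤ e n
      0≤e n = +-nonneg 0≤g 0≤g
        where 0≤g = *-nonneg (<⇒≤ (0<h^ n)) 0≤D

      e-step : ∀ n → e (suc n) ≈ g n
      e-step n = trans (solve 3 (λ h p D → h :* p :* D :+ h :* p :* D := (h :+ h) :* (p :* D)) refl h (h ^ n) D)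
        (trans (*-congʳ h+h≈1) (ℝᵣ.*-identityˡ (g n)))

      up : ∀ n → s (suc n) + e (suc n) ≤ s n + e n
      up n = ≤-resp refl (begin
          s (suc n) + e (suc n) + upper (tb n)     ≈⟨ +-congʳ (+-cong (sum-snoc t n) (e-step n)) ⟩
          s n + t n + g n + upper (tb n)
            ≈⟨ solve 4 (λ s t g v → s :+ t :+ g :+ v := s :+ (g :+ (t :+ v))) refl (s n) (t n) (g n) (upper (tb n)) ⟩
          s n + (g n + (t n + upper (tb n)))       ≈⟨ +-congˡ (+-congˡ (a+upper≈b (tb n))) ⟩
          s n + e n                                ∎)
        (x≤x+y (0≤upper (tb n)))

      down : ∀ n → s n + e (suc n) ≤ s (suc n) + e n
      down n = ≤-resp refl (begin
          s n + e (suc n) + lower (tb n)    ≈⟨ +-cong (+-congˡ (e-step n)) (lower≈a+b (tb n)) ⟩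
          s n + g n + (t n + g n)
            ≈⟨ solve 3 (λ s t g → s :+ g :+ (t :+ g) := s :+ t :+ (g :+ g)) refl (s n) (t n) (g n) ⟩
          s n + t n + e n                   ≈⟨ +-congʳ (sum-snoc t n) ⟨
          s (suc n) + e n                   ∎)
        (x≤x+y (0≤lower (tb n)))

      ups : ∀ k n → s (k ℕ.+ n) + e (k ℕ.+ n) ≤ s n + e n
      ups zero    n = ≤-refl
      ups (suc k) n = ≤-trans (up (k ℕ.+ n)) (ups k n)

      +-cancelʳ-≤ : ∀ {x y} z → x + z ≤ y + z → x ≤ y
      +-cancelʳ-≤ z p q = p (+-monoˡ-< z q)

      downs : ∀ k n → s n + e (k ℕ.+ n) ≤ s (k ℕ.+ n) + e n
      downs zero    n = ≤-refl
      downs (suc k) n = +-cancelʳ-≤ (e m) (≤-resp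
          (solve 3 (λ a b c → a :+ b :+ c := a :+ c :+ b) refl (s n) (e m) (e (suc m)))
          refl
          (≤-trans (+-monoˡ-≤ (e (suc m)) (downs k n))
            (≤-resp (solve 3 (λ a b c → a :+ b :+ c := a :+ c :+ b) refl (s m) (e (suc m)) (e n))
                    (solve 3 (λ a b c → a :+ b :+ c := a :+ c :+ b) refl (s (suc m)) (e m) (e n))
                    (+-monoˡ-≤ (e n) (down m)))))
        where m = k ℕ.+ n

      upper-bound : ∀ {m N} → N ℕ.≤ m → s m ≤ s N + e N
      upper-bound {m} {N} N≤m =
        ≡.subst (λ j → s j ≤ s N + e N) (ℕ.m∸n+n≡m N≤m)
          (≤-trans (x≤x+y (0≤e (m ℕ.∸ N ℕ.+ N))) (ups (m ℕ.∸ N) N))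

      lower-bound : ∀ {m N} → N ℕ.≤ m → s N ≤ s m + e N
      lower-bound {m} {N} N≤m =
        ≡.subst (λ j → s N ≤ s j + e N) (ℕ.m∸n+n≡m N≤m)
          (≤-trans (x≤x+y (0≤e (m ℕ.∸ N ℕ.+ N))) (downs (m ℕ.∸ N) N))

      small : ∀ ε → 0# < ε → ∃ λ N → e N + e N < ε
      small ε 0<ε = N , <-≤-trans
          (<-respˡ hK≈ (<-respʳ refl (*-monoʳ-< (0<h^ N) K<Nε)))
          (≤-resp refl (trans (sym (ℝᵣ.*-assoc _ _ ε)) (trans (*-congʳ (h^n*2^n≈1 N)) (ℝᵣ.*-identityˡ ε)))
            (≤-resp (ℝᵣ.*-comm _ _) (ℝᵣ.*-comm _ _) (*-monoˡ-≤ (<⇒≤ (0<h^ N))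
              (*-monoˡ-≤ (<⇒≤ 0<ε) (fromℕ-mono (n≤2^n N))))))
        where
        K : ℝ
        K = D + D + (D + D)
        u = proj₁ (invPos 0<ε)
        εu≈1 = proj₂ (invPos 0<ε)
        N = proj₁ (archimedean (K * u))
        *-monoʳ-< : ∀ {x y z} → 0# < z → x < y → z * x < z * y
        *-monoʳ-< {x} {y} {z} 0<z x<y =
          <-respˡ (ℝᵣ.+-identityˡ (z * x)) (<-respʳ (begin
            z * (y - x) + z * x   ≈⟨ ℝᵣ.distribˡ z (y - x) x ⟨
            z * (y - x + x)       ≈⟨ *-congˡ (trans (ℝᵣ.+-assoc y (- x) x)
                                       (trans (+-congˡ (ℝᵣ.-‿inverseˡ x)) (ℝᵣ.+-identityʳ y))) ⟩
            z * y                 ∎)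
          (+-monoˡ-< (z * x) (*-pos 0<z (<-respˡ (ℝᵣ.-‿inverseʳ x) (+-monoˡ-< (- x) x<y)))))
        K<Nε : K < fromℕ-ℝ N * ε
        K<Nε = <-respˡ (begin
            ε * (K * u)    ≈⟨ solve 3 (λ ε K u → ε :* (K :* u) := K :* (ε :* u)) refl ε K u ⟩
            K * (ε * u)    ≈⟨ *-congˡ εu≈1 ⟩
            K * 1#         ≈⟨ ℝᵣ.*-identityʳ K ⟩
            K              ∎)
          (<-respʳ (ℝᵣ.*-comm ε _) (*-monoʳ-< 0<ε (proj₂ (archimedean (K * u)))))
        hK≈ : h ^ N * K ≈ e N + e N
        hK≈ = solve 2 (λ p D → p :* (D :+ D :+ (D :+ D)) := (p :* D :+ p :* D) :+ (p :* D :+ p :* D)) refl (h ^ N) D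

      isCauchy : IsCauchy s
      isCauchy ε 0<ε = N , λ m n N≤m N≤n →
        ≤-<-trans (≤-trans (upper-bound N≤m) (≤-resp refl (ℝᵣ.+-assoc (s n) (e N) (e N))
                    (+-monoˡ-≤ (e N) (lower-bound N≤n))))
          (<-respˡ (ℝᵣ.+-comm _ (s n)) (<-respʳ (ℝᵣ.+-comm ε (s n)) (+-monoˡ-< (s n) 2e<ε)))
        where
        N = proj₁ (small ε 0<ε)
        2e<ε = proj₂ (small ε 0<ε)

  open ExpConvergence using (module ExpCauchy)

  expPartialSum-isCauchy : ∀ x → IsCauchy (expPartialSum x)
  expPartialSum-isCauchy = ExpCauchy.isCauchy

  exp : ℝ → ℝ
  exp x = proj₁ (complete (expPartialSum x) (expPartialSum-isCauchy x))

  exp-converges : ∀ x → ConvergesTo (expPartialSum x) (exp x)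
  exp-converges x = proj₂ (complete (expPartialSum x) (expPartialSum-isCauchy x))

  ----------------------------------------------------------------------

  infix 4 _≈ᶜ_
  infixl 6 _+ᶜ_
  infixl 7 _*ᶜ_
  infixr 7 _·_
  infix  8 -ᶜ_

  record ℂ : Set c where
    constructor _+i_
    field
      re im : ℝ
  open ℂ public

  record _≈ᶜ_ (z w : ℂ) : Set ℓ₁ where
    constructor _,_
    field
      re≈ : re z ≈ re w
      im≈ : im z ≈ im w
  open _≈ᶜ_ public

  _+ᶜ_ _*ᶜ_ : Op₂ ℂ
  z +ᶜ w = (re z + re w) +i (im z + im w)
  z *ᶜ w = (re z * re w - im z * im w) +i (re z * im w + im z * re w)

  -ᶜ_ conj : Op₁ ℂ
  -ᶜ z = (- re z) +i (- im z)
  conj z = re z +i (- im z)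

  0ᶜ 1ᶜ : ℂ
  0ᶜ = 0# +i 0#
  1ᶜ = 1# +i 0#

  _·_ : ℝ → ℂ → ℂ
  x · z = (x * re z) +i (x * im z)

  private
    -- Replaces - x by (- 1#) * x, with - 1# an atom, so that the semiring
    -- solver applies: the ring laws hold over R[i] for any value of i².
    n : ℝ
    n = - 1#

    a-b≈a+nb : ∀ a b → a - b ≈ a + n * b
    a-b≈a+nb a b = +-congˡ (trans (ℝᵣ.-‿cong (sym (ℝᵣ.*-identityˡ b))) (-‿distribˡ-* 1# b))

    *ᶜ-re : ∀ z w → re (z *ᶜ w) ≈ re z * re w + n * (im z * im w)
    *ᶜ-re z w = a-b≈a+nb (re z * re w) (im z * im w)

    *ᶜ-cong : ∀ {z z′ w w′} → z ≈ᶜ z′ → w ≈ᶜ w′ → z *ᶜ w ≈ᶜ z′ *ᶜ w′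
    *ᶜ-cong (p , q) (p′ , q′) =
      +-cong (*-cong p p′) (ℝᵣ.-‿cong (*-cong q q′)) , +-cong (*-cong p q′) (*-cong q p′)

    *ᶜ-assoc : ∀ x y z → (x *ᶜ y) *ᶜ z ≈ᶜ x *ᶜ (y *ᶜ z)
    *ᶜ-assoc x@(a +i b) y@(c +i d) z@(e +i f) =
      (begin
        re ((x *ᶜ y) *ᶜ z)
          ≈⟨ trans (*ᶜ-re (x *ᶜ y) z) (+-congʳ (*-congʳ (*ᶜ-re x y))) ⟩
        (a * c + n * (b * d)) * e + n * ((a * d + b * c) * f)
          ≈⟨ solve 7 (λ a b c d e f n →
               (a :* c :+ n :* (b :* d)) :* e :+ n :* ((a :* d :+ b :* c) :* f) :=
               a :* (c :* e :+ n :* (d :* f)) :+ n :* (b :* (c :* f :+ d :* e))) refl a b c d e f n ⟩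
        a * (c * e + n * (d * f)) + n * (b * (c * f + d * e))
          ≈⟨ trans (*ᶜ-re x (y *ᶜ z)) (+-congʳ (*-congˡ (*ᶜ-re y z))) ⟨
        re (x *ᶜ (y *ᶜ z)) ∎)
      , (begin
        im ((x *ᶜ y) *ᶜ z)
          ≈⟨ +-congʳ (*-congʳ (*ᶜ-re x y)) ⟩
        (a * c + n * (b * d)) * f + (a * d + b * c) * e
          ≈⟨ solve 7 (λ a b c d e f n →
               (a :* c :+ n :* (b :* d)) :* f :+ (a :* d :+ b :* c) :* e :=
               a :* (c :* f :+ d :* e) :+ b :* (c :* e :+ n :* (d :* f))) refl a b c d e f n ⟩
        a * (c * f + d * e) + b * (c * e + n * (d * f))
          ≈⟨ +-congˡ (*-congˡ (*ᶜ-re y z)) ⟨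
        im (x *ᶜ (y *ᶜ z)) ∎)

    *ᶜ-comm : ∀ x y → x *ᶜ y ≈ᶜ y *ᶜ x
    *ᶜ-comm x y =
      +-cong (ℝᵣ.*-comm (re x) (re y)) (ℝᵣ.-‿cong (ℝᵣ.*-comm (im x) (im y)))
      , solve 4 (λ a b c d → a :* d :+ b :* c := c :* b :+ d :* a) refl (re x) (im x) (re y) (im y)

    *ᶜ-identityˡ : ∀ x → 1ᶜ *ᶜ x ≈ᶜ x
    *ᶜ-identityˡ x =
      trans (*ᶜ-re 1ᶜ x) (solve 3 (λ a b n → con 1 :* a :+ n :* (con 0 :* b) := a) refl (re x) (im x) n)
      , solve 2 (λ a b → con 1 :* b :+ con 0 :* a := b) refl (re x) (im x)

    *ᶜ-distribˡ : ∀ x y z → x *ᶜ (y +ᶜ z) ≈ᶜ x *ᶜ y +ᶜ x *ᶜ z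
    *ᶜ-distribˡ x y z =
      trans (*ᶜ-re x (y +ᶜ z)) (trans
        (solve 7 (λ a b c d e f n →
           a :* (c :+ e) :+ n :* (b :* (d :+ f)) :=
           (a :* c :+ n :* (b :* d)) :+ (a :* e :+ n :* (b :* f)))
           refl (re x) (im x) (re y) (im y) (re z) (im z) n)
        (sym (+-cong (*ᶜ-re x y) (*ᶜ-re x z))))
      , solve 6 (λ a b c d e f →
           a :* (d :+ f) :+ b :* (c :+ e) := (a :* d :+ b :* c) :+ (a :* f :+ b :* e))
           refl (re x) (im x) (re y) (im y) (re z) (im z)

    ≈ᶜ-isEquivalence : IsEquivalence _≈ᶜ_
    ≈ᶜ-isEquivalence = record
      { refl  = refl , refl
      ; sym   = λ (p , q) → sym p , sym q
      ; trans = λ (p , q) (p′ , q′) → trans p p′ , trans q q′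
      }
    module ≈ᶜ = IsEquivalence ≈ᶜ-isEquivalence

  ℂ-isCommutativeRing : IsCommutativeRing _≈ᶜ_ _+ᶜ_ _*ᶜ_ -ᶜ_ 0ᶜ 1ᶜ
  ℂ-isCommutativeRing = record
    { isRing = record
      { +-isAbelianGroup = record
        { isGroup = record
          { isMonoid = record
            { isSemigroup = record
              { isMagma = record
                { isEquivalence = ≈ᶜ-isEquivalence
                ; ∙-cong = λ (p , q) (p′ , q′) → +-cong p p′ , +-cong q q′
                }
              ; assoc = λ x y z → ℝᵣ.+-assoc _ _ _ , ℝᵣ.+-assoc _ _ _
              }
            ; identity = (λ x → ℝᵣ.+-identityˡ _ , ℝᵣ.+-identityˡ _)
                       , (λ x → ℝᵣ.+-identityʳ _ , ℝᵣ.+-identityʳ _)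
            }
          ; inverse = (λ x → ℝᵣ.-‿inverseˡ _ , ℝᵣ.-‿inverseˡ _)
                    , (λ x → ℝᵣ.-‿inverseʳ _ , ℝᵣ.-‿inverseʳ _)
          ; ⁻¹-cong = λ (p , q) → ℝᵣ.-‿cong p , ℝᵣ.-‿cong q
          }
        ; comm = λ x y → ℝᵣ.+-comm _ _ , ℝᵣ.+-comm _ _
        }
      ; *-cong = *ᶜ-cong
      ; *-assoc = *ᶜ-assoc
      ; *-identity = *ᶜ-identityˡ
                   , (λ x → ≈ᶜ.trans (*ᶜ-comm x 1ᶜ) (*ᶜ-identityˡ x))
      ; distrib = *ᶜ-distribˡ
                , (λ x y z → ≈ᶜ.trans (*ᶜ-comm (y +ᶜ z) x) (≈ᶜ.trans (*ᶜ-distribˡ x y z)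
                     (+-cong (re≈ (*ᶜ-comm x y)) (re≈ (*ᶜ-comm x z))
                     , +-cong (im≈ (*ᶜ-comm x y)) (im≈ (*ᶜ-comm x z)))))
      }
    ; *-comm = *ᶜ-comm
    }

  ℂ-commutativeRing : CommutativeRing c ℓ₁
  ℂ-commutativeRing = record { isCommutativeRing = ℂ-isCommutativeRing }

  private module ℂᵣ = CommutativeRing ℂ-commutativeRing

  open ℂᵣ public using () renaming (_-_ to _-ᶜ_)
  open import Algebra.Definitions.RawMonoid ℂᵣ.+-rawMonoid public using () renaming (sum to ∑ℂ)

  -- |z| ≤ x, squared so as to avoid the square root.
  ∣_∣≤_ : ℂ → ℝ → Set ℓ₂
  ∣ z ∣≤ x = 0# ≤ x × re z * re z + im z * im z ≤ x * x

  HasSum : (ℕ → ℂ) → ℂ → Set (c ⊔ ℓ₂)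
  HasSum a l = ∀ ε → 0# < ε →
    ∃ λ N → ∀ n → N ℕ.≤ n → ∣ ∑ℂ {n} (λ i → a (toℕ i)) -ᶜ l ∣≤ ε

  Summable : (ℕ → ℂ) → Set (c ⊔ ℓ₂)
  Summable a = ∃ λ l → HasSum a l

  ∑∞ : (a : ℕ → ℂ) → Summable a → ℂ
  ∑∞ a = proj₁

  -- F(θ) = O(θᵏ) as θ → 0⁺, for F defined on θ > 0.
  IsBigO⁺ : (∀ θ → 0# < θ → ℂ) → ℕ → Set (c ⊔ ℓ₂)
  IsBigO⁺ F k = ∃ λ C → ∃ λ δ → 0# < δ ×
    (∀ θ (θ>0 : 0# < θ) → θ < δ → ∣ F θ θ>0 ∣≤ (C * θ ^ k))

  ----------------------------------------------------------------------

  record DirichletCharacter (f : ℕ) : Set (c ⊔ ℓ₁) where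
    field
      χ           : ℤ → ℂ
      periodic    : ∀ m → χ (m ℤ.+ ℤ.+ f) ≈ᶜ χ m
      χ1≈1        : χ ℤ.1ℤ ≈ᶜ 1ᶜ
      homo-*      : ∀ m n → χ (m ℤ.* n) ≈ᶜ χ m *ᶜ χ n
      zero-noncop : ∀ m → ¬ ℤ.Coprime m (ℤ.+ f) → χ m ≈ᶜ 0ᶜ
  open DirichletCharacter public renaming (χ to ⟦_⟧)

  private
    conj-cong : ∀ {z w} → z ≈ᶜ w → conj z ≈ᶜ conj w
    conj-cong (p , q) = p , ℝᵣ.-‿cong q

    conj-homo-* : ∀ z w → conj (z *ᶜ w) ≈ᶜ conj z *ᶜ conj w
    conj-homo-* (a +i b) (c +i d) =
      +-congˡ (ℝᵣ.-‿cong (begin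
        b * d            ≈⟨ ⁻¹-involutive (b * d) ⟨
        - - (b * d)      ≈⟨ ℝᵣ.-‿cong (-‿distribʳ-* b d) ⟩
        - (b * - d)      ≈⟨ -‿distribˡ-* b (- d) ⟩
        - b * - d        ∎))
      , (begin
        - (a * d + b * c)        ≈⟨ ⁻¹-∙-comm (a * d) (b * c) ⟨
        - (a * d) + - (b * c)    ≈⟨ +-cong (-‿distribʳ-* a d) (-‿distribˡ-* b c) ⟩
        a * - d + - b * c        ∎)

  conjugate : ∀ {f} → DirichletCharacter f → DirichletCharacter f
  conjugate χ = record
    { χ           = λ m → conj (⟦ χ ⟧ m)
    ; periodic    = λ m → conj-cong (periodic χ m)
    ; χ1≈1        = ≈ᶜ.trans (conj-cong (χ1≈1 χ)) (refl , -0#≈0#)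
    ; homo-*      = λ m n → ≈ᶜ.trans (conj-cong (homo-* χ m n)) (conj-homo-* (⟦ χ ⟧ m) (⟦ χ ⟧ n))
    ; zero-noncop = λ m m⊥̸f → ≈ᶜ.trans (conj-cong (zero-noncop χ m m⊥̸f)) (refl , -0#≈0#)
    }

  InducedBy : ∀ {f d} → DirichletCharacter f → DirichletCharacter d → Set ℓ₁
  InducedBy {f} χ ψ = ∀ m → ℤ.Coprime m (ℤ.+ f) → ⟦ χ ⟧ m ≈ᶜ ⟦ ψ ⟧ m

  -- A primitive character modulo f has conductor f.
  Primitive : ∀ {f} → DirichletCharacter f → Set (c ⊔ ℓ₁)
  Primitive {f} χ = ∀ d → d ℕ.∣ f → (ψ : DirichletCharacter d) → InducedBy χ ψ → d ≡ f

  Nonprincipal : ∀ {f} → DirichletCharacter f → Set ℓ₁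
  Nonprincipal χ = ¬ (∀ m → ⟦ χ ⟧ m ≈ᶜ 1ᶜ)

  ----------------------------------------------------------------------

  -- Quotient of the power series a by the power series d, by long
  -- division; u is the inverse of the constant coefficient of d.
  divideSeries : (d : ℕ → ℝ) (u : ℝ) (a : ℕ → ℂ) → ℕ → ℂ
  divideSeries d u a zero    = u · a 0
  divideSeries d u a (suc n) = divideSeries d u (λ k → a (suc k) -ᶜ d (suc k) · u · a 0) n

  -- The coefficients of ∑_{m<f} χ̄(m) e^{(m+x)t}.
  characterSeries : ∀ {f} → DirichletCharacter f → ℝ → ℕ → ℂ
  characterSeries {f} χ x n =
    ∑ℂ {f} (λ m → expSeries (fromℕ-ℝ (toℕ m) + x) n · conj (⟦ χ ⟧ (ℤ.+ toℕ m)))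

  -- B_{n,χ}(x)/n!, the coefficient of tⁿ in
  --   (∑_{m<f} χ̄(m) e^{(m+x)t}) / ((e^{ft} - 1)/t),
  -- where (e^{ft} - 1)/t is a power series with constant coefficient f.
  -- B-generating below is the generating-function identity itself.
  bernoulliCoefficient : ∀ {f} .{{_ : NonZero f}} → DirichletCharacter f → ℝ → ℕ → ℂ
  bernoulliCoefficient {f} χ x =
    divideSeries (λ n → expSeries (fromℕ-ℝ f) (suc n)) (recip f) (characterSeries χ x)

  B : ∀ {f} .{{_ : NonZero f}} → ℕ → DirichletCharacter f → ℝ → ℂ
  B n χ x = fromℕ-ℝ (n !) · bernoulliCoefficient χ x n

  -- Cauchy product of a real and a complex power series.
  infixl 7 _⊛_
  _⊛_ : (ℕ → ℝ) → (ℕ → ℂ) → ℕ → ℂ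
  (a ⊛ b) n = ∑ℂ {suc n} (λ i → a (n ℕ.∸ toℕ i) · b (toℕ i))

  t× : (ℕ → ℂ) → ℕ → ℂ
  t× a zero    = 0ᶜ
  t× a (suc n) = a n

  e^[_]t-1 : ℝ → ℕ → ℝ
  e^[ a ]t-1 zero    = expSeries a 0 - 1#
  e^[ a ]t-1 (suc n) = expSeries a (suc n)

  private
    module Σᶜ where
      open import Algebra.Properties.Monoid.Sum ℂᵣ.+-monoid public

    ·-cong : ∀ {x y z w} → x ≈ y → z ≈ᶜ w → x · z ≈ᶜ y · w
    ·-cong p (q , r) = *-cong p q , *-cong p r

    0·z≈0 : ∀ {x} z → x ≈ 0# → x · z ≈ᶜ 0ᶜ
    0·z≈0 z p = trans (*-congʳ p) (ℝᵣ.zeroˡ _) , trans (*-congʳ p) (ℝᵣ.zeroˡ _)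

    divide-correct : ∀ d u → d 0 * u ≈ 1# → ∀ a n → (d ⊛ divideSeries d u a) n ≈ᶜ a n
    divide-correct d u du≈1 a zero = ≈ᶜ.trans (ℂᵣ.+-identityʳ _) (lem (re (a 0)) , lem (im (a 0)))
      where
      lem : ∀ x → d 0 * (u * x) ≈ x
      lem x = trans (sym (ℝᵣ.*-assoc (d 0) u x)) (trans (*-congʳ du≈1) (ℝᵣ.*-identityˡ x))
    divide-correct d u du≈1 a (suc n) =
      ≈ᶜ.trans (ℂᵣ.+-congˡ {p} (divide-correct d u du≈1 a′ n))
        (≈ᶜ.trans (≈ᶜ.sym (ℂᵣ.+-assoc p (a (suc n)) (-ᶜ p)))
          (≈ᶜ.trans (ℂᵣ.+-congʳ (ℂᵣ.+-comm p (a (suc n))))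
            (≈ᶜ.trans (ℂᵣ.+-assoc (a (suc n)) p (-ᶜ p))
              (≈ᶜ.trans (ℂᵣ.+-congˡ (ℂᵣ.-‿inverseʳ p)) (ℂᵣ.+-identityʳ (a (suc n)))))))
      where
      p = d (suc n) · u · a 0
      a′ : ℕ → ℂ
      a′ k = a (suc k) -ᶜ d (suc k) · u · a 0

    expSeries0 : ∀ a → expSeries a 0 ≈ 1#
    expSeries0 a = trans (*-congʳ (sym (ℝᵣ.+-identityʳ 1#))) (fromℕ*recip 1)

    expSeries1 : ∀ a → expSeries a 1 ≈ a
    expSeries1 a = trans (*-cong (ℝᵣ.*-identityʳ a)
      (trans (sym (ℝᵣ.*-identityˡ _)) (expSeries0 a))) (ℝᵣ.*-identityʳ a)

    e-1₀≈0 : ∀ a → e^[ a ]t-1 0 ≈ 0#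
    e-1₀≈0 a = trans (+-congʳ (expSeries0 a)) (ℝᵣ.-‿inverseʳ 1#)

    shift-⊛ : ∀ a b n → (e^[ a ]t-1 ⊛ b) (suc n) ≈ᶜ ((λ k → expSeries a (suc k)) ⊛ b) n
    shift-⊛ a b n = ≈ᶜ.trans (Σᶜ.sum-init-last {suc n} v)
      (≈ᶜ.trans (ℂᵣ.+-cong (Σᶜ.sum-cong-≋ {suc n} init≈) last≈) (ℂᵣ.+-identityʳ _))
      where
      v : Fin (suc (suc n)) → ℂ
      v i = e^[ a ]t-1 (suc n ℕ.∸ toℕ i) · b (toℕ i)
      last≈ : v (fromℕ (suc n)) ≈ᶜ 0ᶜ
      last≈ rewrite toℕ-fromℕ n | ℕ.n∸n≡0 n = 0·z≈0 (b (suc n)) (e-1₀≈0 a)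
      init≈ : ∀ i → v (inject₁ i) ≈ᶜ expSeries a (suc (n ℕ.∸ toℕ i)) · b (toℕ i)
      init≈ i rewrite toℕ-inject₁ i | ℕ.+-∸-assoc 1 (toℕ≤pred[n] i) = ≈ᶜ.refl

  B-generating : ∀ {f} .{{_ : NonZero f}} (χ : DirichletCharacter f) x n →
    (e^[ fromℕ-ℝ f ]t-1 ⊛ (λ k → recip (k !) {{k ℕ.!≢0}} · B k χ x)) n ≈ᶜ
    ∑ℂ {f} (λ m → t× (λ j → expSeries (fromℕ-ℝ (toℕ m) + x) j · conj (⟦ χ ⟧ (ℤ.+ toℕ m))) n)
  B-generating {f} χ x zero = ≈ᶜ.trans
    (≈ᶜ.trans (ℂᵣ.+-identityʳ _) (0·z≈0 (recip 1 · B 0 χ x) (e-1₀≈0 (fromℕ-ℝ f))))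
    (≈ᶜ.sym (Σᶜ.sum-replicate-zero f))
  B-generating {f} χ x (suc n) = ≈ᶜ.trans
    (shift-⊛ (fromℕ-ℝ f) (λ k → recip (k !) {{k ℕ.!≢0}} · B k χ x) n)
    (≈ᶜ.trans
      (Σᶜ.sum-cong-≋ {suc n} (λ i → ·-cong (refl {d (n ℕ.∸ toℕ i)}) (lem (toℕ i))))
      (divide-correct d (recip f)
        (trans (*-congʳ (expSeries1 (fromℕ-ℝ f))) (fromℕ*recip f)) (characterSeries χ x) n))
    where
    d : ℕ → ℝ
    d j = expSeries (fromℕ-ℝ f) (suc j)
    lem : ∀ k → recip (k !) {{k ℕ.!≢0}} · B k χ x ≈ᶜ bernoulliCoefficient χ x k
    lem k = go (re (bernoulliCoefficient χ x k)) , go (im (bernoulliCoefficient χ x k))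
      where
      go : ∀ z → recip (k !) {{k ℕ.!≢0}} * (fromℕ-ℝ (k !) * z) ≈ z
      go z = trans (solve 3 (λ r y z → r :* (y :* z) := (y :* r) :* z) refl (recip (k !) {{k ℕ.!≢0}}) (fromℕ-ℝ (k !)) z)
        (trans (*-congʳ (fromℕ*recip (k !) {{k ℕ.!≢0}})) (ℝᵣ.*-identityˡ z))

  ----------------------------------------------------------------------

  G₂-term : ∀ {f} → DirichletCharacter f → ℝ → (r : ℕ) .{{_ : NonZero r}} → ℝ → ℕ → ℂ
  G₂-term χ b r θ n = exp (- ((fromℕ-ℝ n + b /ℕ r) ^ r * θ)) · ⟦ χ ⟧ (ℤ.+ n)

  G₂ : ∀ {f} (χ : DirichletCharacter f) b (r : ℕ) .{{_ : NonZero r}} θ →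
       Summable (G₂-term χ b r θ) → ℂ
  G₂ χ b r θ s = fromℕ-ℝ r · ∑∞ (G₂-term χ b r θ) s

  G₂-expansion : ∀ {f} .{{_ : NonZero f}} → DirichletCharacter f →
                 ℝ → (r : ℕ) .{{_ : NonZero r}} → ℕ → ℝ → ℂ
  G₂-expansion χ b r N θ = -ᶜ (fromℕ-ℝ r · ∑ℂ {suc N} (λ i → coefficient (toℕ i)))
    where
    coefficient : ℕ → ℂ
    coefficient n =
      ((- 1#) ^ n * recip (suc (r ℕ.* n)) * recip (n !) {{n ℕ.!≢0}} * θ ^ n)
        · B (suc (r ℕ.* n)) (conjugate χ) (b /ℕ r)

{-# OPTIONS --safe #-}
module Submission where

-- Put x = b/r, F(n) = exp(-θ(n+x)ʳ), and let X be the real or the imaginary part of χ, a sequence of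
-- period f with zero sum over a period (χ being primitive and nonprincipal). Such a sequence has a
-- periodic antiderivative of the same kind, so K summations by parts give
--     ∑_{n<M} X(n) F(n) = Λ(F) - Λ(F(· + M)) ± ∑_{n<M} X_K(n) (Δᴷ F)(n),
-- where Λ is a fixed linear combination of values at 0, …, K-1.
--
-- Write F(m) = F(n) e⁻ᵘ with u = θ((m+x)ʳ - (n+x)ʳ) and expand e⁻ᵘ to order K. Taking Kth differences in
-- m = n of uᵏ leaves θᵏ times a polynomial of degree rk - K in n, and the remainder is O(uᴷ) with
-- u = O(θ(1+n+x)ʳ⁻¹) near m = n. As (θ(n+x)ʳ)ʲ F(n) is bounded for each j, the choice K = rq + 2 yields
-- Δᴷ F(n) = O(θ^q / ((n+1)(n+2))), and therefore ∑ X(n) F(n) = Λ(F) + O(θ^q).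
--
-- Λ(F) involves finitely many values of F, so its expansion in θ has the coefficients
-- (-1)ⁱ/i! · Λ((· + x)^{ri}). Finally, summation by parts over one period, applied to (n+x)ᵏ/k! for k < K,
-- is the triangular system which defines the Bernoulli coefficients, whence Λ((· + x)ᵏ) = -B_{k+1}/(k+1).

open import Algebra.Bundles using (CommutativeRing)
import Algebra.Properties.AbelianGroup
import Algebra.Properties.CommutativeMonoid.Sum
import Algebra.Properties.Ring
import Algebra.Properties.Semiring.Exp
import Algebra.Properties.Semiring.Mult
import Algebra.Properties.Semiring.Mult.TCOptimised
import Algebra.Properties.Semiring.Sum
open import Algebra.Solver.Ring.AlmostCommutativeRing using (fromCommutativeRing; _-Raw-AlmostCommutative⟶_)
import Algebra.Solver.Ring
open import Data.Fin.Base using (Fin; zero; suc; toℕ; fromℕ<; punchOut)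
open import Data.Fin.Permutation using (Permutation′; permutation; _⟨$⟩ʳ_)
import Data.Fin.Properties as Fin
open import Data.Integer.Base as ℤ using (ℤ; +_; -[1+_]; _⊖_)
import Data.Integer.Coprimality as ℤ
open import Data.Integer.DivMod using (n%ℕd<d; a≡a%ℕn+[a/ℕn]*n)
import Data.Integer.Properties as ℤ
open import Data.Integer.Solver using () renaming (module +-*-Solver to ℤ-Solver)
open import Data.Maybe.Base using (Maybe; just; nothing)
open import Data.Nat.Base as ℕ using (ℕ; zero; suc; NonZero; z≤n; s≤s; _!)
import Data.Nat.Coprimality as ℕ
import Data.Nat.Divisibility as ℕ
open import Data.Nat.DivMod using (_%_; _/_; m%n<n; m≡m%n+[m/n]*n)
import Data.Nat.Properties as ℕ
open import Data.Nat.Solver using () renaming (module +-*-Solver to ℕ-Solver)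
open import Data.Product.Base using (Σ; ∃; _×_; _,_; proj₁; proj₂)
open import Data.Sum.Base using (_⊎_; inj₁; inj₂; [_,_]′)
open import Function.Base using (_∘_)
open import Function.Definitions using (Injective)
open import Level using (_⊔_)
open import Relation.Binary.PropositionalEquality.Core as ≡ using (_≡_)
open import Relation.Binary.Structures using (IsPreorder; IsStrictPartialOrder)
import Relation.Binary.Reasoning.Base.Triple
open import Relation.Nullary.Decidable.Core using (yes; no)
open import Relation.Nullary.Negation.Core using (¬_; contradiction)
open import Defs

-- On the scale n ~ θ^(-1/r) one difference of F gains a factor θ^(1/r). Thus rq differences account
-- for θ^q, and two further ones for the factor of order 1/n² that makes the bound summable
-- uniformly in θ. The obstacle is to get this with constants independent of both n and θ. Hence the
-- differences are taken in m around a moving base point n, and `Degree` carries bounds uniform in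
-- n. The powers of n left over are paid for by the damping, at the rate of r powers of n per power
-- of θ. Why Λ meets the Bernoulli polynomials is clearest on generating series. Put E(n) =
-- e^((n+x)t). A move by one period multiplies E by e^(ft), so that summation by parts over a period
-- formally reads ∑_{m<f} X(m) E(m) = (1 - e^(ft)) Λ(E), and Λ(E) is minus the quotient of the left
-- side by e^(ft) - 1. The triangular system is this identity, restricted to the degrees that K
-- differences annihilate.

module Expansions {c ℓ₁ ℓ₂} (R : RealField c ℓ₁ ℓ₂) where

  open Analysis R
  open OrderProperties
  private
    module ℝᵣ = CommutativeRing ℝ-commutativeRing
    module ℂᵣ = CommutativeRing ℂ-commutativeRing
    module < = IsStrictPartialOrder isStrictPartialOrder
  open ℝᵣ using (refl; sym; trans; +-cong; +-congˡ; +-congʳ; *-cong; *-congˡ; *-congʳ; -‿cong)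
  open Algebra.Properties.Ring ℝᵣ.ring using (-‿distribˡ-*; -‿distribʳ-*; -0#≈0#)
  open Algebra.Properties.AbelianGroup ℝᵣ.+-abelianGroup using (⁻¹-involutive; ⁻¹-∙-comm)
  open Algebra.Properties.Semiring.Mult ℝᵣ.semiring using (×1-homo-*; ×-homo-+)
  open Algebra.Properties.Semiring.Exp ℝᵣ.semiring using (^-congˡ; ^-homo-*; ^-assocʳ)
  open ExpConvergence using (sum-snoc; n≤2^n; h; h+h≈1; 0<h^; h^n*2^n≈1; ^-distrib-*; Bounded; natBound; expSeries-bound)

  -- Ring normalisation over ℤ: with no decidable equality on ℝ, cancellation has to be seen in the coefficients.
  module RingSolver where
    open Algebra.Properties.Semiring.Mult.TCOptimised ℝᵣ.semiring
      using () renaming (_×_ to _×′_; ×-homo-+ to ×′-homo-+; ×1-homo-* to ×′1-homo-*)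

    ⟦_⟧ℤ : ℤ → ℝ
    ⟦ + n ⟧ℤ      = n ×′ 1#
    ⟦ -[1+ n ] ⟧ℤ = - (suc n ×′ 1#)

    neg-homo : ∀ i → ⟦ ℤ.- i ⟧ℤ ≈ - ⟦ i ⟧ℤ
    neg-homo (+ zero)    = sym -0#≈0#
    neg-homo (+ (suc n)) = refl
    neg-homo -[1+ n ]    = sym (⁻¹-involutive _)

    cancel : ∀ a b → (1# + a) - (1# + b) ≈ a - b
    cancel a b =
      trans (+-congˡ (trans (sym (⁻¹-∙-comm 1# b)) (ℝᵣ.+-comm (- 1#) (- b))))
        (trans (sym (ℝᵣ.+-assoc (1# + a) (- b) (- 1#)))
          (trans (+-congʳ (trans (ℝᵣ.+-assoc 1# a (- b)) (ℝᵣ.+-comm 1# (a - b))))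
            (trans (ℝᵣ.+-assoc (a - b) 1# (- 1#))
              (trans (+-congˡ (ℝᵣ.-‿inverseʳ 1#)) (ℝᵣ.+-identityʳ (a - b))))))

    ⊖-homo : ∀ m n → ⟦ m ⊖ n ⟧ℤ ≈ m ×′ 1# - n ×′ 1#
    ⊖-homo m       zero    = sym (trans (+-congˡ -0#≈0#) (ℝᵣ.+-identityʳ _))
    ⊖-homo zero    (suc n) = sym (ℝᵣ.+-identityˡ _)
    ⊖-homo (suc m) (suc n) rewrite ℤ.[1+m]⊖[1+n]≡m⊖n m n =
      trans (⊖-homo m n) (sym (trans (+-cong (×′-homo-+ 1# 1 m) (-‿cong (×′-homo-+ 1# 1 n))) (cancel _ _)))

    add-homo : ∀ i j → ⟦ i ℤ.+ j ⟧ℤ ≈ ⟦ i ⟧ℤ + ⟦ j ⟧ℤ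
    add-homo (+ m)    (+ n)    = ×′-homo-+ 1# m n
    add-homo (+ m)    -[1+ n ] = ⊖-homo m (suc n)
    add-homo -[1+ m ] (+ n)    = trans (⊖-homo n (suc m)) (ℝᵣ.+-comm _ _)
    add-homo -[1+ m ] -[1+ n ] = trans (-‿cong (trans (≡.subst (λ k → suc (suc (m ℕ.+ n)) ×′ 1# ≈ k ×′ 1#)
            (≡.cong suc (≡.sym (ℕ.+-suc m n))) refl) (×′-homo-+ 1# (suc m) (suc n)))) (sym (⁻¹-∙-comm _ _))

    mul-homo : ∀ i j → ⟦ i ℤ.* j ⟧ℤ ≈ ⟦ i ⟧ℤ * ⟦ j ⟧ℤ
    mul-homo (+ m) (+ n) rewrite ≡.sym (ℤ.pos-* m n) = ×′1-homo-* m n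
    mul-homo (+ m) -[1+ n ] rewrite ≡.sym (ℤ.neg-distribʳ-* (+ m) (+ suc n)) =
      trans (neg-homo (+ m ℤ.* + suc n)) (trans (-‿cong (mul-homo (+ m) (+ suc n))) (-‿distribʳ-* _ _))
    mul-homo -[1+ m ] (+ n) rewrite ≡.sym (ℤ.neg-distribˡ-* (+ suc m) (+ n)) =
      trans (neg-homo (+ suc m ℤ.* + n)) (trans (-‿cong (mul-homo (+ suc m) (+ n))) (-‿distribˡ-* _ _))
    mul-homo -[1+ m ] -[1+ n ] =
      trans (mul-homo (+ suc m) (+ suc n))
        (trans (sym (⁻¹-involutive _)) (trans (-‿cong (-‿distribˡ-* _ _)) (-‿distribʳ-* _ _)))

    morphism : CommutativeRing.rawRing ℤ.+-*-commutativeRing -Raw-AlmostCommutative⟶ fromCommutativeRing ℝ-commutativeRing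
    morphism = record
      { ⟦_⟧ = ⟦_⟧ℤ ; +-homo = add-homo ; *-homo = mul-homo ; -‿homo = neg-homo ; 0-homo = refl ; 1-homo = refl }

    weakly-decide : ∀ i j → Maybe (⟦ i ⟧ℤ ≈ ⟦ j ⟧ℤ)
    weakly-decide i j with i ℤ.≟ j
    ... | yes ≡.refl = just refl
    ... | no _       = nothing

    open Algebra.Solver.Ring _ _ morphism weakly-decide public
      using (Polynomial; solve; _:=_; _:+_; _:*_; _:-_; :-_; con)

    :0 :1 : ∀ {n} → Polynomial n
    :0 = con (+ 0)
    :1 = con (+ 1)

  open RingSolver using (solve; _:=_; _:+_; _:*_; _:-_; :-_; con; :0; :1)

  -- Order arithmetic and bounds on absolute values

  ≤-isPreorder : IsPreorder _≈_ _≤_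
  ≤-isPreorder = record { isEquivalence = ℝᵣ.isEquivalence ; reflexive = λ e → ≤-resp refl e ≤-refl ; trans = ≤-trans }

  module ≤-Reasoning = Relation.Binary.Reasoning.Base.Triple ≤-isPreorder <.asym <.trans <.<-resp-≈ <⇒≤ <-≤-trans ≤-<-trans
  open ≤-Reasoning

  ≤-by : ∀ {x y} d → 0# ≤ d → x + d ≈ y → x ≤ y
  ≤-by d 0≤d e = ≤-resp refl e (x≤x+y 0≤d)

  ≤-reflexive : ∀ {x y} → x ≈ y → x ≤ y
  ≤-reflexive e = ≤-resp refl e ≤-refl

  sub-nonneg : ∀ {x y} → x ≤ y → 0# ≤ y - x
  sub-nonneg {x} {y} p = ≤-resp (ℝᵣ.-‿inverseʳ x) refl (+-monoˡ-≤ (- x) p)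

  sub-pos : ∀ {x y} → x < y → 0# < y - x
  sub-pos {x} {y} p = <-respˡ (ℝᵣ.-‿inverseʳ x) (+-monoˡ-< (- x) p)

  ≤-antisym : ∀ {x y} → x ≤ y → y ≤ x → x ≈ y
  ≤-antisym {x} {y} p q = proj₁ (tight x y) [ q , p ]′

  -- An inequality is a negation, so it may be proved by cases on an undecided proposition.
  ≤-cases : ∀ {p x y} (P : Set p) → (P → x ≤ y) → (¬ P → x ≤ y) → x ≤ y
  ≤-cases P f g r = g (λ p → f p r) r

  +-mono-≤ : ∀ {x y z w} → x ≤ y → z ≤ w → x + z ≤ y + w
  +-mono-≤ {y = y} {z} p q = ≤-trans (+-monoˡ-≤ z p) (+-monoʳ-≤ y q)

  *-monoʳ-≤ : ∀ {x y z} → 0# ≤ z → x ≤ y → z * x ≤ z * y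
  *-monoʳ-≤ p q = ≤-resp (ℝᵣ.*-comm _ _) (ℝᵣ.*-comm _ _) (*-monoˡ-≤ p q)

  *-mono-≤ : ∀ {x y z w} → 0# ≤ z → 0# ≤ y → x ≤ y → z ≤ w → x * z ≤ y * w
  *-mono-≤ 0≤z 0≤y p q = ≤-trans (*-monoˡ-≤ 0≤z p) (*-monoʳ-≤ 0≤y q)

  0≤1 : 0# ≤ 1#
  0≤1 = <⇒≤ 0<1

  ^-nonneg : ∀ {x} → 0# ≤ x → ∀ n → 0# ≤ x ^ n
  ^-nonneg 0≤x zero    = 0≤1
  ^-nonneg 0≤x (suc n) = *-nonneg 0≤x (^-nonneg 0≤x n)

  ^-mono-≤ : ∀ {x y} → 0# ≤ x → x ≤ y → ∀ n → x ^ n ≤ y ^ n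
  ^-mono-≤ 0≤x x≤y zero    = ≤-refl
  ^-mono-≤ 0≤x x≤y (suc n) = *-mono-≤ (^-nonneg 0≤x n) (≤-trans 0≤x x≤y) x≤y (^-mono-≤ 0≤x x≤y n)

  1^n≈1 : ∀ n → 1# ^ n ≈ 1#
  1^n≈1 zero    = refl
  1^n≈1 (suc n) = trans (ℝᵣ.*-identityˡ _) (1^n≈1 n)

  1≤^ : ∀ {x} → 1# ≤ x → ∀ n → 1# ≤ x ^ n
  1≤^ p n = ≤-resp (1^n≈1 n) refl (^-mono-≤ 0≤1 p n)

  ^≤1 : ∀ {x} → 0# ≤ x → x ≤ 1# → ∀ n → x ^ n ≤ 1#
  ^≤1 0≤x p n = ≤-resp refl (1^n≈1 n) (^-mono-≤ 0≤x p n)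

  x≤y+x : ∀ {x y} → 0# ≤ y → x ≤ y + x
  x≤y+x p = ≤-resp refl (ℝᵣ.+-comm _ _) (x≤x+y p)

  0≤recip : ∀ n .{{_ : NonZero n}} → 0# ≤ recip n
  0≤recip n = <⇒≤ (0<recip n)

  inverse-unique : ∀ {x y z} → x * y ≈ 1# → x * z ≈ 1# → y ≈ z
  inverse-unique {x} {y} {z} p q = trans (sym (ℝᵣ.*-identityʳ y)) (trans (*-congˡ (sym q))
    (trans (solve 3 (λ x y z → y :* (x :* z) := x :* y :* z) refl x y z) (trans (*-congʳ p) (ℝᵣ.*-identityˡ z))))

  *-cancelˡ-pos : ∀ {x y z} → 0# < x → x * y ≈ x * z → y ≈ z
  *-cancelˡ-pos {x} {y} {z} 0<x e = let u , xu≈1 = invPos 0<x in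
    trans (sym (lem u xu≈1 y)) (trans (*-congˡ e) (lem u xu≈1 z))
    where
    lem : ∀ u → x * u ≈ 1# → ∀ y → u * (x * y) ≈ y
    lem u e y = trans (solve 3 (λ u x y → u :* (x :* y) := x :* u :* y) refl u x y) (trans (*-congʳ e) (ℝᵣ.*-identityˡ y))

  recip≤1 : ∀ n .{{_ : NonZero n}} → recip n ≤ 1#
  recip≤1 (suc n) = ≤-resp (ℝᵣ.*-identityˡ _) (fromℕ*recip (suc n))
    (*-monoˡ-≤ (0≤recip (suc n)) (x≤x+y (0≤fromℕ n)))

  infix 4 _≼_
  -- a ≼ b says |a| ≤ b.
  record _≼_ (a b : ℝ) : Set ℓ₂ where
    constructor _&_
    field
      upper : a ≤ b
      lower : - a ≤ b
  open _≼_

  ≼-nonneg : ∀ {a b} → a ≼ b → 0# ≤ b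
  ≼-nonneg {a} {b} (p & q) = halve-nonneg (≤-resp (ℝᵣ.-‿inverseʳ a) refl (+-mono-≤ p q))

  ≼-resp : ∀ {a a′ b b′} → a ≈ a′ → b ≈ b′ → a ≼ b → a′ ≼ b′
  ≼-resp e e′ (p & q) = ≤-resp e e′ p & ≤-resp (-‿cong e) e′ q

  ≼-respˡ : ∀ {a a′ b} → a ≈ a′ → a ≼ b → a′ ≼ b
  ≼-respˡ e = ≼-resp e refl

  ≼-mono : ∀ {a b b′} → b ≤ b′ → a ≼ b → a ≼ b′
  ≼-mono e (p & q) = ≤-trans p e & ≤-trans q e

  ≼-neg : ∀ {a b} → a ≼ b → - a ≼ b
  ≼-neg (p & q) = q & ≤-resp (sym (⁻¹-involutive _)) refl p

  ≼-+ : ∀ {a b a′ b′} → a ≼ b → a′ ≼ b′ → a + a′ ≼ b + b′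
  ≼-+ (p & q) (p′ & q′) = +-mono-≤ p p′ & ≤-resp (⁻¹-∙-comm _ _) refl (+-mono-≤ q q′)

  ≼-- : ∀ {a b a′ b′} → a ≼ b → a′ ≼ b′ → a - a′ ≼ b + b′
  ≼-- p q = ≼-+ p (≼-neg q)

  neg≤nonneg : ∀ {a} → 0# ≤ a → - a ≤ a
  neg≤nonneg {a} 0≤a = ≤-by (a + a) (+-nonneg 0≤a 0≤a) (solve 1 (λ a → :- a :+ (a :+ a) := a) refl a)

  ≼-self : ∀ {a} → 0# ≤ a → a ≼ a
  ≼-self 0≤a = ≤-refl & neg≤nonneg 0≤a

  ≼-between : ∀ {a b} → 0# ≤ a → a ≤ b → a ≼ b
  ≼-between 0≤a a≤b = ≼-mono a≤b (≼-self 0≤a)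

  ≼-0 : ∀ {a b} → a ≈ 0# → 0# ≤ b → a ≼ b
  ≼-0 e 0≤b = ≼-mono 0≤b (≼-respˡ (sym e) (≼-self ≤-refl))

  -- No sign is decidable, so the bound comes from 2(bd - ac) = (b - a)(d + c) + (b + a)(d - c), a
  -- sum of products of nonnegative factors.
  ≼-* : ∀ {a b a′ b′} → a ≼ b → a′ ≼ b′ → a * a′ ≼ b * b′
  ≼-* p q = go p q & ≤-resp (sym (-‿distribˡ-* _ _)) refl (go (≼-neg p) q)
    where
    go : ∀ {a b c d} → a ≼ b → c ≼ d → a * c ≤ b * d
    go {a} {b} {c} {d} (p & p′) (q & q′) = ≤-by (b * d - a * c) (halve-nonneg (≤-resp refl
        (solve 4 (λ a b c d → (b :- a) :* (d :- :- c) :+ (b :- :- a) :* (d :- c) := (b :* d :- a :* c) :+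
                (b :* d :- a :* c)) refl a b c d)
        (+-nonneg (*-nonneg (sub-nonneg p) (sub-nonneg q′)) (*-nonneg (sub-nonneg p′) (sub-nonneg q)))))
      (solve 2 (λ x y → x :+ (y :- x) := y) refl (a * c) (b * d))

  ≼-^ : ∀ {a b} → a ≼ b → ∀ n → a ^ n ≼ b ^ n
  ≼-^ p zero    = ≼-self 0≤1
  ≼-^ p (suc n) = ≼-* p (≼-^ p n)

  ≼-scale : ∀ {k a b} → 0# ≤ k → a ≼ b → k * a ≼ k * b
  ≼-scale 0≤k = ≼-* (≼-self 0≤k)

  ≼-distance-trans : ∀ {a b c x y} → a - b ≼ x → b - c ≼ y → a - c ≼ x + y
  ≼-distance-trans {a} {b} {c} p q = ≼-respˡ (solve 3 (λ a b c → (a :- b) :+ (b :- c) := a :- c) refl a b c) (≼-+ p q)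

  ≼-swap : ∀ {a b x} → a - b ≼ x → b - a ≼ x
  ≼-swap {a} {b} p = ≼-respˡ (solve 2 (λ a b → :- (a :- b) := b :- a) refl a b) (≼-neg p)

  ≼⇒≈0 : ∀ {a} → a ≼ 0# → a ≈ 0#
  ≼⇒≈0 {a} (p & q) = ≤-antisym p (≤-resp refl (solve 1 (λ a → :0 :+ a := a) refl a)
    (≤-resp (ℝᵣ.-‿inverseˡ a) refl (+-monoˡ-≤ a q)))

  ≼-cases : ∀ {p x y} (P : Set p) → (P → x ≼ y) → (¬ P → x ≼ y) → x ≼ y
  ≼-cases P f g = ≤-cases P (upper ∘ f) (upper ∘ g) & ≤-cases P (lower ∘ f) (lower ∘ g)

  bounded⇒≼ : ∀ {a b} → Bounded b a → a ≼ b
  bounded⇒≼ {a} {b} p =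
    ≤-by (Bounded.upper p) (Bounded.0≤upper p) (Bounded.a+upper≈b p) &
    ≤-by (Bounded.lower p) (Bounded.0≤lower p) (trans (+-congˡ (Bounded.lower≈a+b p))
            (solve 2 (λ a b → :- a :+ (a :+ b) := b) refl a b))

  ≼-bound : ∀ a → ∃ λ b → a ≼ b
  ≼-bound a = _ , bounded⇒≼ (proj₂ (natBound a))

  -- N is taken above C/ε, so that C ≤ Nε; strictness comes from the extra ε in (N + 1)ε.
  archimedean-small : ∀ C {ε} → 0# < ε → ∃ λ N → C * recip (suc N) < ε
  archimedean-small C {ε} 0<ε = N , <-respˡ (ℝᵣ.+-identityˡ _) (<-respʳ (begin-equality
      (fromℕ-ℝ N * ε - C) * recip (suc N) + ε * recip (suc N) + C * recip (suc N)
        ≈⟨ solve 4 (λ m e c k → (m :* e :- c) :* k :+ e :* k :+ c :* k := (:1 :+ m) :* k :* e) refl (fromℕ-ℝ N) ε C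
                (recip (suc N)) ⟩
      fromℕ-ℝ (suc N) * recip (suc N) * ε   ≈⟨ *-congʳ (fromℕ*recip (suc N)) ⟩
      1# * ε                                ≈⟨ ℝᵣ.*-identityˡ ε ⟩
      ε                                     ∎)
    (+-monoˡ-< (C * recip (suc N)) 0<gap))
    where
    u = proj₁ (invPos 0<ε)
    N = proj₁ (archimedean (C * u))
    0<gap : 0# < (fromℕ-ℝ N * ε - C) * recip (suc N) + ε * recip (suc N)
    0<gap = <-≤-trans (*-pos 0<ε (0<recip (suc N))) (x≤y+x (*-nonneg
      (sub-nonneg (≤-resp (trans (ℝᵣ.*-assoc C u ε) (trans (*-congˡ (trans (ℝᵣ.*-comm u ε) (proj₂ (invPos 0<ε))))
              (ℝᵣ.*-identityʳ C))) refl
        (*-monoˡ-≤ (<⇒≤ 0<ε) (<⇒≤ (proj₂ (archimedean (C * u))))))) (0≤recip (suc N))))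

  archimedean-≤ : ∀ {a B C} → (∀ n → a ≤ B + C * recip (suc n)) → a ≤ B
  archimedean-≤ {a} {B} {C} p B<a = go (archimedean-small C (sub-pos B<a))
    where
    go : ¬ (∃ λ N → C * recip (suc N) < a - B)
    go (N , small) = p N (<-respˡ (ℝᵣ.+-comm _ B) (<-respʳ (solve 2 (λ a b → a :- b :+ b := a) refl a B) (+-monoˡ-< B small)))

  archimedean-≼ : ∀ {a B C} → (∀ n → a ≼ B + C * recip (suc n)) → a ≼ B
  archimedean-≼ p = archimedean-≤ (upper ∘ p) & archimedean-≤ (lower ∘ p)

  archimedean-zero : ∀ {a C} → (∀ n → a ≼ C * recip (suc n)) → a ≈ 0#
  archimedean-zero p = ≼⇒≈0 (archimedean-≼ (λ n → ≼-resp refl (sym (ℝᵣ.+-identityˡ _)) (p n)))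

  h^n≤recip : ∀ n → h ^ suc n ≤ recip (suc n)
  h^n≤recip n = begin
    h ^ suc n                                            ≈⟨ ℝᵣ.*-identityʳ _ ⟨
    h ^ suc n * 1#                                       ≈⟨ *-congˡ (fromℕ*recip (suc n)) ⟨
    h ^ suc n * (fromℕ-ℝ (suc n) * recip (suc n))        ≤⟨ *-monoʳ-≤ (<⇒≤ (0<h^ (suc n)))
            (*-monoˡ-≤ (0≤recip (suc n)) (fromℕ-mono (n≤2^n (suc n)))) ⟩
    h ^ suc n * (fromℕ-ℝ (2 ℕ.^ suc n) * recip (suc n))  ≈⟨ ℝᵣ.*-assoc _ _ _ ⟨
    h ^ suc n * fromℕ-ℝ (2 ℕ.^ suc n) * recip (suc n)    ≈⟨ *-congʳ (h^n*2^n≈1 (suc n)) ⟩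
    1# * recip (suc n)                                   ≈⟨ ℝᵣ.*-identityˡ _ ⟩
    recip (suc n)                                        ∎

  0≤h : 0# ≤ h
  0≤h = 0≤recip 2

  h≤1 : h ≤ 1#
  h≤1 = recip≤1 2

  -- The criterion behind the functional equation of the exponential: an arbitrarily small bound on
  -- a difference makes it zero, because 2⁻ⁿ ≤ 1/n reduces the claim to the Archimedean axiom.
  geometric-zero : ∀ {a C} → 0# ≤ C → (∀ n → a ≼ C * h ^ n) → a ≈ 0#
  geometric-zero {a} {C} 0≤C p = archimedean-zero {C = C} (λ n → ≼-mono (*-monoʳ-≤ 0≤C (h^n≤recip n)) (p (suc n)))

  -- Finite sums

  -- Recursion at the upper end makes the passage from n to n + 1 terms definitional, as inductions
  -- on partial sums require; `∑≈∑ℝ` links it to the sums over `Fin`.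
  ∑ : ℕ → (ℕ → ℝ) → ℝ
  ∑ zero    a = 0#
  ∑ (suc n) a = ∑ n a + a n

  ∑-cong< : ∀ n {a b : ℕ → ℝ} → (∀ k → k ℕ.< n → a k ≈ b k) → ∑ n a ≈ ∑ n b
  ∑-cong< zero    e = refl
  ∑-cong< (suc n) e = +-cong (∑-cong< n (λ k p → e k (ℕ.m≤n⇒m≤1+n p))) (e n ℕ.≤-refl)

  ∑-cong : ∀ n {a b : ℕ → ℝ} → (∀ k → a k ≈ b k) → ∑ n a ≈ ∑ n b
  ∑-cong n e = ∑-cong< n (λ k _ → e k)

  ∑-+ : ∀ n a b → ∑ n (λ k → a k + b k) ≈ ∑ n a + ∑ n b
  ∑-+ zero    a b = sym (ℝᵣ.+-identityˡ 0#)
  ∑-+ (suc n) a b = trans (+-congʳ (∑-+ n a b))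
    (solve 4 (λ p q x y → p :+ q :+ (x :+ y) := (p :+ x) :+ (q :+ y)) refl (∑ n a) (∑ n b) (a n) (b n))

  ∑-* : ∀ n x a → ∑ n (λ k → x * a k) ≈ x * ∑ n a
  ∑-* zero    x a = sym (ℝᵣ.zeroʳ x)
  ∑-* (suc n) x a = trans (+-congʳ (∑-* n x a)) (sym (ℝᵣ.distribˡ x _ _))

  ∑-neg : ∀ n a → ∑ n (λ k → - a k) ≈ - ∑ n a
  ∑-neg zero    a = sym -0#≈0#
  ∑-neg (suc n) a = trans (+-congʳ (∑-neg n a)) (⁻¹-∙-comm _ _)

  ∑-0 : ∀ n {a} → (∀ k → k ℕ.< n → a k ≈ 0#) → ∑ n a ≈ 0#
  ∑-0 zero    e = refl
  ∑-0 (suc n) e = trans (+-cong (∑-0 n (λ k p → e k (ℕ.m≤n⇒m≤1+n p))) (e n ℕ.≤-refl)) (ℝᵣ.+-identityˡ 0#)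

  ∑-const : ∀ n x → ∑ n (λ _ → x) ≈ fromℕ-ℝ n * x
  ∑-const zero    x = sym (ℝᵣ.zeroˡ x)
  ∑-const (suc n) x = trans (+-congʳ (∑-const n x))
    (solve 2 (λ m x → m :* x :+ x := (:1 :+ m) :* x) refl (fromℕ-ℝ n) x)

  ∑-cons : ∀ n a → ∑ (suc n) a ≈ a 0 + ∑ n (a ∘ suc)
  ∑-cons zero    a = ℝᵣ.+-comm _ _
  ∑-cons (suc n) a = trans (+-congʳ (∑-cons n a)) (ℝᵣ.+-assoc _ _ _)

  ∑-append : ∀ m n a → ∑ (m ℕ.+ n) a ≈ ∑ n a + ∑ m (λ k → a (k ℕ.+ n))
  ∑-append zero    n a = sym (ℝᵣ.+-identityʳ _)
  ∑-append (suc m) n a = trans (+-congʳ (∑-append m n a)) (ℝᵣ.+-assoc _ _ _)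

  ∑-≼ : ∀ n {a b : ℕ → ℝ} → (∀ k → k ℕ.< n → a k ≼ b k) → ∑ n a ≼ ∑ n b
  ∑-≼ zero    p = ≼-self ≤-refl
  ∑-≼ (suc n) p = ≼-+ (∑-≼ n (λ k q → p k (ℕ.m≤n⇒m≤1+n q))) (p n ℕ.≤-refl)

  ∑-nonneg : ∀ n {a : ℕ → ℝ} → (∀ k → 0# ≤ a k) → 0# ≤ ∑ n a
  ∑-nonneg zero    p = ≤-refl
  ∑-nonneg (suc n) p = +-nonneg (∑-nonneg n p) (p n)

  ∑-term≤ : ∀ n {a : ℕ → ℝ} → (∀ k → 0# ≤ a k) → ∀ k → k ℕ.< n → a k ≤ ∑ n a
  ∑-term≤ (suc n) p k k<1+n with ℕ.m≤n⇒m<n∨m≡n (ℕ.≤-pred k<1+n)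
  ... | inj₁ k<n    = ≤-trans (∑-term≤ n p k k<n) (x≤x+y (p n))
  ... | inj₂ ≡.refl = x≤y+x (∑-nonneg n p)

  ∑≈∑ℝ : ∀ n a → ∑ n a ≈ ∑ℝ {n} (a ∘ toℕ)
  ∑≈∑ℝ zero    a = refl
  ∑≈∑ℝ (suc n) a = trans (+-congʳ (∑≈∑ℝ n a)) (sym (sum-snoc a n))

  -- Convergence is used only at the precision of the supposed excess: if the bound failed by ε, a
  -- term within ε of the limit would already contradict it.
  limit-≼ : ∀ {s l a b} → ConvergesTo s l → ∀ N → (∀ n → N ℕ.≤ n → s n - a ≼ b) → l - a ≼ b
  limit-≼ {s} {l} {a} {b} s→l N p = above & below
    where
    above : l - a ≤ b
    above b<l-a = <.irrefl refl (begin-strict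
      l                         <⟨ proj₂ (proj₂ (s→l ε 0<ε) n (ℕ.m≤n⊔m N _)) ⟩
      s n + ε                   ≈⟨ solve 4 (λ s l a b → s :+ (l :- a :- b) := (s :- a) :+ (l :- b)) refl (s n) l a b ⟩
      (s n - a) + (l - b)       ≤⟨ +-monoˡ-≤ _ (upper (p n (ℕ.m≤m⊔n N _))) ⟩
      b + (l - b)               ≈⟨ solve 2 (λ l b → b :+ (l :- b) := l) refl l b ⟩
      l                         ∎)
      where
      ε = l - a - b
      0<ε = sub-pos b<l-a
      n = N ℕ.⊔ proj₁ (s→l ε 0<ε)
    below : - (l - a) ≤ b
    below b<a-l = <.irrefl refl (begin-strict
      a                         ≈⟨ solve 2 (λ s a → a := s :+ :- (s :- a)) refl (s n) a ⟩
      s n + - (s n - a)         ≤⟨ +-monoʳ-≤ (s n) (lower (p n (ℕ.m≤m⊔n N _))) ⟩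
      s n + b                   <⟨ +-monoˡ-< b (proj₁ (proj₂ (s→l ε 0<ε) n (ℕ.m≤n⊔m N _))) ⟩
      l + ε + b                 ≈⟨ solve 3 (λ l a b → l :+ (:- (l :- a) :- b) :+ b := a) refl l a b ⟩
      a                         ∎)
      where
      ε = - (l - a) - b
      0<ε = sub-pos b<a-l
      n = N ℕ.⊔ proj₁ (s→l ε 0<ε)

  -- For q ≤ 1/2 each term satisfies D qⁱ ≤ 2D(qⁱ - qⁱ⁺¹), and the right sides telescope.
  geometric-tail : ∀ {b D q} → 0# ≤ D → 0# ≤ q → q + q ≤ 1# → ∀ j → (∀ i → j ℕ.≤ i → b i ≼ D * q ^ i) →
    ∀ m → j ℕ.≤ m → ∑ m b - ∑ j b ≼ (D + D) * q ^ j
  geometric-tail {b} {D} {q} 0≤D 0≤q 2q≤1 j p m j≤m =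
    ≼-mono (≤-by ((D + D) * q ^ m) (*-nonneg (+-nonneg 0≤D 0≤D) (^-nonneg 0≤q m)) (solve 2 (λ x y → x :- y :+ y := x) refl _ _))
      (≡.subst (λ n → ∑ n b - ∑ j b ≼ (D + D) * q ^ j - (D + D) * q ^ n) (ℕ.m∸n+n≡m j≤m) (go (m ℕ.∸ j)))
    where
    go : ∀ k → ∑ (k ℕ.+ j) b - ∑ j b ≼ (D + D) * q ^ j - (D + D) * q ^ (k ℕ.+ j)
    go zero    = ≼-0 (ℝᵣ.-‿inverseʳ _) (≤-reflexive (sym (ℝᵣ.-‿inverseʳ _)))
    go (suc k) = ≼-resp
      (solve 3 (λ s t x → (s :- t) :+ x := s :+ x :- t) refl _ _ _)
      (solve 4 (λ p D q r → (p :- (D :+ D) :* r) :+ ((D :+ D) :* r :- (D :+ D) :* (q :* r)) := p :- (D :+ D) :*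
              (q :* r)) refl ((D + D) * q ^ j) D q (q ^ n))
      (≼-+ (go k) (≼-mono
        (≤-by (D * q ^ n * (1# - (q + q))) (*-nonneg (*-nonneg 0≤D (^-nonneg 0≤q n)) (sub-nonneg 2q≤1))
          (solve 3 (λ D q r → D :* r :+ D :* r :* (:1 :- (q :+ q)) := (D :+ D) :* r :- (D :+ D) :* (q :* r)) refl D q (q ^ n)))
        (p n (ℕ.m≤n+m j k))))
      where n = k ℕ.+ j

  -- The exponential function

  -- Agda compares two applications of exp by unfolding them down to the completeness axiom, which
  -- does not finish in reasonable time; e^ is exp behind an abstraction barrier.
  module OpaqueExp where
    abstract
      e^ : ℝ → ℝ
      e^ = exp

      e^≡exp : ∀ x → e^ x ≡ Analysis.exp R x
      e^≡exp x = ≡.refl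

      e^-converges : ∀ x → ConvergesTo (expPartialSum x) (e^ x)
      e^-converges = exp-converges

  open OpaqueExp

  e^-remainder : ∀ {y D q} → 0# ≤ D → 0# ≤ q → q + q ≤ 1# → ∀ j → (∀ i → j ℕ.≤ i → expSeries y i ≼ D * q ^ i) →
    e^ y - ∑ j (expSeries y) ≼ (D + D) * q ^ j
  e^-remainder {y} 0≤D 0≤q 2q≤1 j p = limit-≼ (e^-converges y) j (λ n j≤n →
    ≼-respˡ (+-congʳ (∑≈∑ℝ n (expSeries y))) (geometric-tail 0≤D 0≤q 2q≤1 j p n j≤n))

  -- The ratio 1/4 rather than 1/2 leaves room: in a Cauchy product the error acquires a factor n,
  -- and n/4ⁿ is still at most 1/2ⁿ.
  ¼ : ℝ
  ¼ = h * h

  0≤¼ : 0# ≤ ¼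
  0≤¼ = *-nonneg 0≤h 0≤h

  ¼+¼≤1 : ¼ + ¼ ≤ 1#
  ¼+¼≤1 = ≤-resp (sym (trans (sym (ℝᵣ.distribˡ h h h)) (trans (*-congˡ h+h≈1) (ℝᵣ.*-identityʳ h)))) refl h≤1

  -- A bound with ratio 1/2 at 2x is a bound with ratio 1/4 at x.
  expSeries-≼ : ∀ x → ∃ λ D → 0# ≤ D × (∀ n → expSeries x n ≼ D * ¼ ^ n)
  expSeries-≼ x = D , 0≤D , λ n → ≼-resp
    (begin-equality
      h ^ n * ((x + x) ^ n * _)       ≈⟨ ℝᵣ.*-assoc _ _ _ ⟨
      h ^ n * (x + x) ^ n * _         ≈⟨ *-congʳ (^-distrib-* h (x + x) n) ⟨
      (h * (x + x)) ^ n * _           ≈⟨ *-congʳ (^-congˡ n h*2x≈x) ⟩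
      expSeries x n                   ∎)
    (begin-equality
      h ^ n * (h ^ n * D)             ≈⟨ solve 2 (λ p D → p :* (p :* D) := D :* (p :* p)) refl (h ^ n) D ⟩
      D * (h ^ n * h ^ n)             ≈⟨ *-congˡ (^-distrib-* h h n) ⟨
      D * ¼ ^ n                       ∎)
    (≼-scale (<⇒≤ (0<h^ n)) (bounded⇒≼ (bound n)))
    where
    D = proj₁ (expSeries-bound (x + x))
    0≤D = proj₁ (proj₂ (expSeries-bound (x + x)))
    bound = proj₂ (proj₂ (expSeries-bound (x + x)))
    h*2x≈x : h * (x + x) ≈ x
    h*2x≈x = trans (solve 2 (λ h x → h :* (x :+ x) := (h :+ h) :* x) refl h x) (trans (*-congʳ h+h≈1) (ℝᵣ.*-identityˡ x))

  -- Cauchy products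

  -- Peeling off the leading coefficient first matches the order in which `divideSeries` proceeds.
  conv : (ℕ → ℝ) → (ℕ → ℝ) → ℕ → ℝ
  conv a b zero    = a 0 * b 0
  conv a b (suc n) = a 0 * b (suc n) + conv (a ∘ suc) b n

  conv-cong : ∀ {a a′ b b′ : ℕ → ℝ} → (∀ n → a n ≈ a′ n) → (∀ n → b n ≈ b′ n) → ∀ n → conv a b n ≈ conv a′ b′ n
  conv-cong e e′ zero    = *-cong (e 0) (e′ 0)
  conv-cong e e′ (suc n) = +-cong (*-cong (e 0) (e′ (suc n))) (conv-cong (e ∘ suc) e′ n)

  conv-+ˡ : ∀ a a′ b n → conv (λ k → a k + a′ k) b n ≈ conv a b n + conv a′ b n
  conv-+ˡ a a′ b zero    = ℝᵣ.distribʳ _ _ _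
  conv-+ˡ a a′ b (suc n) = trans (+-congˡ (conv-+ˡ (a ∘ suc) (a′ ∘ suc) b n))
    (solve 5 (λ x y b p q → (x :+ y) :* b :+ (p :+ q) := (x :* b :+ p) :+ (y :* b :+ q)) refl (a 0) (a′ 0) (b (suc n)) _ _)

  conv-*ˡ : ∀ x a b n → conv (λ k → x * a k) b n ≈ x * conv a b n
  conv-*ˡ x a b zero    = ℝᵣ.*-assoc _ _ _
  conv-*ˡ x a b (suc n) = trans (+-cong (ℝᵣ.*-assoc _ _ _) (conv-*ˡ x (a ∘ suc) b n)) (sym (ℝᵣ.distribˡ x _ _))

  conv-*ʳ : ∀ x a b n → conv a (λ k → x * b k) n ≈ x * conv a b n
  conv-*ʳ x a b zero    = solve 3 (λ x a b → a :* (x :* b) := x :* (a :* b)) refl x (a 0) (b 0)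
  conv-*ʳ x a b (suc n) = trans (+-cong (solve 3 (λ x a b → a :* (x :* b) := x :* (a :* b)) refl x (a 0) (b (suc n)))
          (conv-*ʳ x (a ∘ suc) b n)) (sym (ℝᵣ.distribˡ x _ _))

  conv-snoc : ∀ a b n → conv a b (suc n) ≈ conv a (b ∘ suc) n + a (suc n) * b 0
  conv-snoc a b zero    = refl
  conv-snoc a b (suc n) = trans (+-congˡ (conv-snoc (a ∘ suc) b n)) (sym (ℝᵣ.+-assoc _ _ _))

  -- The formal derivative; `conv-∂` is its Leibniz rule.
  ∂ : (ℕ → ℝ) → ℕ → ℝ
  ∂ a n = fromℕ-ℝ (suc n) * a (suc n)

  conv-∂ : ∀ a b n → ∂ (conv a b) n ≈ conv (∂ a) b n + conv a (∂ b) n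
  conv-∂ a b zero =
    solve 5 (λ z a₀ a₁ b₀ b₁ → (:1 :+ z) :* (a₀ :* b₁ :+ a₁ :* b₀) := (:1 :+ z) :* a₁ :* b₀ :+ a₀ :*
            ((:1 :+ z) :* b₁)) refl 0# (a 0) (a 1) (b 0) (b 1)
  conv-∂ a b (suc n) = begin-equality
    (1# + m) * (a 0 * b (2 ℕ.+ n) + conv a′ b (suc n))
      ≈⟨ solve 4 (λ m a b c → (:1 :+ m) :* (a :* b :+ c) := a :* ((:1 :+ m) :* b) :+ (c :+ m :* c)) refl m (a 0)
              (b (2 ℕ.+ n)) (conv a′ b (suc n)) ⟩
    a 0 * ∂ b (suc n) + ((a 1 * b (suc n) + conv a″ b n) + ∂ (conv a′ b) n)
      ≈⟨ +-congˡ (+-congˡ (conv-∂ a′ b n)) ⟩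
    a 0 * ∂ b (suc n) + ((a 1 * b (suc n) + conv a″ b n) + (conv (∂ a′) b n + conv a′ (∂ b) n))
      ≈⟨ solve 5 (λ p q r s t → p :+ ((q :+ r) :+ (s :+ t)) := (q :+ (r :+ s)) :+ (p :+ t)) refl _ _ _ _ _ ⟩
    (a 1 * b (suc n) + (conv a″ b n + conv (∂ a′) b n)) + (a 0 * ∂ b (suc n) + conv a′ (∂ b) n)
      ≈⟨ +-congʳ (+-cong (*-congʳ (solve 1 (λ a → a := (:1 :+ :0) :* a) refl (a 1))) (trans (sym (conv-+ˡ a″ (∂ a′) b n))
           (conv-cong (λ k → solve 2 (λ m a → a :+ (:1 :+ m) :* a := (:1 :+ (:1 :+ m)) :* a) refl (fromℕ-ℝ k)
                   (a (2 ℕ.+ k))) (λ _ → refl) n))) ⟩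
    conv (∂ a) b (suc n) + conv a (∂ b) (suc n) ∎
    where
    m = fromℕ-ℝ (suc n)
    a′ = a ∘ suc
    a″ = λ k → a (2 ℕ.+ k)

  ∂-expSeries : ∀ x n → ∂ (expSeries x) n ≈ x * expSeries x n
  ∂-expSeries x n = begin-equality
    m * (x * x ^ n * recip (suc n !) {{suc n ℕ.!≢0}})    ≈⟨ solve 4 (λ m x p r → m :* (x :* p :* r) := x :*
            (p :* (m :* r))) refl _ _ _ _ ⟩
    x * (x ^ n * (m * recip (suc n !) {{suc n ℕ.!≢0}}))  ≈⟨ *-congˡ (*-congˡ (inverse-unique
        (trans (sym (ℝᵣ.*-assoc _ _ _)) (trans (*-congʳ (trans (ℝᵣ.*-comm _ _) (sym (×1-homo-* (suc n) (n !)))))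
                (fromℕ*recip (suc n !) {{suc n ℕ.!≢0}})))
        (fromℕ*recip (n !) {{n ℕ.!≢0}}))) ⟩
    x * expSeries x n  ∎
    where m = fromℕ-ℝ (suc n)

  expSeries-0 : ∀ x → expSeries x 0 ≈ 1#
  expSeries-0 x = trans (*-congʳ (sym (ℝᵣ.+-identityʳ 1#))) (fromℕ*recip 1)

  -- Both sides solve (n+1) c(n+1) = (x+y) c(n), c(0) = 1.
  expSeries-+ : ∀ x y n → expSeries (x + y) n ≈ conv (expSeries x) (expSeries y) n
  expSeries-+ x y zero    = trans (expSeries-0 (x + y)) (trans (sym (ℝᵣ.*-identityˡ 1#))
          (sym (*-cong (expSeries-0 x) (expSeries-0 y))))
  expSeries-+ x y (suc n) = *-cancelˡ-pos (0<fromℕ n) (begin-equality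
    ∂ (expSeries (x + y)) n          ≈⟨ ∂-expSeries (x + y) n ⟩
    (x + y) * expSeries (x + y) n    ≈⟨ *-congˡ (expSeries-+ x y n) ⟩
    (x + y) * conv (expSeries x) (expSeries y) n  ≈⟨ ℝᵣ.distribʳ _ x y ⟩
    x * conv (expSeries x) (expSeries y) n + y * conv (expSeries x) (expSeries y) n
      ≈⟨ +-cong (conv-*ˡ x (expSeries x) (expSeries y) n) (conv-*ʳ y (expSeries x) (expSeries y) n) ⟨
    conv (λ k → x * expSeries x k) (expSeries y) n + conv (expSeries x) (λ k → y * expSeries y k) n
      ≈⟨ +-cong (conv-cong (∂-expSeries x) (λ _ → refl) n) (conv-cong (λ _ → refl) (∂-expSeries y) n) ⟨
    conv (∂ (expSeries x)) (expSeries y) n + conv (expSeries x) (∂ (expSeries y)) n  ≈⟨ conv-∂ (expSeries x) (expSeries y) n ⟨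
    ∂ (conv (expSeries x) (expSeries y)) n  ∎)

  -- e is the sum of the series b.
  ∑-conv : ∀ {q b D′ e} → 0# ≤ q → (∀ j → e - ∑ j b ≼ D′ * q ^ j) → ∀ n {a D} → (∀ i → a i ≼ D * q ^ i) →
    ∑ n a * e - ∑ n (conv a b) ≼ fromℕ-ℝ n * (D * D′ * q ^ n)
  ∑-conv {e = e} 0≤q pb zero pa = ≼-0 (solve 1 (λ e → :0 :* e :- :0 := :0) refl e) (≤-reflexive (sym (ℝᵣ.zeroˡ _)))
  ∑-conv {q} {b} {D′} {e} 0≤q pb (suc n) {a} {D} pa = ≼-resp
    (sym (begin-equality
      ∑ (suc n) a * e - ∑ (suc n) (conv a b)
        ≈⟨ +-cong (*-congʳ (∑-cons n a)) (-‿cong (trans (∑-cons n (conv a b))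
                (+-congˡ (trans (∑-+ n (λ k → a 0 * b (suc k)) (conv a′ b)) (+-congʳ (∑-* n (a 0) (b ∘ suc))))))) ⟩
      (a 0 + ∑ n a′) * e - (a 0 * b 0 + (a 0 * ∑ n (b ∘ suc) + ∑ n (conv a′ b)))
        ≈⟨ solve 6 (λ a s e b t u → (a :+ s) :* e :- (a :* b :+ (a :* t :+ u)) := a :* (e :- (b :+ t)) :+
                (s :* e :- u)) refl (a 0) (∑ n a′) e (b 0) (∑ n (b ∘ suc)) (∑ n (conv a′ b)) ⟩
      a 0 * (e - (b 0 + ∑ n (b ∘ suc))) + (∑ n a′ * e - ∑ n (conv a′ b))
        ≈⟨ +-congʳ (*-congˡ (+-congˡ (-‿cong (∑-cons n b)))) ⟨
      a 0 * (e - ∑ (suc n) b) + (∑ n a′ * e - ∑ n (conv a′ b)) ∎))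
    (solve 5 (λ D D′ q r m → D :* :1 :* (D′ :* (q :* r)) :+ m :* (D :* q :* D′ :* r) := (:1 :+ m) :*
            (D :* D′ :* (q :* r))) refl D D′ q (q ^ n) (fromℕ-ℝ n))
    (≼-+ (≼-* (pa 0) (pb (suc n))) (∑-conv 0≤q pb n (λ i → ≼-resp refl (sym (ℝᵣ.*-assoc _ _ _)) (pa (suc i)))))
    where a′ = a ∘ suc

  n*h^n≤1 : ∀ n → fromℕ-ℝ n * h ^ n ≤ 1#
  n*h^n≤1 n = begin
    fromℕ-ℝ n * h ^ n            ≤⟨ *-monoˡ-≤ (<⇒≤ (0<h^ n)) (fromℕ-mono (n≤2^n n)) ⟩
    fromℕ-ℝ (2 ℕ.^ n) * h ^ n    ≈⟨ ℝᵣ.*-comm _ _ ⟩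
    h ^ n * fromℕ-ℝ (2 ℕ.^ n)    ≈⟨ h^n*2^n≈1 n ⟩
    1#                           ∎

  ¼^n≈ : ∀ n → ¼ ^ n ≈ h ^ n * h ^ n
  ¼^n≈ n = ^-distrib-* h h n

  ¼^n≤h^n : ∀ n → ¼ ^ n ≤ h ^ n
  ¼^n≤h^n n = ≤-resp (sym (¼^n≈ n)) (ℝᵣ.*-identityˡ _) (*-monoˡ-≤ (<⇒≤ (0<h^ n)) (^≤1 0≤h h≤1 n))

  x-y≈0⇒x≈y : ∀ {x y} → x - y ≈ 0# → x ≈ y
  x-y≈0⇒x≈y {x} {y} e = trans (solve 2 (λ x y → x := x :- y :+ y) refl x y) (trans (+-congʳ e) (ℝᵣ.+-identityˡ y))

  HasExpBound : ℝ → ℝ → Set ℓ₂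
  HasExpBound x D = ∀ n → expSeries x n ≼ D * ¼ ^ n

  -- With A and S the nth partial sums of the series of e^x and of the Cauchy product, the
  -- difference splits as (e^(x+y) - S) + (S - A e^y) + (A - e^x) e^y. The middle part consists of n
  -- products of a coefficient and a tail, each of order 4⁻ⁿ, whence a factor n that the weaker
  -- ratio `h` absorbs.
  e^-+-bound : ∀ x y {D D′ D″ E} → 0# ≤ D → 0# ≤ D′ → 0# ≤ D″ → HasExpBound x D → HasExpBound y D′ → HasExpBound (x + y) D″ →
    e^ y ≼ E → ∀ n → e^ (x + y) - e^ x * e^ y ≼ ((D″ + D″) + D * (D′ + D′) + (D + D) * E) * h ^ n
  e^-+-bound x y {D} {D′} {D″} {E} 0≤D 0≤D′ 0≤D″ px py pxy pE n = ≼-resp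
    (solve 4 (λ z s a b → (z :- s) :+ :- (a :- s) :+ :- (b :- a) := z :- b) refl (e^ (x + y)) S (A * e^ y) (e^ x * e^ y))
    (trans (+-congʳ (sym (ℝᵣ.distribʳ _ _ _))) (sym (ℝᵣ.distribʳ _ _ _)))
    (≼-+ (≼-+
      (≼-respˡ (+-congˡ (-‿cong (∑-cong n (expSeries-+ x y)))) (≼-mono (*-monoʳ-≤ (+-nonneg 0≤D″ 0≤D″) (¼^n≤h^n n))
              (remainder 0≤D″ pxy n)))
      (≼-mono le (≼-neg (∑-conv 0≤¼ (remainder 0≤D′ py) n px))))
      (≼-mono le′ (≼-neg (≼-respˡ (solve 3 (λ a b c → (a :- b) :* c := a :* c :- b :* c) refl (e^ x) A (e^ y))
        (≼-* (remainder 0≤D px n) pE)))))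
    where
    A S : ℝ
    A = ∑ n (expSeries x)
    S = ∑ n (conv (expSeries x) (expSeries y))
    remainder : ∀ {z D} → 0# ≤ D → HasExpBound z D → ∀ j → e^ z - ∑ j (expSeries z) ≼ (D + D) * ¼ ^ j
    remainder 0≤D p j = e^-remainder 0≤D 0≤¼ ¼+¼≤1 j (λ i _ → p i)
    0≤DD : 0# ≤ D * (D′ + D′)
    0≤DD = *-nonneg 0≤D (+-nonneg 0≤D′ 0≤D′)
    le : fromℕ-ℝ n * (D * (D′ + D′) * ¼ ^ n) ≤ D * (D′ + D′) * h ^ n
    le = ≤-resp
      (trans (solve 3 (λ m D p → m :* p :* (D :* p) := m :* (D :* (p :* p))) refl (fromℕ-ℝ n) (D * (D′ + D′)) (h ^ n))
              (*-congˡ (*-congˡ (sym (¼^n≈ n)))))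
      (ℝᵣ.*-identityˡ _) (*-monoˡ-≤ (*-nonneg 0≤DD (<⇒≤ (0<h^ n))) (n*h^n≤1 n))
    le′ : (D + D) * ¼ ^ n * E ≤ (D + D) * E * h ^ n
    le′ = ≤-resp (solve 3 (λ D E p → D :* E :* p := D :* p :* E) refl (D + D) E (¼ ^ n)) refl
      (*-monoʳ-≤ (*-nonneg (+-nonneg 0≤D 0≤D) (≼-nonneg pE)) (¼^n≤h^n n))

  e^-+ : ∀ x y → e^ (x + y) ≈ e^ x * e^ y
  e^-+ x y = go (expSeries-≼ x) (expSeries-≼ y) (expSeries-≼ (x + y)) (≼-bound (e^ y))
    where
    go : (∃ λ D → 0# ≤ D × HasExpBound x D) → (∃ λ D → 0# ≤ D × HasExpBound y D) → (∃ λ D → 0# ≤ D × HasExpBound (x + y) D) →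
      (∃ λ E → e^ y ≼ E) → e^ (x + y) ≈ e^ x * e^ y
    go (D , 0≤D , px) (D′ , 0≤D′ , py) (D″ , 0≤D″ , pxy) (E , pE) = x-y≈0⇒x≈y {e^ (x + y)} {e^ x * e^ y}
            (geometric-zero {e^ (x + y) - e^ x * e^ y} {(D″ + D″) + D * (D′ + D′) + (D + D) * E}
         (+-nonneg (+-nonneg (+-nonneg 0≤D″ 0≤D″) (*-nonneg 0≤D (+-nonneg 0≤D′ 0≤D′)))
                 (*-nonneg (+-nonneg 0≤D 0≤D) (≼-nonneg pE)))
         (e^-+-bound x y 0≤D 0≤D′ 0≤D″ px py pxy pE))

  e^-cong : ∀ {x y} → x ≈ y → e^ x ≈ e^ y
  e^-cong {x} {y} x≈y = go (expSeries-≼ x) (expSeries-≼ y)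
    where
    go : (∃ λ D → 0# ≤ D × HasExpBound x D) → (∃ λ D → 0# ≤ D × HasExpBound y D) → e^ x ≈ e^ y
    go (D , 0≤D , px) (D′ , 0≤D′ , py) = x-y≈0⇒x≈y (geometric-zero (+-nonneg (+-nonneg 0≤D 0≤D) (+-nonneg 0≤D′ 0≤D′)) λ n →
      ≼-mono (≤-resp (ℝᵣ.distribʳ _ _ _) refl (*-monoʳ-≤ (+-nonneg (+-nonneg 0≤D 0≤D) (+-nonneg 0≤D′ 0≤D′)) (¼^n≤h^n n)))
        (≼-distance-trans
          (≼-respˡ (+-congˡ (-‿cong (∑-cong n (λ k → *-congʳ (^-congˡ k x≈y))))) (e^-remainder 0≤D 0≤¼ ¼+¼≤1 n (λ i _ → px i)))
          (≼-swap (e^-remainder 0≤D′ 0≤¼ ¼+¼≤1 n (λ i _ → py i)))))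

  e^-zero : e^ 0# ≈ 1#
  e^-zero = trans (x-y≈0⇒x≈y (≼⇒≈0 (≼-resp refl (solve 1 (λ h → (:0 :+ :0) :* h := :0) refl (¼ ^ 1))
    (e^-remainder ≤-refl 0≤¼ ¼+¼≤1 1 zeros)))) (trans (ℝᵣ.+-identityˡ _) (expSeries-0 0#))
    where
    zeros : ∀ i → 1 ℕ.≤ i → expSeries 0# i ≼ 0# * ¼ ^ i
    zeros (suc i) _ = ≼-0 (solve 2 (λ a b → :0 :* a :* b := :0) refl _ _) (≤-reflexive (sym (ℝᵣ.zeroˡ _)))

  e^-inverse : ∀ x → e^ x * e^ (- x) ≈ 1#
  e^-inverse x = trans (sym (e^-+ x (- x))) (trans (e^-cong (ℝᵣ.-‿inverseʳ x)) e^-zero)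

  expSeries-nonneg : ∀ {x} → 0# ≤ x → ∀ k → 0# ≤ expSeries x k
  expSeries-nonneg 0≤x k = *-nonneg (^-nonneg 0≤x k) (0≤recip (k !) {{k ℕ.!≢0}})

  limit-≥ : ∀ {s l a} → ConvergesTo s l → ∀ N → (∀ n → N ℕ.≤ n → a ≤ s n) → a ≤ l
  limit-≥ {s} {l} {a} s→l N p l<a = <.irrefl refl (begin-strict
    s n          <⟨ proj₁ (proj₂ (s→l (a - l) (sub-pos l<a)) n (ℕ.m≤n⊔m N _)) ⟩
    l + (a - l)  ≈⟨ solve 2 (λ l a → l :+ (a :- l) := a) refl l a ⟩
    a            ≤⟨ p n (ℕ.m≤m⊔n N _) ⟩
    s n          ∎)
    where n = N ℕ.⊔ proj₁ (s→l (a - l) (sub-pos l<a))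

  -- The source of all decay: for x ≥ 0 one term of the series is below the whole sum, so x^k e^(-x)
  -- is at most k!.
  expSeries≤e^ : ∀ {x} → 0# ≤ x → ∀ k → expSeries x k ≤ e^ x
  expSeries≤e^ {x} 0≤x k = limit-≥ (e^-converges x) (suc k) (λ n k<n →
    ≤-resp refl (∑≈∑ℝ n (expSeries x)) (∑-term≤ n (expSeries-nonneg 0≤x) k k<n))

  1≤e^ : ∀ {x} → 0# ≤ x → 1# ≤ e^ x
  1≤e^ {x} 0≤x = ≤-resp (expSeries-0 x) refl (expSeries≤e^ 0≤x 0)

  0<e^- : ∀ {x} → 0# ≤ x → 0# < e^ (- x)
  0<e^- {x} 0≤x = invPos-pos (<-≤-trans 0<1 (1≤e^ 0≤x)) (e^-inverse x)

  0≤e^- : ∀ {x} → 0# ≤ x → 0# ≤ e^ (- x)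
  0≤e^- 0≤x = <⇒≤ (0<e^- 0≤x)

  expSeries*e^-≤1 : ∀ {x} → 0# ≤ x → ∀ k → expSeries x k * e^ (- x) ≤ 1#
  expSeries*e^-≤1 {x} 0≤x k = ≤-resp refl (e^-inverse x) (*-monoˡ-≤ (0≤e^- 0≤x) (expSeries≤e^ 0≤x k))

  e^-≤1 : ∀ {x} → 0# ≤ x → e^ (- x) ≤ 1#
  e^-≤1 {x} 0≤x = ≤-resp (trans (*-congʳ (expSeries-0 x)) (ℝᵣ.*-identityˡ _)) refl (expSeries*e^-≤1 0≤x 0)

  expSeries-neg-≼ : ∀ {u} → 0# ≤ u → ∀ k → expSeries (- u) k ≼ u ^ k * recip (k !) {{k ℕ.!≢0}}
  expSeries-neg-≼ 0≤u k = ≼-* (≼-^ (≼-neg (≼-self 0≤u)) k) (≼-self (0≤recip (k !) {{k ℕ.!≢0}}))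

  ^-antimono-≤ : ∀ {u} → 0# ≤ u → u ≤ 1# → ∀ {k i} → k ℕ.≤ i → u ^ i ≤ u ^ k
  ^-antimono-≤ {u} 0≤u u≤1 {k} {i} k≤i = ≤-resp
    (trans (sym (^-homo-* u (i ℕ.∸ k) k)) (ℝᵣ.reflexive (≡.cong (u ^_) (ℕ.m∸n+n≡m k≤i)))) (ℝᵣ.*-identityˡ _)
    (*-monoˡ-≤ (^-nonneg 0≤u k) (^≤1 0≤u u≤1 (i ℕ.∸ k)))

  -- The series is estimated for u ≤ 1, and each of its finitely many terms is at most uᴷ for u ≥ 1.
  e^-taylor : ∀ K → ∃ λ C → 0# ≤ C × (∀ {u} → 0# ≤ u → e^ (- u) - ∑ K (expSeries (- u)) ≼ C * u ^ K)
  e^-taylor K = go (expSeries-≼ 1#)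
    where
    go : (∃ λ D → 0# ≤ D × HasExpBound 1# D) → _
    go (D , 0≤D , p1) = C , +-nonneg 0≤2D (0≤fromℕ (suc K)) , bound
      where
      C : ℝ
      C = (D + D) + fromℕ-ℝ (suc K)
      0≤2D : 0# ≤ D + D
      0≤2D = +-nonneg 0≤D 0≤D
      small : ∀ {u} → 0# ≤ u → u ≤ 1# → e^ (- u) - ∑ K (expSeries (- u)) ≼ (D + D) * u ^ K
      small {u} 0≤u u≤1 = ≼-mono
          (≤-resp (solve 3 (λ d p q → (d :+ d) :* p :* q := (p :* d :+ p :* d) :* q) refl D (u ^ K) (¼ ^ K)) (ℝᵣ.*-identityʳ _)
            (*-monoʳ-≤ (*-nonneg 0≤2D (^-nonneg 0≤u K)) (^≤1 0≤¼ (≤-trans (¼≤h) h≤1) K)))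
          -- The constant passed is uᴷ D: for u ≤ 1 every later power of u is at most uᴷ, and 1/i! ≤
          -- D 4⁻ⁱ is the bound on the series at 1.
          (e^-remainder (*-nonneg (^-nonneg 0≤u K) 0≤D) 0≤¼ ¼+¼≤1 K λ i K≤i →
            ≼-mono (≤-trans (*-monoˡ-≤ (0≤recip (i !) {{i ℕ.!≢0}}) (^-antimono-≤ 0≤u u≤1 K≤i))
                (≤-resp refl (sym (ℝᵣ.*-assoc _ _ _)) (*-monoʳ-≤ (^-nonneg 0≤u K)
                        (≤-resp (trans (*-congʳ (1^n≈1 i)) (ℝᵣ.*-identityˡ _)) refl (upper (p1 i))))))
              (expSeries-neg-≼ 0≤u i))
        where
        ¼≤h : ¼ ≤ h
        ¼≤h = ≤-resp (ℝᵣ.*-identityʳ _) (ℝᵣ.*-identityʳ _) (¼^n≤h^n 1)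
      large : ∀ {u} → 0# ≤ u → 1# ≤ u → ∀ k → e^ (- u) - ∑ k (expSeries (- u)) ≼ fromℕ-ℝ (suc k) * u ^ k
      large {u} 0≤u 1≤u zero = ≼-resp (solve 1 (λ e → e := e :- :0) refl (e^ (- u))) (solve 0 (:1 := (:1 :+ :0) :* :1) refl)
        (≼-between (0≤e^- 0≤u) (e^-≤1 0≤u))
      large {u} 0≤u 1≤u (suc k) = ≼-resp
        (solve 3 (λ e s t → (e :- s) :- t := e :- (s :+ t)) refl (e^ (- u)) (∑ k (expSeries (- u))) (expSeries (- u) k)) refl
        (≼-mono (begin
            fromℕ-ℝ (suc k) * u ^ k + u ^ k * recip (k !) {{k ℕ.!≢0}}
              ≤⟨ +-monoʳ-≤ _ (*-monoʳ-≤ (^-nonneg 0≤u k) (recip≤1 (k !) {{k ℕ.!≢0}})) ⟩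
            fromℕ-ℝ (suc k) * u ^ k + u ^ k * 1#
              ≈⟨ solve 2 (λ m p → m :* p :+ p :* :1 := (:1 :+ m) :* (:1 :* p)) refl (fromℕ-ℝ (suc k)) (u ^ k) ⟩
            fromℕ-ℝ (suc (suc k)) * (1# * u ^ k)
              ≤⟨ *-monoʳ-≤ (0≤fromℕ (suc (suc k))) (*-monoˡ-≤ (^-nonneg 0≤u k) 1≤u) ⟩
            fromℕ-ℝ (suc (suc k)) * (u * u ^ k) ∎)
          (≼-- (large 0≤u 1≤u k) (expSeries-neg-≼ 0≤u k)))
      bound : ∀ {u} → 0# ≤ u → e^ (- u) - ∑ K (expSeries (- u)) ≼ C * u ^ K
      bound {u} 0≤u = ≼-cases (u ≤ 1#)
        (λ u≤1 → ≼-mono (*-monoˡ-≤ (^-nonneg 0≤u K) (x≤x+y (0≤fromℕ (suc K)))) (small 0≤u u≤1))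
        (λ u≰1 → ≼-mono (*-monoˡ-≤ (^-nonneg 0≤u K) (x≤y+x 0≤2D)) (large 0≤u (λ u<1 → u≰1 (<⇒≤ u<1)) K))

  -- Finite differences

  Δ : (ℕ → ℝ) → ℕ → ℝ
  Δ F n = F (suc n) - F n

  Δ^ : ℕ → (ℕ → ℝ) → ℕ → ℝ
  Δ^ zero    F = F
  Δ^ (suc K) F = Δ^ K (Δ F)

  Δ^-cong : ∀ K {F G : ℕ → ℝ} → (∀ n → F n ≈ G n) → ∀ n → Δ^ K F n ≈ Δ^ K G n
  Δ^-cong zero    e n = e n
  Δ^-cong (suc K) e n = Δ^-cong K (λ m → +-cong (e (suc m)) (-‿cong (e m))) n

  Δ^-+ : ∀ K F G n → Δ^ K (λ m → F m + G m) n ≈ Δ^ K F n + Δ^ K G n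
  Δ^-+ zero    F G n = refl
  Δ^-+ (suc K) F G n = trans (Δ^-cong K (λ m → solve 4 (λ a b c d → (a :+ b) :- (c :+ d) := (a :- c) :+
          (b :- d)) refl _ _ _ _) n) (Δ^-+ K (Δ F) (Δ G) n)

  Δ^-* : ∀ K x F n → Δ^ K (λ m → x * F m) n ≈ x * Δ^ K F n
  Δ^-* zero    x F n = refl
  Δ^-* (suc K) x F n = trans (Δ^-cong K (λ m → solve 3 (λ x a b → x :* a :- x :* b := x :* (a :- b)) refl _ _ _) n)
          (Δ^-* K x (Δ F) n)

  Δ^-0 : ∀ K {F : ℕ → ℝ} → (∀ n → F n ≈ 0#) → ∀ n → Δ^ K F n ≈ 0#
  Δ^-0 zero    e n = e n
  Δ^-0 (suc K) e n = Δ^-0 K (λ m → trans (+-cong (e (suc m)) (-‿cong (e m))) (ℝᵣ.-‿inverseʳ 0#)) n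

  Δ^-∑ : ∀ K M (F : ℕ → ℕ → ℝ) n → Δ^ K (λ m → ∑ M (λ k → F k m)) n ≈ ∑ M (λ k → Δ^ K (F k) n)
  Δ^-∑ K zero    F n = Δ^-0 K (λ _ → refl) n
  Δ^-∑ K (suc M) F n = trans (Δ^-+ K (λ m → ∑ M (λ k → F k m)) (F M) n) (+-congʳ (Δ^-∑ K M F n))

  2^ : ℕ → ℝ
  2^ K = (1# + 1#) ^ K

  0≤2 : 0# ≤ 1# + 1#
  0≤2 = +-nonneg 0≤1 0≤1

  0≤2^ : ∀ K → 0# ≤ 2^ K
  0≤2^ K = ^-nonneg 0≤2 K

  Δ^-≼ : ∀ K {F : ℕ → ℝ} {ε} n → (∀ i → i ℕ.≤ K → F (i ℕ.+ n) ≼ ε) → Δ^ K F n ≼ 2^ K * ε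
  Δ^-≼ zero    n p = ≼-resp refl (sym (ℝᵣ.*-identityˡ _)) (p 0 z≤n)
  Δ^-≼ (suc K) {F} {ε} n p = ≼-resp refl (solve 2 (λ k e → k :* (e :+ e) := (:1 :+ :1) :* k :* e) refl (2^ K) ε)
    (Δ^-≼ K n (λ i i≤K → ≼-- (p (suc i) (s≤s i≤K)) (p i (ℕ.m≤n⇒m≤1+n i≤K))))

  -- Polynomial growth, uniform in the base point

  module Growth {x : ℝ} (0≤x : 0# ≤ x) where

    t : ℕ → ℝ
    t n = fromℕ-ℝ n + x

    0≤t : ∀ n → 0# ≤ t n
    0≤t n = +-nonneg (0≤fromℕ n) 0≤x

    W : ℕ → ℝ
    W n = 1# + t n

    1≤W : ∀ n → 1# ≤ W n
    1≤W n = x≤x+y (0≤t n)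

    0≤W : ∀ n → 0# ≤ W n
    0≤W n = ≤-trans 0≤1 (1≤W n)

    t≤W : ∀ n → t n ≤ W n
    t≤W n = x≤y+x 0≤1

    -- It dominates the base point t n and the argument t m together. On the diagonal, where the
    -- bounds are finally read off, it is at most 2 W n.
    w : ℕ → ℕ → ℝ
    w n m = W n + t m

    1≤w : ∀ n m → 1# ≤ w n m
    1≤w n m = ≤-trans (1≤W n) (x≤x+y (0≤t m))

    0≤w : ∀ n m → 0# ≤ w n m
    0≤w n m = ≤-trans 0≤1 (1≤w n m)

    w-suc : ∀ n m → w n (suc m) ≤ (1# + 1#) * w n m
    w-suc n m = ≤-trans (≤-reflexive (solve 3 (λ a m x → a :+ ((:1 :+ m) :+ x) := :1 :+ (a :+ (m :+ x))) refl (W n)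
            (fromℕ-ℝ m) x))
      (≤-resp refl (solve 1 (λ w → w :+ w := (:1 :+ :1) :* w) refl (w n m)) (+-monoˡ-≤ (w n m) (1≤w n m)))

    -- Degree d p: as a function of m, p n m behaves like a polynomial of degree < d, each difference
    -- lowering the exponent of w n m by one, with constants that do not depend on n.
    data Degree : ℕ → (ℕ → ℕ → ℝ) → Set (c ⊔ ℓ₁ ⊔ ℓ₂) where
      vanishing : ∀ {p} → (∀ n m → p n m ≈ 0#) → Degree 0 p
      growing   : ∀ {d p} C → 0# ≤ C → (∀ n m → p n m ≼ C * w n m ^ d) → Degree d (λ n → Δ (p n)) → Degree (suc d) p

    degree-resp : ∀ {d} {p q : ℕ → ℕ → ℝ} → (∀ n m → p n m ≈ q n m) → Degree d p → Degree d q
    degree-resp e (vanishing z)       = vanishing (λ n m → trans (sym (e n m)) (z n m))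
    degree-resp e (growing C 0≤C b Δp) = growing C 0≤C (λ n m → ≼-respˡ (e n m) (b n m))
      (degree-resp (λ n m → +-cong (e n (suc m)) (-‿cong (e n m))) Δp)

    degree-0 : ∀ d {p : ℕ → ℕ → ℝ} → (∀ n m → p n m ≈ 0#) → Degree d p
    degree-0 zero    z = vanishing z
    degree-0 (suc d) z = growing 0# ≤-refl (λ n m → ≼-0 (z n m) (≤-reflexive (sym (ℝᵣ.zeroˡ _))))
      (degree-0 d (λ n m → trans (+-cong (z n (suc m)) (-‿cong (z n m))) (ℝᵣ.-‿inverseʳ 0#)))

    degree-shift : ∀ {d p} → Degree d p → Degree d (λ n m → p n (suc m))
    degree-shift (vanishing z) = vanishing (λ n m → z n (suc m))
    degree-shift {suc d} (growing C 0≤C b Δp) = growing (C * 2^ d) (*-nonneg 0≤C (0≤2^ d))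
      (λ n m → ≼-mono (begin
        C * w n (suc m) ^ d              ≤⟨ *-monoʳ-≤ 0≤C (^-mono-≤ (0≤w n (suc m)) (w-suc n m) d) ⟩
        C * ((1# + 1#) * w n m) ^ d      ≈⟨ *-congˡ (^-distrib-* _ _ d) ⟩
        C * (2^ d * w n m ^ d)           ≈⟨ ℝᵣ.*-assoc _ _ _ ⟨
        C * 2^ d * w n m ^ d             ∎) (b n (suc m)))
      (degree-shift Δp)

    degree-+ : ∀ {d p q} → Degree d p → Degree d q → Degree d (λ n m → p n m + q n m)
    degree-+ (vanishing z) (vanishing z′) = vanishing (λ n m → trans (+-cong (z n m) (z′ n m)) (ℝᵣ.+-identityˡ 0#))
    degree-+ (growing C 0≤C b Δp) (growing C′ 0≤C′ b′ Δq) = growing (C + C′) (+-nonneg 0≤C 0≤C′)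
      (λ n m → ≼-resp refl (sym (ℝᵣ.distribʳ _ _ _)) (≼-+ (b n m) (b′ n m)))
      (degree-resp (λ n m → solve 4 (λ a b c d → (a :- b) :+ (c :- d) := (a :+ c) :- (b :+ d)) refl _ _ _ _) (degree-+ Δp Δq))

    degree-neg : ∀ {d p} → Degree d p → Degree d (λ n m → - p n m)
    degree-neg (vanishing z) = vanishing (λ n m → trans (-‿cong (z n m)) -0#≈0#)
    degree-neg (growing C 0≤C b Δp) = growing C 0≤C (λ n m → ≼-neg (b n m))
      (degree-resp (λ n m → solve 2 (λ a b → :- (a :- b) := :- a :- :- b) refl _ _) (degree-neg Δp))

    -- By the Leibniz rule Δ(pq) = Δp · q(m+1) + p · Δq, one degree drops in each summand, which
    -- drives the recursion. The index strictly exceeds the degree, so a + 1 and b + 1 combine to a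
    -- + b + 1.
    degree-* : ∀ a b {p q} → Degree (suc a) p → Degree (suc b) q → Degree (suc (a ℕ.+ b)) (λ n m → p n m * q n m)
    degree-* a b {p} {q} P@(growing C 0≤C β Δp) Q@(growing C′ 0≤C′ β′ Δq) = growing (C * C′) (*-nonneg 0≤C 0≤C′)
      (λ n m → ≼-resp refl (begin-equality
          C * w n m ^ a * (C′ * w n m ^ b)    ≈⟨ solve 4 (λ c x d y → c :* x :* (d :* y) := c :* d :* (x :* y)) refl _ _ _ _ ⟩
          C * C′ * (w n m ^ a * w n m ^ b)    ≈⟨ *-congˡ (^-homo-* (w n m) a b) ⟨
          C * C′ * w n m ^ (a ℕ.+ b)          ∎) (≼-* (β n m) (β′ n m)))
      (degree-resp (λ n m → solve 4 (λ p p′ q q′ → (p′ :- p) :* q′ :+ p :* (q′ :- q) := p′ :* q′ :- p :* q) refl (p n m)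
              (p n (suc m)) (q n m) (q n (suc m)))
        (degree-+ (left a Δp) (right b Δq)))
      where
      left : ∀ a → Degree a (λ n → Δ (p n)) → Degree (a ℕ.+ b) (λ n m → Δ (p n) m * q n (suc m))
      left zero    (vanishing z) = degree-0 b (λ n m → trans (*-congʳ (z n m)) (ℝᵣ.zeroˡ _))
      left (suc a) Δp            = degree-* a b Δp (degree-shift Q)
      right : ∀ b → Degree b (λ n → Δ (q n)) → Degree (a ℕ.+ b) (λ n m → p n m * Δ (q n) m)
      right zero    (vanishing z) = degree-0 (a ℕ.+ 0) (λ n m → trans (*-congˡ (z n m)) (ℝᵣ.zeroʳ _))
      right (suc b) Δq            = ≡.subst (λ d → Degree d (λ n m → p n m * Δ (q n) m)) (≡.sym (ℕ.+-suc a b)) (degree-* a b P Δq)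

    degree-^ : ∀ {a p} → Degree (suc a) p → ∀ k → Degree (suc (k ℕ.* a)) (λ n m → p n m ^ k)
    degree-^ P zero        = growing 1# 0≤1 (λ n m → ≼-resp refl (sym (ℝᵣ.*-identityʳ _)) (≼-self 0≤1))
            (vanishing (λ n m → ℝᵣ.-‿inverseʳ 1#))
    degree-^ {a} P (suc k) = degree-* a (k ℕ.* a) P (degree-^ P k)

    degree-t : Degree 2 (λ n m → t m)
    degree-t = growing 1# 0≤1
      (λ n m → ≼-between (0≤t m) (≤-resp refl (solve 1 (λ w → w := :1 :* (w :* :1)) refl (w n m)) (x≤y+x (0≤W n))))
      (growing 1# 0≤1 (λ n m → ≼-resp (solve 2 (λ m x → :1 := :1 :+ m :+ x :- (m :+ x)) refl (fromℕ-ℝ m) x)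
              (sym (ℝᵣ.*-identityʳ _)) (≼-self 0≤1))
        (vanishing (λ n m → solve 2 (λ m x → (:1 :+ (:1 :+ m) :+ x) :- (:1 :+ m :+ x) :-
                (:1 :+ m :+ x :- (m :+ x)) := :0) refl (fromℕ-ℝ m) x)))

    -- Constant in m, yet not given index 1: a bound whose constant is independent of n costs one
    -- power of `w`. Both summands of `increment` thus share the index r + 1.
    degree-base : Degree 2 (λ n m → t n)
    degree-base = growing 1# 0≤1
      (λ n m → ≼-between (0≤t n) (≤-resp refl (solve 1 (λ w → w := :1 :* (w :* :1)) refl (w n m))
              (≤-trans (t≤W n) (x≤x+y (0≤t m)))))
      (degree-0 1 (λ n m → ℝᵣ.-‿inverseʳ (t n)))

    increment : ℕ → ℕ → ℕ → ℝ
    increment r n m = t m ^ r - t n ^ r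

    degree-increment : ∀ r → Degree (suc r) (increment r)
    degree-increment r = degree-+ (power degree-t) (degree-neg (power degree-base))
      where
      power : ∀ {p} → Degree 2 p → Degree (suc r) (λ n m → p n m ^ r)
      power {p} P = ≡.subst (λ d → Degree (suc d) (λ n m → p n m ^ r)) (ℕ.*-identityʳ r) (degree-^ P r)

    degree-Δ^ : ∀ K {d p} → Degree (K ℕ.+ d) p → Degree d (λ n → Δ^ K (p n))
    degree-Δ^ zero    P                   = P
    degree-Δ^ (suc K) (growing _ _ _ Δp) = degree-Δ^ K Δp

    Δ^-vanishes : ∀ {d K p} → Degree d p → d ℕ.≤ K → ∀ n m → Δ^ K (p n) m ≈ 0#
    Δ^-vanishes {K = K} (vanishing z) z≤n n m              = Δ^-0 K (z n) m
    Δ^-vanishes (growing _ _ _ Δp) (s≤s d≤K) n m = Δ^-vanishes Δp d≤K n m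

  open ℕ-Solver using () renaming (solve to solveℕ; _:+_ to _⊕_; _:*_ to _⊗_; con to lit; _:=_ to _⊜_)

  -- Differences of the damping factor

  -- A mean value estimate. The induction uses (s+y)^(r+2) - y^(r+2) = s(s+y)^(r+1) + y((s+y)^(r+1)
  -- - y^(r+1)), with s + y ≤ (1+κ)(1+y) in the first summand. In the application s is the shift i
  -- and κ the order K of the difference.
  power-difference : ∀ {κ} → 0# ≤ κ → ∀ r → ∃ λ C → 0# ≤ C × (∀ {s y} → 0# ≤ s → s ≤ κ → 0# ≤ y →
    (s + y) ^ suc r - y ^ suc r ≤ C * (1# + y) ^ r)
  power-difference {κ} 0≤κ zero = κ , 0≤κ , λ {s} {y} _ s≤κ _ →
    ≤-resp (solve 2 (λ s y → s := (s :+ y) :* :1 :- y :* :1) refl s y) (sym (ℝᵣ.*-identityʳ κ)) s≤κ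
  power-difference {κ} 0≤κ (suc r) = let C , 0≤C , bound = power-difference 0≤κ r in
    κ * (1# + κ) ^ suc r + C , +-nonneg (*-nonneg 0≤κ (^-nonneg 0≤1+κ (suc r))) 0≤C , λ {s} {y} 0≤s s≤κ 0≤y →
    let 0≤s+y = +-nonneg 0≤s 0≤y ; 0≤1+y = +-nonneg 0≤1 0≤y in begin
      (s + y) * (s + y) ^ suc r - y * y ^ suc r
        ≈⟨ solve 4 (λ s y p q → (s :+ y) :* p :- y :* q := s :* p :+ y :* (p :- q)) refl s y _ _ ⟩
      s * (s + y) ^ suc r + y * ((s + y) ^ suc r - y ^ suc r)
        ≤⟨ +-mono-≤
             (*-mono-≤ (^-nonneg 0≤s+y (suc r)) 0≤κ s≤κ
               (^-mono-≤ 0≤s+y (≤-trans (+-monoˡ-≤ y s≤κ) (≤-by (1# + κ * y) (+-nonneg 0≤1 (*-nonneg 0≤κ 0≤y))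
                 (solve 2 (λ k y → k :+ y :+ (:1 :+ k :* y) := (:1 :+ k) :* (:1 :+ y)) refl κ y))) (suc r)))
             (≤-trans (*-monoʳ-≤ 0≤y (bound 0≤s s≤κ 0≤y)) (*-monoˡ-≤ (*-nonneg 0≤C (^-nonneg 0≤1+y r)) (x≤y+x 0≤1))) ⟩
      κ * ((1# + κ) * (1# + y)) ^ suc r + (1# + y) * (C * (1# + y) ^ r)
        ≈⟨ +-congʳ (*-congˡ (^-distrib-* (1# + κ) (1# + y) (suc r))) ⟩
      κ * ((1# + κ) ^ suc r * (1# + y) ^ suc r) + (1# + y) * (C * (1# + y) ^ r)
        ≈⟨ solve 5 (λ k p z y c → k :* (p :* (y :* z)) :+ y :* (c :* z) := (k :* p :+ c) :* (y :* z)) refl κ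
                ((1# + κ) ^ suc r) ((1# + y) ^ r) (1# + y) C ⟩
      (κ * (1# + κ) ^ suc r + C) * (1# + y) ^ suc r ∎
    where
    0≤1+κ : 0# ≤ 1# + κ
    0≤1+κ = +-nonneg 0≤1 0≤κ

  -- A majorant of order 1/n² with explicit partial sums, since it telescopes.
  v : ℕ → ℝ
  v n = recip (suc n) * recip (suc (suc n))

  0≤v : ∀ n → 0# ≤ v n
  0≤v n = *-nonneg (0≤recip (suc n)) (0≤recip (suc (suc n)))

  v-telescopes : ∀ n → v n ≈ recip (suc n) - recip (suc (suc n))
  v-telescopes n = begin-equality
    a * b                                    ≈⟨ solve 3 (λ m a b → a :* b := (:1 :+ m) :* (a :* b) :- m :* (a :* b)) refl m a b ⟩
    (1# + m) * (a * b) - m * (a * b)         ≈⟨ +-cong (trans (solve 3 (λ m a b → m :* (a :* b) := a :* (m :* b)) refl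
            (1# + m) a b) (*-congˡ (fromℕ*recip (suc (suc n)))))
                                                  (-‿cong (trans (sym (ℝᵣ.*-assoc m a b)) (*-congʳ (fromℕ*recip (suc n))))) ⟩
    a * 1# - 1# * b                          ≈⟨ solve 2 (λ a b → a :* :1 :- :1 :* b := a :- b) refl a b ⟩
    a - b                                    ∎
    where
    a = recip (suc n)
    b = recip (suc (suc n))
    m = fromℕ-ℝ (suc n)

  ∑-v : ∀ k n → ∑ (k ℕ.+ n) v - ∑ n v ≈ recip (suc n) - recip (suc (k ℕ.+ n))
  ∑-v zero    n = trans (ℝᵣ.-‿inverseʳ _) (sym (ℝᵣ.-‿inverseʳ _))
  ∑-v (suc k) n = trans (solve 3 (λ s t v → (s :+ v) :- t := (s :- t) :+ v) refl _ _ _)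
    (trans (+-cong (∑-v k n) (v-telescopes (k ℕ.+ n))) (solve 3 (λ a b c → (a :- b) :+ (b :- c) := a :- c) refl _ _ _))

  ∑-v-≼ : ∀ k n → ∑ (k ℕ.+ n) v - ∑ n v ≼ recip (suc n)
  ∑-v-≼ k n = ≼-between
    (≤-resp refl (trans (solve 3 (λ s t u → u := (t :+ u) :- t) refl 0# (∑ n v) _) (+-congʳ (sym (∑-append k n v))))
            (∑-nonneg k (λ i → 0≤v (i ℕ.+ n))))
    (≤-by (recip (suc (k ℕ.+ n))) (0≤recip (suc (k ℕ.+ n))) (trans (+-congʳ (∑-v k n))
            (solve 2 (λ a b → a :- b :+ b := a) refl _ _)))

  module Damping {x : ℝ} (0≤x : 0# ≤ x) (r′ : ℕ) where

    open Growth 0≤x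

    r : ℕ
    r = suc r′

    F : ℝ → ℕ → ℝ
    F θ n = e^ (- (t n ^ r * θ))

    0≤t^r : ∀ n → 0# ≤ t n ^ r
    0≤t^r n = ^-nonneg (0≤t n) r

    0≤F : ∀ {θ} → 0# ≤ θ → ∀ n → 0# ≤ F θ n
    0≤F 0≤θ n = 0≤e^- (*-nonneg (0≤t^r n) 0≤θ)

    -- (1 + t)^r is at most 2^r for t ≤ 1 and at most (2t)^r for t ≥ 1; the right side dominates
    -- both.
    W^r≤ : ∀ n → W n ^ r ≤ 2^ r * (1# + t n ^ r)
    W^r≤ n = ≤-cases (t n ≤ 1#)
      (λ t≤1 → ≤-trans (^-mono-≤ (0≤W n) (+-monoʳ-≤ 1# t≤1) r)
        (≤-resp (ℝᵣ.*-identityʳ _) refl (*-monoʳ-≤ (0≤2^ r) (x≤x+y (0≤t^r n)))))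
      (λ t≰1 → ≤-trans (^-mono-≤ (0≤W n) (≤-resp refl (solve 1 (λ t → t :+ t := (:1 :+ :1) :* t) refl (t n))
              (+-monoˡ-≤ (t n) (λ t<1 → t≰1 (<⇒≤ t<1)))) r)
        (≤-resp (sym (^-distrib-* (1# + 1#) (t n) r)) refl (*-monoʳ-≤ (0≤2^ r) (x≤y+x 0≤1))))

    -- With s = θ tʳ this is boundedness of (1+s)ʲ e⁻ˢ.
    damp : ∀ j → ∃ λ C → 0# ≤ C × (∀ {θ} → 0# ≤ θ → θ ≤ 1# → ∀ n → (W n ^ r * θ) ^ j * F θ n ≤ C)
    damp j = (2^ r) ^ j * (fromℕ-ℝ (j !) * e^ 1#) ,
      *-nonneg (^-nonneg (0≤2^ r) j) (*-nonneg (0≤fromℕ (j !)) (≤-trans 0≤1 (1≤e^ 0≤1))) , λ {θ} 0≤θ θ≤1 n →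
      let s = t n ^ r * θ
          0≤s = *-nonneg (0≤t^r n) 0≤θ
          0≤1+s = +-nonneg 0≤1 0≤s
          j!≢0 = j ℕ.!≢0
      in begin
        (W n ^ r * θ) ^ j * F θ n
          ≤⟨ *-monoˡ-≤ (0≤F 0≤θ n) (^-mono-≤ (*-nonneg (^-nonneg (0≤W n) r) 0≤θ)
               (≤-trans (*-monoˡ-≤ 0≤θ (W^r≤ n)) (≤-trans (≤-reflexive
                       (solve 3 (λ k t θ → k :* (:1 :+ t) :* θ := k :* (θ :+ t :* θ)) refl _ _ _)) (*-monoʳ-≤ (0≤2^ r)
                       (+-monoˡ-≤ s θ≤1)))) j) ⟩
        (2^ r * (1# + s)) ^ j * F θ n
          -- A factor e is spent on writing e^(-s) as e · e^(-(1+s)), so that (1+s)^j meets the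
          -- exponential of its own argument.
          ≈⟨ *-cong (^-distrib-* (2^ r) (1# + s) j) (trans (e^-cong (solve 1 (λ s → :- s := :1 :+ :- (:1 :+ s)) refl s))
                  (e^-+ 1# (- (1# + s)))) ⟩
        (2^ r) ^ j * (1# + s) ^ j * (e^ 1# * e^ (- (1# + s)))
          ≈⟨ *-congʳ (*-congˡ (trans (sym (ℝᵣ.*-identityˡ _)) (*-congʳ (sym (fromℕ*recip (j !) {{j!≢0}}))))) ⟩
        (2^ r) ^ j * (fromℕ-ℝ (j !) * recip (j !) {{j!≢0}} * (1# + s) ^ j) * (e^ 1# * e^ (- (1# + s)))
          ≈⟨ solve 6 (λ k m i p e f → k :* (m :* i :* p) :* (e :* f) := k :* (m :* e) :* (p :* i :* f)) refl ((2^ r) ^ j)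
                  (fromℕ-ℝ (j !)) (recip (j !) {{j!≢0}}) ((1# + s) ^ j) (e^ 1#) (e^ (- (1# + s))) ⟩
        (2^ r) ^ j * (fromℕ-ℝ (j !) * e^ 1#) * (expSeries (1# + s) j * e^ (- (1# + s)))
          ≤⟨ *-monoʳ-≤ (*-nonneg (^-nonneg (0≤2^ r) j) (*-nonneg (0≤fromℕ (j !)) (≤-trans 0≤1 (1≤e^ 0≤1))))
                  (expSeries*e^-≤1 0≤1+s j) ⟩
        (2^ r) ^ j * (fromℕ-ℝ (j !) * e^ 1#) * 1#
          ≈⟨ ℝᵣ.*-identityʳ _ ⟩
        (2^ r) ^ j * (fromℕ-ℝ (j !) * e^ 1#) ∎

    -- 1 = (n+1)(n+2) v n, where n + 1 ≤ W n and n + 2 ≤ 2 W n. This buys the factor `v` at the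
    -- price of two powers of `W`.
    1≤2W²v : ∀ n → 1# ≤ (1# + 1#) * (W n * W n) * v n
    1≤2W²v n = begin
      1#                       ≈⟨ trans (*-cong (fromℕ*recip (suc n)) (fromℕ*recip (suc (suc n)))) (ℝᵣ.*-identityˡ 1#) ⟨
      (m * recip (suc n)) * ((1# + m) * recip (suc (suc n)))
        ≈⟨ solve 4 (λ m a k b → (m :* a) :* (k :* b) := m :* k :* (a :* b)) refl _ _ _ _ ⟩
      m * (1# + m) * v n       ≤⟨ *-monoˡ-≤ (0≤v n) (*-mono-≤ (≤-trans (0≤fromℕ (suc n)) (x≤y+x 0≤1)) (0≤W n) m≤W
              (+-mono-≤ (1≤W n) m≤W)) ⟩
      W n * (W n + W n) * v n  ≈⟨ *-congʳ (solve 1 (λ w → w :* (w :+ w) := (:1 :+ :1) :* (w :* w)) refl (W n)) ⟩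
      (1# + 1#) * (W n * W n) * v n ∎
      where
      m = fromℕ-ℝ (suc n)
      m≤W : m ≤ W n
      m≤W = +-monoʳ-≤ 1# (x≤x+y 0≤x)

    -- The balance sheet of the damping: a powers of W, two more spent on `v`, and j powers of θ
    -- make up (W^r θ)^j when rj = a + 2, and F keeps that bounded. What remains is θ^q v.
    absorb : ∀ q j a → r ℕ.* j ≡ 2 ℕ.+ a → ∃ λ C → 0# ≤ C ×
      (∀ {θ} → 0# ≤ θ → θ ≤ 1# → ∀ n → F θ n * (θ ^ (q ℕ.+ j) * W n ^ a) ≤ C * θ ^ q * v n)
    absorb q j a rj≡2+a = let C , 0≤C , bound = damp j in
      (1# + 1#) * C , *-nonneg 0≤2 0≤C , λ {θ} 0≤θ θ≤1 n →
      let 0≤θ^qv = *-nonneg (^-nonneg 0≤θ q) (0≤v n) in begin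
        F θ n * (θ ^ (q ℕ.+ j) * W n ^ a)
          ≤⟨ ≤-resp (ℝᵣ.*-identityʳ _) refl (*-monoʳ-≤ (*-nonneg (0≤F 0≤θ n)
                  (*-nonneg (^-nonneg 0≤θ (q ℕ.+ j)) (^-nonneg (0≤W n) a))) (1≤2W²v n)) ⟩
        F θ n * (θ ^ (q ℕ.+ j) * W n ^ a) * ((1# + 1#) * (W n * W n) * v n)
          ≈⟨ *-congʳ (*-congˡ (*-congʳ (^-homo-* θ q j))) ⟩
        F θ n * (θ ^ q * θ ^ j * W n ^ a) * ((1# + 1#) * (W n * W n) * v n)
          ≈⟨ solve 6 (λ f p s u w v → f :* (p :* s :* u) :* ((:1 :+ :1) :* (w :* w) :* v) := (:1 :+ :1) :*
                  (w :* (w :* u) :* s :* f) :* (p :* v)) refl (F θ n) (θ ^ q) (θ ^ j) (W n ^ a) (W n) (v n) ⟩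
        (1# + 1#) * (W n ^ (2 ℕ.+ a) * θ ^ j * F θ n) * (θ ^ q * v n)
          ≈⟨ *-congʳ (*-congˡ (*-congʳ (trans (*-congʳ (trans (ℝᵣ.reflexive (≡.cong (W n ^_) (≡.sym rj≡2+a)))
                  (sym (^-assocʳ (W n) r j)))) (sym (^-distrib-* (W n ^ r) θ j))))) ⟩
        (1# + 1#) * ((W n ^ r * θ) ^ j * F θ n) * (θ ^ q * v n)
          ≤⟨ *-monoˡ-≤ 0≤θ^qv (*-monoʳ-≤ 0≤2 (bound 0≤θ θ≤1 n)) ⟩
        (1# + 1#) * C * (θ ^ q * v n)
          ≈⟨ ℝᵣ.*-assoc _ _ _ ⟨
        (1# + 1#) * C * θ ^ q * v n ∎

    F-factor : ∀ θ n m → F θ m ≈ F θ n * e^ (- (increment r n m * θ))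
    F-factor θ n m = trans (e^-cong (solve 3 (λ a b θ → :- (a :* θ) := :- (b :* θ) :+ :- ((a :- b) :* θ)) refl (t m ^ r)
            (t n ^ r) θ)) (e^-+ _ _)

    -- The value rq + 2 is forced by `remainder-bound`: the equations K = q + j and rj = 2 + r′K
    -- have the single solution j = r′q + 2. In this spelling K is definitionally q + j, as `absorb`
    -- expects.
    order : ℕ → ℕ
    order q = q ℕ.+ (r′ ℕ.* q ℕ.+ 2)

    taylor-term : ℝ → ℕ → ℕ → ℕ → ℝ
    taylor-term θ k n m = expSeries (- (increment r n m * θ)) k

    -- In m the term is a polynomial of degree rk. If rk < K its Kth difference vanishes. Otherwise
    -- that difference is O(θ^k W^a) with a = rk - K, and j = k - q satisfies rj = rk - rq = a + 2.
    taylor-term-bound : ∀ q k → ∃ λ C → 0# ≤ C × (∀ {θ} → 0# ≤ θ → θ ≤ 1# → ∀ n →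
      F θ n * Δ^ (order q) (taylor-term θ k n) n ≼ C * θ ^ q * v n)
    taylor-term-bound q k = [ low , high ]′ (ℕ.≤-<-connex (suc (k ℕ.* r)) K)
      where
      K = order q
      k!≢0 = k ℕ.!≢0
      Goal = ∃ λ C → 0# ≤ C × (∀ {θ} → 0# ≤ θ → θ ≤ 1# → ∀ n → F θ n * Δ^ K (taylor-term θ k n) n ≼ C * θ ^ q * v n)
      P : Degree (suc (k ℕ.* r)) (λ n m → increment r n m ^ k)
      P = degree-^ (degree-increment r) k
      κ : ℝ → ℝ
      κ θ = (- θ) ^ k * recip (k !) {{k!≢0}}
      term≈ : ∀ θ n → Δ^ K (taylor-term θ k n) n ≈ κ θ * Δ^ K (λ m → increment r n m ^ k) n
      term≈ θ n = trans (Δ^-cong K (λ m → begin-equality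
          (- (increment r n m * θ)) ^ k * recip (k !) {{k!≢0}}
            ≈⟨ *-congʳ (trans (^-congˡ k (solve 2 (λ p θ → :- (p :* θ) := :- θ :* p) refl _ θ)) (^-distrib-* (- θ) _ k)) ⟩
          (- θ) ^ k * increment r n m ^ k * recip (k !) {{k!≢0}}
            ≈⟨ solve 3 (λ a b c → a :* b :* c := a :* c :* b) refl _ _ _ ⟩
          κ θ * increment r n m ^ k ∎) n) (Δ^-* K (κ θ) (λ m → increment r n m ^ k) n)
      low : suc (k ℕ.* r) ℕ.≤ K → Goal
      low le = 0# , ≤-refl , λ {θ} _ _ n → ≼-0
        (trans (*-congˡ (trans (term≈ θ n) (trans (*-congˡ (Δ^-vanishes P le n n)) (ℝᵣ.zeroʳ _)))) (ℝᵣ.zeroʳ _))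
        (≤-reflexive (solve 2 (λ a b → :0 := :0 :* a :* b) refl _ _))
      high : K ℕ.< suc (k ℕ.* r) → Goal
      high (s≤s K≤kr) = go (
          (degree-Δ^ K (≡.subst (λ d → Degree d (λ n m → increment r n m ^ k))
                  (≡.trans (≡.cong suc (≡.sym K+a≡kr)) (≡.sym (ℕ.+-suc K a))) P)))
        where
        a = k ℕ.* r ℕ.∸ K
        K+a≡kr : K ℕ.+ a ≡ k ℕ.* r
        K+a≡kr = ℕ.m+[n∸m]≡n K≤kr
        K≡ : K ≡ q ℕ.* r ℕ.+ 2
        K≡ = solveℕ 2 (λ q r → q ⊕ (r ⊗ q ⊕ lit 2) ⊜ q ⊗ (lit 1 ⊕ r) ⊕ lit 2) ≡.refl q r′
        q≤k : q ℕ.≤ k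
        q≤k = ℕ.*-cancelʳ-≤ q k r (ℕ.≤-trans (ℕ.m≤m+n (q ℕ.* r) 2) (ℕ.≤-trans (ℕ.≤-reflexive (≡.sym K≡)) K≤kr))
        j = k ℕ.∸ q
        q+j≡k : q ℕ.+ j ≡ k
        q+j≡k = ℕ.m+[n∸m]≡n q≤k
        rj≡2+a : r ℕ.* j ≡ 2 ℕ.+ a
        rj≡2+a = ℕ.+-cancelˡ-≡ (q ℕ.* r) (r ℕ.* j) (2 ℕ.+ a) (≡.trans
          (≡.trans (≡.cong (q ℕ.* r ℕ.+_) (ℕ.*-comm r j)) (≡.trans (≡.sym (ℕ.*-distribʳ-+ r q j)) (≡.cong (ℕ._* r) q+j≡k)))
          (≡.trans (≡.sym K+a≡kr) (≡.trans (≡.cong (ℕ._+ a) K≡) (ℕ.+-assoc (q ℕ.* r) 2 a))))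
        go : Degree (suc a) (λ n → Δ^ K (λ m → increment r n m ^ k)) → Goal
        go (growing C 0≤C b _) = let C′ , 0≤C′ , bound = absorb q j a rj≡2+a in
          (C * 2^ a) * C′ , *-nonneg (*-nonneg 0≤C (0≤2^ a)) 0≤C′ , λ {θ} 0≤θ θ≤1 n →
          ≼-respˡ (*-congˡ (sym (term≈ θ n))) (≼-mono (begin
            F θ n * ((θ ^ k * 1#) * (C * w n n ^ a))
              ≤⟨ *-monoʳ-≤ (0≤F 0≤θ n) (*-monoʳ-≤ (*-nonneg (^-nonneg 0≤θ k) 0≤1) (*-monoʳ-≤ 0≤C
                   (≤-resp refl (^-distrib-* _ (W n) a) (^-mono-≤ (0≤w n n)
                     (≤-resp refl (solve 1 (λ w → w :+ w := (:1 :+ :1) :* w) refl (W n)) (+-monoʳ-≤ (W n) (t≤W n))) a)))) ⟩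
            F θ n * ((θ ^ k * 1#) * (C * (2^ a * W n ^ a)))
              ≈⟨ solve 5 (λ f p c b w → f :* (p :* :1 :* (c :* (b :* w))) := c :* b :* (f :* (p :* w))) refl (F θ n)
                      (θ ^ k) C (2^ a) (W n ^ a) ⟩
            (C * 2^ a) * (F θ n * (θ ^ k * W n ^ a))
              ≈⟨ *-congˡ (*-congˡ (*-congʳ (ℝᵣ.reflexive (≡.cong (θ ^_) (≡.sym q+j≡k))))) ⟩
            (C * 2^ a) * (F θ n * (θ ^ (q ℕ.+ j) * W n ^ a))
              ≤⟨ *-monoʳ-≤ (*-nonneg 0≤C (0≤2^ a)) (bound 0≤θ θ≤1 n) ⟩
            (C * 2^ a) * (C′ * θ ^ q * v n)
              ≈⟨ solve 4 (λ c d p v → c :* (d :* p :* v) := c :* d :* p :* v) refl _ _ _ _ ⟩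
            (C * 2^ a) * C′ * θ ^ q * v n ∎)
          (≼-* (≼-self (0≤F 0≤θ n)) (≼-* (≼-* (≼-^ (≼-neg (≼-self 0≤θ)) k)
                  (≼-between (0≤recip (k !) {{k!≢0}}) (recip≤1 (k !) {{k!≢0}}))) (b n n))))

    remainder : ℝ → ℕ → ℕ → ℕ → ℝ
    remainder θ K n m = e^ (- (increment r n m * θ)) - ∑ K (λ k → taylor-term θ k n m)

    -- Differencing gains nothing on the remainder, so its size at each of the points n, ..., n + K
    -- has to suffice by itself.
    remainder-bound : ∀ q → let K = order q in ∃ λ C → 0# ≤ C × (∀ {θ} → 0# ≤ θ → θ ≤ 1# → ∀ n i → i ℕ.≤ K →
      F θ n * remainder θ K n (i ℕ.+ n) ≼ C * θ ^ q * v n)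
    remainder-bound q =
      let C , 0≤C , taylor = e^-taylor K
          D , 0≤D , difference = power-difference (0≤fromℕ K) r′
          E , 0≤E , bound = absorb q j a exponents
      in (C * D ^ K) * E , *-nonneg (*-nonneg 0≤C (^-nonneg 0≤D K)) 0≤E , λ {θ} 0≤θ θ≤1 n i i≤K →
      let p = increment r n (i ℕ.+ n)
          t≈ : (fromℕ-ℝ i + t n) ^ r ≈ t (i ℕ.+ n) ^ r
          t≈ = ^-congˡ r (trans (sym (ℝᵣ.+-assoc _ _ _)) (+-congʳ (sym (×-homo-+ 1# i n))))
          0≤p : 0# ≤ p
          0≤p = sub-nonneg (≤-resp refl t≈ (^-mono-≤ (0≤t n) (x≤y+x (0≤fromℕ i)) r))
          p≤ : p ≤ D * W n ^ r′
          p≤ = ≤-resp (+-congʳ t≈) refl (difference (0≤fromℕ i) (fromℕ-mono i≤K) (0≤t n))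
      in ≼-mono (begin
        F θ n * (C * (p * θ) ^ K)
          ≤⟨ *-monoʳ-≤ (0≤F 0≤θ n) (*-monoʳ-≤ 0≤C (^-mono-≤ (*-nonneg 0≤p 0≤θ) (*-monoˡ-≤ 0≤θ p≤) K)) ⟩
        F θ n * (C * (D * W n ^ r′ * θ) ^ K)
          ≈⟨ *-congˡ (*-congˡ (trans (^-distrib-* _ θ K) (*-congʳ (trans (^-distrib-* D _ K) (*-congˡ (^-assocʳ (W n) r′ K)))))) ⟩
        F θ n * (C * (D ^ K * W n ^ a * θ ^ K))
          ≈⟨ solve 5 (λ f c d w p → f :* (c :* (d :* w :* p)) := c :* d :* (f :* (p :* w))) refl (F θ n) C (D ^ K)
                  (W n ^ a) (θ ^ K) ⟩
        (C * D ^ K) * (F θ n * (θ ^ K * W n ^ a))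
          ≤⟨ *-monoʳ-≤ (*-nonneg 0≤C (^-nonneg 0≤D K)) (bound 0≤θ θ≤1 n) ⟩
        (C * D ^ K) * (E * θ ^ q * v n)
          ≈⟨ solve 4 (λ c d p v → c :* (d :* p :* v) := c :* d :* p :* v) refl _ _ _ _ ⟩
        (C * D ^ K) * E * θ ^ q * v n ∎)
      (≼-* (≼-self (0≤F 0≤θ n)) (taylor (*-nonneg 0≤p 0≤θ)))
      where
      K = order q
      j = r′ ℕ.* q ℕ.+ 2
      a = r′ ℕ.* K
      exponents : r ℕ.* j ≡ 2 ℕ.+ a
      exponents = solveℕ 2 (λ q r → (lit 1 ⊕ r) ⊗ (r ⊗ q ⊕ lit 2) ⊜ lit 2 ⊕ r ⊗ (q ⊕ (r ⊗ q ⊕ lit 2))) ≡.refl q r′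

    difference-bound : ∀ q → ∃ λ C → 0# ≤ C × (∀ {θ} → 0# ≤ θ → θ ≤ 1# → ∀ n → Δ^ (order q) (F θ) n ≼ C * θ ^ q * v n)
    difference-bound q =
      let E , 0≤E , rest = remainder-bound q in
      ∑ K (λ k → proj₁ (terms k)) + 2^ K * E , +-nonneg (∑-nonneg K (λ k → proj₁ (proj₂ (terms k))))
              (*-nonneg (0≤2^ K) 0≤E) , λ {θ} 0≤θ θ≤1 n →
      ≼-resp (sym (begin-equality
          Δ^ K (F θ) n
            ≈⟨ Δ^-cong K (λ m → trans (F-factor θ n m) (solve 3 (λ f e s → f :* e := f :* s :+ f :* (e :- s)) refl
                    (F θ n) _ (∑ K (λ k → taylor-term θ k n m)))) n ⟩
          Δ^ K (λ m → F θ n * ∑ K (λ k → taylor-term θ k n m) + F θ n * remainder θ K n m) n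
            ≈⟨ Δ^-+ K _ _ n ⟩
          Δ^ K (λ m → F θ n * ∑ K (λ k → taylor-term θ k n m)) n + Δ^ K (λ m → F θ n * remainder θ K n m) n
            ≈⟨ +-congʳ (trans (Δ^-* K (F θ n) _ n) (trans (*-congˡ (Δ^-∑ K K (λ k → taylor-term θ k n) n))
                    (sym (∑-* K (F θ n) _)))) ⟩
          ∑ K (λ k → F θ n * Δ^ K (taylor-term θ k n) n) + Δ^ K (λ m → F θ n * remainder θ K n m) n ∎))
        (begin-equality
          ∑ K (λ k → proj₁ (terms k) * θ ^ q * v n) + 2^ K * (E * θ ^ q * v n)
            ≈⟨ +-congʳ (trans (∑-cong K (λ k → solve 3 (λ c p v → c :* p :* v := p :* v :* c) refl _ _ _))
                    (∑-* K (θ ^ q * v n) _)) ⟩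
          (θ ^ q * v n) * ∑ K (λ k → proj₁ (terms k)) + 2^ K * (E * θ ^ q * v n)
            ≈⟨ solve 5 (λ p v s b e → p :* v :* s :+ b :* (e :* p :* v) := (s :+ b :* e) :* p :* v) refl (θ ^ q) (v n) _
                    (2^ K) E ⟩
          (∑ K (λ k → proj₁ (terms k)) + 2^ K * E) * θ ^ q * v n ∎)
        (≼-+ (∑-≼ K (λ k _ → proj₂ (proj₂ (terms k)) 0≤θ θ≤1 n)) (Δ^-≼ K n (λ i i≤K → rest 0≤θ θ≤1 n i i≤K)))
      where
      K = order q
      terms = taylor-term-bound q

  -- Summation by parts against periodic sequences

  Periodic : ℕ → (ℕ → ℝ) → Set ℓ₁
  Periodic f X = ∀ n → X (n ℕ.+ f) ≈ X n

  record Oscillating (f : ℕ) (X : ℕ → ℝ) : Set ℓ₁ where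
    field
      recurs   : Periodic f X
      balanced : ∑ f X ≈ 0#

  module _ {f : ℕ} .{{f≢0 : NonZero f}} where

    -- The sum of the bounds over one period stands in for their maximum.
    periodic-bounded : ∀ {X} → Periodic f X → ∃ λ C → 0# ≤ C × (∀ n → X n ≼ C)
    periodic-bounded {X} per = ∑ f D , ∑-nonneg f 0≤D , λ n →
      ≼-respˡ (trans (sym (multiple (n % f) (n / f))) (ℝᵣ.reflexive (≡.cong X (≡.sym (m≡m%n+[m/n]*n n f)))))
        (≼-mono (∑-term≤ f 0≤D (n % f) (m%n<n n f)) (proj₂ (≼-bound (X (n % f)))))
      where
      D : ℕ → ℝ
      D n = proj₁ (≼-bound (X n))
      0≤D : ∀ n → 0# ≤ D n
      0≤D n = ≼-nonneg (proj₂ (≼-bound (X n)))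
      multiple : ∀ n k → X (n ℕ.+ k ℕ.* f) ≈ X n
      multiple n zero    = ℝᵣ.reflexive (≡.cong X (ℕ.+-identityʳ n))
      multiple n (suc k) = trans (ℝᵣ.reflexive (≡.cong X (≡.trans (≡.cong (n ℕ.+_) (ℕ.+-comm f (k ℕ.* f)))
              (≡.sym (ℕ.+-assoc n (k ℕ.* f) f)))))
        (trans (per (n ℕ.+ k ℕ.* f)) (multiple n k))

    -- The constant is chosen such that the shift of the antiderivative by one sums to zero over a period.
    antiderivative : (ℕ → ℝ) → ℕ → ℝ
    antiderivative X n = ∑ n X - recip f * ∑ f (λ k → ∑ (suc k) X)

    -- The shift arises because summation by parts pairs Δ F at n with the antiderivative at n + 1.
    next : (ℕ → ℝ) → ℕ → ℝ
    next X n = antiderivative X (suc n)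

    antiderivative-periodic : ∀ {X} → Oscillating f X → Periodic f (antiderivative X)
    antiderivative-periodic {X} osc n = +-congʳ (begin-equality
      ∑ (n ℕ.+ f) X                        ≈⟨ ∑-append n f X ⟩
      ∑ f X + ∑ n (λ k → X (k ℕ.+ f))      ≈⟨ +-cong balanced (∑-cong n recurs) ⟩
      0# + ∑ n X                           ≈⟨ ℝᵣ.+-identityˡ _ ⟩
      ∑ n X                                ∎)
      where open Oscillating osc

    next-oscillating : ∀ {X} → Oscillating f X → Oscillating f (next X)
    next-oscillating {X} osc = record
      { recurs   = λ n → antiderivative-periodic osc (suc n)
      ; balanced = begin-equality
          ∑ f (λ k → ∑ (suc k) X - recip f * S)   ≈⟨ ∑-+ f (λ k → ∑ (suc k) X) (λ _ → - (recip f * S)) ⟩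
          S + ∑ f (λ _ → - (recip f * S))         ≈⟨ +-congˡ (∑-const f _) ⟩
          S + fromℕ-ℝ f * - (recip f * S)         ≈⟨ solve 3 (λ s m k → s :+ m :* :- (k :* s) := s :- m :* k :* s) refl S
                  (fromℕ-ℝ f) (recip f) ⟩
          S - fromℕ-ℝ f * recip f * S             ≈⟨ +-congˡ (-‿cong (trans (*-congʳ (fromℕ*recip f)) (ℝᵣ.*-identityˡ S))) ⟩
          S - S                                   ≈⟨ ℝᵣ.-‿inverseʳ S ⟩
          0#                                      ∎
      }
      where S = ∑ f (λ k → ∑ (suc k) X)

    -- At M = 0 this is the functional Λ; the sign is chosen so that the sum is the value at 0 minus
    -- the value at M. At other M the antiderivatives are evaluated there as well, and for M a
    -- multiple of the period the result is Λ of the shifted function.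
    boundary : ℕ → (ℕ → ℝ) → (ℕ → ℝ) → ℕ → ℝ
    boundary zero    X F M = 0#
    boundary (suc K) X F M = - (antiderivative X M * F M) - boundary K (next X) (Δ F) M

    rest : ℕ → (ℕ → ℝ) → (ℕ → ℝ) → ℕ → ℝ
    rest zero    X F M = ∑ M (λ n → X n * F n)
    rest (suc K) X F M = - rest K (next X) (Δ F) M

    ∑-by-parts : ∀ X F M → ∑ M (λ n → X n * F n) ≈
      antiderivative X M * F M - antiderivative X 0 * F 0 - ∑ M (λ n → next X n * Δ F n)
    ∑-by-parts X F zero    = solve 1 (λ y → :0 := y :- y :- :0) refl _
    ∑-by-parts X F (suc M) = trans (+-congʳ (∑-by-parts X F M))
      (solve 7 (λ s c a x b y S → ((s :- c) :* a :- y :- S) :+ x :* a := (s :+ x :- c) :* b :- y :-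
              (S :+ (s :+ x :- c) :* (b :- a))) refl
        (∑ M X) (recip f * ∑ f (λ k → ∑ (suc k) X)) (F M) (X M) (F (suc M)) (antiderivative X 0 * F 0)
                (∑ M (λ n → next X n * Δ F n)))

    summation-by-parts : ∀ K X F M → ∑ M (λ n → X n * F n) ≈ boundary K X F 0 - boundary K X F M + rest K X F M
    summation-by-parts zero    X F M = solve 1 (λ s → s := :0 :- :0 :+ s) refl _
    summation-by-parts (suc K) X F M = trans (∑-by-parts X F M) (trans (+-congˡ (-‿cong (summation-by-parts K (next X) (Δ F) M)))
      (solve 5 (λ y y₀ b₀ b r → y :- y₀ :- (b₀ :- b :+ r) := (:- y₀ :- b₀) :- (:- y :- b) :+ :- r) refl _ _ _ _ _))

    -- The constant depends on X and K but not on F, which makes the estimate uniform in θ. In the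
    -- application ε carries the power of θ and a is the majorant `v`.
    rest-≼ : ∀ K {X} → Oscillating f X → ∃ λ C → 0# ≤ C × (∀ {F ε a} →
            (∀ n → Δ^ K F n ≼ ε * a n) → ∀ M → rest K X F M ≼ C * (ε * ∑ M a))
    rest-≼ zero osc = let C , 0≤C , bound = periodic-bounded (Oscillating.recurs osc) in
      C , 0≤C , λ {F} {ε} {a} p M → ≼-resp refl (trans (∑-* M C _) (*-congˡ (∑-* M ε a))) (∑-≼ M (λ n _ → ≼-* (bound n) (p n)))
    rest-≼ (suc K) osc = let C , 0≤C , bound = rest-≼ K (next-oscillating osc) in C , 0≤C , λ p M → ≼-neg (bound p M)

    rest-vanishes : ∀ K {X F} → Oscillating f X → (∀ n → Δ^ K F n ≈ 0#) → ∀ M → rest K X F M ≈ 0#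
    rest-vanishes K osc e M = let C , _ , bound = rest-≼ K osc in
      ≼⇒≈0 (≼-resp refl (solve 2 (λ c s → c :* (:0 :* s) := :0) refl _ _)
        (bound {ε = 0#} {a = λ _ → 0#} (λ n → ≼-0 (e n) (≤-reflexive (sym (ℝᵣ.zeroˡ 0#)))) M))

    boundary-≼ : ∀ K {X} → Oscillating f X → ∃ λ C → 0# ≤ C × (∀ {F ε} M →
            (∀ i → i ℕ.≤ K → F (i ℕ.+ M) ≼ ε) → boundary K X F M ≼ C * ε)
    boundary-≼ zero    osc = 0# , ≤-refl , λ M p → ≼-0 refl (≤-reflexive (sym (ℝᵣ.zeroˡ _)))
    boundary-≼ (suc K) osc =
      let D , 0≤D , bounded = periodic-bounded (antiderivative-periodic osc)
          C , 0≤C , bound = boundary-≼ K (next-oscillating osc)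
      in D + (C + C) , +-nonneg 0≤D (+-nonneg 0≤C 0≤C) , λ {F} {ε} M p →
        ≼-resp refl (solve 3 (λ b c e → b :* e :+ c :* (e :+ e) := (b :+ (c :+ c)) :* e) refl D C ε)
          (≼-- (≼-neg (≼-* (bounded M) (p 0 z≤n))) (bound M (λ i i≤K → ≼-- (p (suc i) (s≤s i≤K)) (p i (ℕ.m≤n⇒m≤1+n i≤K)))))

    boundary-cong : ∀ K X {F G : ℕ → ℝ} → (∀ n → F n ≈ G n) → ∀ M → boundary K X F M ≈ boundary K X G M
    boundary-cong zero    X e M = refl
    boundary-cong (suc K) X e M = +-cong (-‿cong (*-congˡ (e M)))
      (-‿cong (boundary-cong K (next X) (λ n → +-cong (e (suc n)) (-‿cong (e n))) M))

    boundary-+ : ∀ K X F G M → boundary K X (λ n → F n + G n) M ≈ boundary K X F M + boundary K X G M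
    boundary-+ zero    X F G M = sym (ℝᵣ.+-identityˡ 0#)
    boundary-+ (suc K) X F G M = trans
      (+-congˡ (-‿cong (trans (boundary-cong K (next X) (λ n → solve 4
              (λ a b c d → (a :+ b) :- (c :+ d) := (a :- c) :+ (b :- d)) refl _ _ _ _) M)
        (boundary-+ K (next X) (Δ F) (Δ G) M))))
      (solve 5 (λ y a b p q → :- (y :* (a :+ b)) :- (p :+ q) := (:- (y :* a) :- p) :+ (:- (y :* b) :- q)) refl _ _ _ _ _)

    boundary-* : ∀ K X x F M → boundary K X (λ n → x * F n) M ≈ x * boundary K X F M
    boundary-* zero    X x F M = sym (ℝᵣ.zeroʳ x)
    boundary-* (suc K) X x F M = trans
      (+-congˡ (-‿cong (trans (boundary-cong K (next X) (λ n → solve 3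
              (λ x a b → x :* a :- x :* b := x :* (a :- b)) refl _ _ _) M)
        (boundary-* K (next X) x (Δ F) M))))
      (solve 4 (λ x y a p → :- (y :* (x :* a)) :- x :* p := x :* (:- (y :* a) :- p)) refl _ _ _ _)

    boundary-0 : ∀ K X M → boundary K X (λ _ → 0#) M ≈ 0#
    boundary-0 K X M = trans (boundary-cong K X (λ _ → sym (ℝᵣ.zeroˡ 0#)) M) (trans (boundary-* K X 0# (λ _ → 0#) M) (ℝᵣ.zeroˡ _))

    boundary-∑ : ∀ K X q (F : ℕ → ℕ → ℝ) M → boundary K X (λ n → ∑ q (λ i → F i n)) M ≈ ∑ q (λ i → boundary K X (F i) M)
    boundary-∑ K X zero    F M = boundary-0 K X M
    boundary-∑ K X (suc q) F M = trans (boundary-+ K X _ (F q) M) (+-congʳ (boundary-∑ K X q F M))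

    boundary-conv : ∀ K X (G : ℕ → ℕ → ℝ) b M k → boundary K X (λ n → conv (λ i → G i n) b k) M ≈ conv
            (λ i → boundary K X (G i) M) b k
    boundary-conv K X G b M zero    = trans (boundary-cong K X (λ n → ℝᵣ.*-comm _ _) M)
            (trans (boundary-* K X (b 0) (G 0) M) (ℝᵣ.*-comm _ _))
    boundary-conv K X G b M (suc k) = trans (boundary-+ K X _ _ M) (+-cong
      (trans (boundary-cong K X (λ n → ℝᵣ.*-comm _ _) M) (trans (boundary-* K X (b (suc k)) (G 0) M) (ℝᵣ.*-comm _ _)))
      (boundary-conv K X (G ∘ suc) b M k))

    -- All the iterated antiderivatives have period f, so a move by one period affects F alone.
    boundary-shift : ∀ K {X} → Oscillating f X → ∀ F M → boundary K X F (M ℕ.+ f) ≈ boundary K X (λ n → F (n ℕ.+ f)) M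
    boundary-shift zero    osc F M = refl
    boundary-shift (suc K) osc F M = +-cong (-‿cong (*-congʳ (antiderivative-periodic osc M)))
      (-‿cong (boundary-shift K (next-oscillating osc) (Δ F) M))

  -- Convergence by domination

  recip-antitone : ∀ {m n} → m ℕ.≤ n → recip (suc n) ≤ recip (suc m)
  recip-antitone {m} {n} m≤n = begin
    recip (suc n)                                          ≈⟨ trans (*-congˡ (fromℕ*recip (suc m))) (ℝᵣ.*-identityʳ _) ⟨
    recip (suc n) * (fromℕ-ℝ (suc m) * recip (suc m))      ≤⟨ *-monoʳ-≤ (0≤recip (suc n))
            (*-monoˡ-≤ (0≤recip (suc m)) (fromℕ-mono (s≤s m≤n))) ⟩
    recip (suc n) * (fromℕ-ℝ (suc n) * recip (suc m))      ≈⟨ solve 3 (λ a b c → a :* (b :* c) := b :* a :* c) refl _ _ _ ⟩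
    fromℕ-ℝ (suc n) * recip (suc n) * recip (suc m)        ≈⟨ trans (*-congʳ (fromℕ*recip (suc n))) (ℝᵣ.*-identityˡ _) ⟩
    recip (suc m)                                          ∎

  v≤recip : ∀ n → v n ≤ recip (suc n)
  v≤recip n = ≤-resp refl (ℝᵣ.*-identityʳ _) (*-monoʳ-≤ (0≤recip (suc n)) (recip≤1 (suc (suc n))))

  ∑-v≤1 : ∀ M → ∑ M v ≤ 1#
  ∑-v≤1 M = ≤-trans (≤-resp (trans (ℝᵣ.+-congˡ -0#≈0#) (trans (ℝᵣ.+-identityʳ _)
          (ℝᵣ.reflexive (≡.cong (λ m → ∑ m v) (ℕ.+-identityʳ M))))) refl
    (upper (∑-v-≼ M 0))) (recip≤1 1)

  dominated-convergent : ∀ {C} a → 0# ≤ C → (∀ n → a n ≼ C * v n) → ∃ λ l → ConvergesTo (λ n → ∑ n a) l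
  dominated-convergent {C} a 0≤C dom = complete (λ n → ∑ n a) λ ε 0<ε → cauchy ε (archimedean-small (C + C) 0<ε)
    where
    tail : ∀ N n → N ℕ.≤ n → ∑ n a - ∑ N a ≼ C * recip (suc N)
    tail N n N≤n = ≡.subst (λ m → ∑ m a - ∑ N a ≼ C * recip (suc N)) (ℕ.m∸n+n≡m N≤n) (≼-mono (*-monoʳ-≤ 0≤C (upper (∑-v-≼ k N)))
        (≼-resp (trans (solve 2 (λ s t → s := (t :+ s) :- t) refl _ (∑ N a)) (+-congʳ (sym (∑-append k N a))))
          (trans (∑-* k C (λ i → v (i ℕ.+ N))) (*-congˡ (trans (solve 2 (λ s t → s := (t :+ s) :- t) refl _ (∑ N v))
                  (+-congʳ (sym (∑-append k N v))))))
          (∑-≼ k (λ i _ → dom (i ℕ.+ N)))))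
      where k = n ℕ.∸ N
    cauchy : ∀ ε → (∃ λ N → (C + C) * recip (suc N) < ε) → ∃ λ N → ∀ m n → N ℕ.≤ m → N ℕ.≤ n → ∑ m a < ∑ n a + ε
    cauchy ε (N , small) = N , λ m n N≤m N≤n → begin-strict
      ∑ m a                                 ≈⟨ solve 2 (λ s t → s := t :+ (s :- t)) refl _ (∑ n a) ⟩
      ∑ n a + (∑ m a - ∑ n a)               ≤⟨ +-monoʳ-≤ _ (upper (≼-distance-trans (tail N m N≤m) (≼-swap (tail N n N≤n)))) ⟩
      ∑ n a + (C * recip (suc N) + C * recip (suc N))
        ≈⟨ solve 3 (λ s c k → s :+ (c :* k :+ c :* k) := (c :+ c) :* k :+ s) refl _ C _ ⟩
      (C + C) * recip (suc N) + ∑ n a       <⟨ +-monoˡ-< (∑ n a) small ⟩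
      ε + ∑ n a                             ≈⟨ ℝᵣ.+-comm ε _ ⟩
      ∑ n a + ε                             ∎

  -- The asymptotic expansion for one real periodic sequence

  module Expansion {f : ℕ} .{{f≢0 : NonZero f}} {X : ℕ → ℝ} (osc : Oscillating f X) {x : ℝ} (0≤x : 0# ≤ x) (r′ : ℕ) where

    open Growth 0≤x
    open Damping 0≤x r′

    F-antitone : ∀ {θ θ′} → 0# ≤ θ → θ ≤ θ′ → ∀ n → F θ′ n ≤ F θ n
    F-antitone {θ} {θ′} 0≤θ θ≤θ′ n = begin
      F θ′ n                                  ≈⟨ trans (e^-cong (solve 3
              (λ y a b → :- (y :* b) := :- (y :* a) :+ :- (y :* (b :- a))) refl (t n ^ r) θ θ′)) (e^-+ _ _) ⟩
      F θ n * e^ (- (t n ^ r * (θ′ - θ)))     ≤⟨ *-monoʳ-≤ (0≤F 0≤θ n) (e^-≤1 (*-nonneg (0≤t^r n) (sub-nonneg θ≤θ′))) ⟩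
      F θ n * 1#                              ≈⟨ ℝᵣ.*-identityʳ _ ⟩
      F θ n                                   ∎

    -- The choice q = 0, j = 2 in `absorb` fits every r and bounds θ² F. Division by θ² makes the
    -- constant depend on θ, which is harmless: it serves only convergence and the limit of the
    -- boundary term as M grows.
    decay-small : ∀ {θ} → 0# < θ → θ ≤ 1# → ∃ λ C → 0# ≤ C × (∀ n → F θ n ≤ C * v n)
    decay-small {θ} 0<θ θ≤1 =
      let C , 0≤C , bound = absorb 0 2 (r′ ℕ.* 2) ≡.refl
          u , θu≈1 = invPos 0<θ
          0≤u = <⇒≤ (invPos-pos 0<θ θu≈1)
      in C * (u * u) , *-nonneg 0≤C (*-nonneg 0≤u 0≤u) , λ n → begin
        F θ n
          ≈⟨ trans (*-congˡ (trans (*-cong θu≈1 θu≈1) (ℝᵣ.*-identityˡ 1#))) (ℝᵣ.*-identityʳ _) ⟨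
        F θ n * (θ * u * (θ * u))
          ≈⟨ solve 3 (λ f θ u → f :* (θ :* u :* (θ :* u)) := f :* (θ :* (θ :* :1) :* :1) :* (u :* u)) refl (F θ n) θ u ⟩
        F θ n * (θ ^ 2 * 1#) * (u * u)
          ≤⟨ *-monoˡ-≤ (*-nonneg 0≤u 0≤u) (≤-trans (*-monoʳ-≤ (0≤F (<⇒≤ 0<θ) n)
                  (*-monoʳ-≤ (^-nonneg (<⇒≤ 0<θ) 2) (1≤^ (1≤W n) (r′ ℕ.* 2)))) (bound (<⇒≤ 0<θ) θ≤1 n)) ⟩
        C * 1# * v n * (u * u)
          ≈⟨ solve 3 (λ c v u → c :* :1 :* v :* u := c :* u :* v) refl _ _ _ ⟩
        C * (u * u) * v n ∎

    -- An arbitrary θ is compared with θ/(m+1) ≤ 1, at which F is at least as large.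
    decay : ∀ {θ} → 0# < θ → ∃ λ C → 0# ≤ C × (∀ n → F θ n ≤ C * v n)
    decay {θ} 0<θ =
      let m , θ<m = archimedean θ
          k = recip (suc m)
          C , 0≤C , bound = decay-small (*-pos 0<θ (0<recip (suc m)))
            (≤-resp refl (fromℕ*recip (suc m)) (*-monoˡ-≤ (0≤recip (suc m)) (≤-trans (<⇒≤ θ<m) (x≤y+x 0≤1))))
      in C , 0≤C , λ n → ≤-trans
        (F-antitone (*-nonneg (<⇒≤ 0<θ) (0≤recip (suc m))) (≤-resp refl (ℝᵣ.*-identityʳ θ)
                (*-monoʳ-≤ (<⇒≤ 0<θ) (recip≤1 (suc m)))) n)
        (bound n)

    term : ℝ → ℕ → ℝ
    term θ n = X n * F θ n

    term-summable : ∀ {θ} → 0# < θ → ∃ λ l → ConvergesTo (λ n → ∑ n (term θ)) l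
    term-summable {θ} 0<θ =
      let C , 0≤C , bound = decay 0<θ
          D , 0≤D , bounded = periodic-bounded (Oscillating.recurs osc)
      in dominated-convergent (term θ) (*-nonneg 0≤D 0≤C) (λ n →
        ≼-resp refl (sym (ℝᵣ.*-assoc _ _ _)) (≼-* (bounded n) (≼-between (0≤F (<⇒≤ 0<θ) n) (bound n))))

    -- The decay constant A depends on θ, but it multiplies only the boundary term at M, which
    -- disappears in the limit. The bound on `rest` has a constant free of θ.
    sum-near-boundary : ∀ q → ∃ λ C → 0# ≤ C × (∀ {θ} → 0# < θ → θ ≤ 1# → ∀ {l} → ConvergesTo (λ n → ∑ n (term θ)) l →
      l - boundary (order q) X (F θ) 0 ≼ C * θ ^ q)
    sum-near-boundary q =
      let C , 0≤C , difference = difference-bound q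
          D , 0≤D , rest-bound = rest-≼ K osc
          E , 0≤E , boundary-bound = boundary-≼ K osc
      in D * C , *-nonneg 0≤D 0≤C , λ {θ} 0<θ θ≤1 s→l →
        let 0≤θ = <⇒≤ 0<θ
            A , 0≤A , decays = decay 0<θ
            remainder-≼ : ∀ M → rest K X (F θ) M ≼ D * C * θ ^ q
            remainder-≼ M = ≼-mono
              (≤-resp (solve 4 (λ d c p s → d :* c :* p :* s := d :* (c :* p :* s)) refl _ _ _ _) (ℝᵣ.*-identityʳ _)
                (*-monoʳ-≤ (*-nonneg (*-nonneg 0≤D 0≤C) (^-nonneg 0≤θ q)) (∑-v≤1 M)))
              (rest-bound (difference 0≤θ θ≤1) M)
            far : ∀ N M → N ℕ.≤ M → boundary K X (F θ) M ≼ E * A * recip (suc N)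
            far N M N≤M = ≼-resp refl (sym (ℝᵣ.*-assoc _ _ _)) (boundary-bound M (λ i _ → ≼-between (0≤F 0≤θ (i ℕ.+ M))
              (≤-trans (decays (i ℕ.+ M)) (*-monoʳ-≤ 0≤A (≤-trans (v≤recip (i ℕ.+ M))
                      (recip-antitone (ℕ.≤-trans N≤M (ℕ.m≤n+m M i))))))))
        in archimedean-≼ {C = E * A} (λ N → limit-≼ s→l N (λ M N≤M →
          ≼-respˡ (trans (solve 3 (λ b₀ b t → t :+ :- b := (b₀ :- b :+ t) :- b₀) refl (boundary K X (F θ) 0)
                  (boundary K X (F θ) M) (rest K X (F θ) M))
              (+-congʳ (sym (summation-by-parts K X (F θ) M))))
            (≼-+ (remainder-≼ M) (≼-neg (far N M N≤M)))))
      where K = order q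

    -- Λ on divided powers tⁱ/i! rather than powers: a move by one period then becomes the Cauchy
    -- product with the series of e^(ft).
    L : ℕ → ℕ → ℝ
    L q i = boundary (order q) X (λ n → expSeries (t n) i) 0

    coefficient : ℕ → ℕ → ℝ → ℝ
    coefficient q i θ = (- θ) ^ i * recip (i !) {{i ℕ.!≢0}} * fromℕ-ℝ ((r ℕ.* i) !) * L q (r ℕ.* i)

    expSeries-power : ∀ y θ i → expSeries (- (y ^ r * θ)) i ≈
      (- θ) ^ i * recip (i !) {{i ℕ.!≢0}} * fromℕ-ℝ ((r ℕ.* i) !) * expSeries y (r ℕ.* i)
    expSeries-power y θ i = begin-equality
      (- (y ^ r * θ)) ^ i * k
        ≈⟨ *-congʳ (trans (^-congˡ i (solve 2 (λ y θ → :- (y :* θ) := :- θ :* y) refl (y ^ r) θ))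
                (trans (^-distrib-* (- θ) (y ^ r) i) (*-congˡ (^-assocʳ y r i)))) ⟩
      (- θ) ^ i * y ^ (r ℕ.* i) * k
        ≈⟨ solve 3 (λ a b c → a :* b :* c := a :* c :* b :* :1) refl _ _ _ ⟩
      (- θ) ^ i * k * y ^ (r ℕ.* i) * 1#
        ≈⟨ *-congˡ (fromℕ*recip ((r ℕ.* i) !) {{(r ℕ.* i) ℕ.!≢0}}) ⟨
      (- θ) ^ i * k * y ^ (r ℕ.* i) * (fromℕ-ℝ ((r ℕ.* i) !) * recip ((r ℕ.* i) !) {{(r ℕ.* i) ℕ.!≢0}})
        ≈⟨ solve 4 (λ a p m s → a :* p :* (m :* s) := a :* m :* (p :* s)) refl _ _ _ _ ⟩
      (- θ) ^ i * k * fromℕ-ℝ ((r ℕ.* i) !) * expSeries y (r ℕ.* i) ∎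
      where k = recip (i !) {{i ℕ.!≢0}}

    boundary-expansion : ∀ q → ∃ λ C → 0# ≤ C × (∀ {θ} → 0# ≤ θ →
      boundary (order q) X (F θ) 0 - ∑ q (λ i → coefficient q i θ) ≼ C * θ ^ q)
    boundary-expansion q =
      let C , 0≤C , taylor = e^-taylor q
          D , 0≤D , bound = boundary-≼ K osc
          -- The functional reads only the points 0, ..., K, and t K is the largest argument among
          -- them.
          T = t K ^ r
      in D * (C * T ^ q) , *-nonneg 0≤D (*-nonneg 0≤C (^-nonneg (0≤t^r K) q)) , λ {θ} 0≤θ →
        ≼-resp
          (trans (boundary-+ K X (F θ) (λ n → - ∑ q (λ i → expSeries (- (t n ^ r * θ)) i)) 0) (+-congˡ (begin-equality
            boundary K X (λ n → - ∑ q (λ i → expSeries (- (t n ^ r * θ)) i)) 0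
              ≈⟨ boundary-cong K X (λ n → trans (solve 1 (λ s → :- s := :- :1 :* s) refl _)
                      (*-congˡ (∑-cong q (expSeries-power (t n) θ)))) 0 ⟩
            boundary K X (λ n → - 1# * ∑ q (λ i → scalar θ i * expSeries (t n) (r ℕ.* i))) 0
              ≈⟨ boundary-* K X (- 1#) _ 0 ⟩
            - 1# * boundary K X (λ n → ∑ q (λ i → scalar θ i * expSeries (t n) (r ℕ.* i))) 0
              ≈⟨ *-congˡ (trans (boundary-∑ K X q (λ i n → scalar θ i * expSeries (t n) (r ℕ.* i)) 0)
                      (∑-cong q (λ i → boundary-* K X (scalar θ i) _ 0))) ⟩
            - 1# * ∑ q (λ i → coefficient q i θ)
              ≈⟨ solve 1 (λ s → :- :1 :* s := :- s) refl _ ⟩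
            - ∑ q (λ i → coefficient q i θ) ∎)))
          (trans (*-congˡ (*-congˡ (^-distrib-* T θ q))) (solve 4 (λ d c a b → d :* (c :* (a :* b)) := d :*
                  (c :* a) :* b) refl D C (T ^ q) (θ ^ q)))
          (bound 0 (λ i i≤K → ≼-mono (*-monoʳ-≤ 0≤C (^-mono-≤ (*-nonneg (0≤t^r (i ℕ.+ 0)) 0≤θ)
              (*-monoˡ-≤ 0≤θ (^-mono-≤ (0≤t (i ℕ.+ 0)) (+-monoˡ-≤ x (fromℕ-mono
                      (ℕ.≤-trans (ℕ.≤-reflexive (ℕ.+-identityʳ i)) i≤K))) r)) q))
            (taylor (*-nonneg (0≤t^r (i ℕ.+ 0)) 0≤θ))))
      where
      K = order q
      scalar : ℝ → ℕ → ℝ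
      scalar θ i = (- θ) ^ i * recip (i !) {{i ℕ.!≢0}} * fromℕ-ℝ ((r ℕ.* i) !)

    expansion : ∀ q → ∃ λ C → 0# ≤ C × (∀ {θ} → 0# < θ → θ ≤ 1# → ∀ {l} → ConvergesTo (λ n → ∑ n (term θ)) l →
      l - ∑ q (λ i → coefficient q i θ) ≼ C * θ ^ q)
    expansion q =
      let C , 0≤C , p = sum-near-boundary q
          D , 0≤D , s = boundary-expansion q
      in C + D , +-nonneg 0≤C 0≤D , λ 0<θ θ≤1 s→l → ≼-resp refl (sym (ℝᵣ.distribʳ _ C D))
              (≼-distance-trans (p 0<θ θ≤1 s→l) (s (<⇒≤ 0<θ)))

    -- The recursion which determines -L q k as the coefficient k + 1 of the generating function.
    L-recursion : ∀ q k → suc (suc k) ℕ.≤ order q →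
      ∑ f (λ m → X m * expSeries (t m) (suc k)) ≈ - conv (L q) (λ j → expSeries (fromℕ-ℝ f) (suc j)) k
    L-recursion q k 2+k≤K = begin-equality
      ∑ f (λ m → X m * G (suc k) m)
        ≈⟨ summation-by-parts K X (G (suc k)) f ⟩
      L q (suc k) - boundary K X (G (suc k)) f + rest K X (G (suc k)) f
        -- A polynomial of degree k + 1 < K has Kth difference zero, so here summation by parts
        -- leaves no remainder.
        ≈⟨ trans (+-congˡ (rest-vanishes K osc (Δ^-vanishes {p = λ _ → G (suc k)} degree-G 2+k≤K 0) f)) (ℝᵣ.+-identityʳ _) ⟩
      L q (suc k) - boundary K X (G (suc k)) f
        ≈⟨ +-congˡ (-‿cong (begin-equality
             boundary K X (G (suc k)) (0 ℕ.+ f)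
               ≈⟨ boundary-shift K osc (G (suc k)) 0 ⟩
             boundary K X (λ n → G (suc k) (n ℕ.+ f)) 0
               ≈⟨ boundary-cong K X (λ n → trans (*-congʳ (^-congˡ (suc k)
                       (trans (+-congʳ (×-homo-+ 1# n f)) (solve 3 (λ a b c → a :+ b :+ c := a :+ c :+ b) refl _ _ _))))
                    (expSeries-+ (t n) φ (suc k))) 0 ⟩
             boundary K X (λ n → conv (λ i → G i n) (expSeries φ) (suc k)) 0
               ≈⟨ boundary-conv K X G (expSeries φ) 0 (suc k) ⟩
             conv (L q) (expSeries φ) (suc k)
               ≈⟨ conv-snoc (L q) (expSeries φ) k ⟩
             conv (L q) (expSeries φ ∘ suc) k + L q (suc k) * expSeries φ 0
               ≈⟨ +-congˡ (trans (*-congˡ (expSeries-0 φ)) (ℝᵣ.*-identityʳ _)) ⟩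
             conv (L q) (expSeries φ ∘ suc) k + L q (suc k) ∎)) ⟩
      L q (suc k) - (conv (L q) (expSeries φ ∘ suc) k + L q (suc k))
        ≈⟨ solve 2 (λ l c → l :- (c :+ l) := :- c) refl _ _ ⟩
      - conv (L q) (expSeries φ ∘ suc) k ∎
      where
      K = order q
      φ = fromℕ-ℝ f
      G : ℕ → ℕ → ℝ
      G i n = expSeries (t n) i
      degree-G : Degree (2 ℕ.+ k) (λ _ → G (suc k))
      degree-G = ≡.subst (λ d → Degree (suc d) (λ _ → G (suc k))) (≡.trans (ℕ.+-identityʳ _) (ℕ.*-identityʳ (suc k)))
        (degree-* (suc k ℕ.* 1) 0 (degree-^ degree-t (suc k)) (degree-const (recip (suc k !) {{suc k ℕ.!≢0}})))
        where
        degree-const : ∀ y → Degree 1 (λ _ _ → y)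
        degree-const y = let D , p = ≼-bound y in
          growing D (≼-nonneg p) (λ n m → ≼-resp refl (sym (ℝᵣ.*-identityʳ _)) p) (vanishing (λ _ _ → ℝᵣ.-‿inverseʳ y))

  -- Vanishing of the character sum over a period

  open ℤ-Solver using () renaming (solve to solveℤ; _:+_ to _⊞_; _:*_ to _⊠_; _:-_ to _⊟_; _:=_ to _≣_)

  injective⇒surjective : ∀ {n} {σ : Fin n → Fin n} → Injective _≡_ _≡_ σ → ∀ y → ∃ λ x → σ x ≡ y
  injective⇒surjective {suc n} {σ} inj y with Fin.any? (λ x → σ x Fin.≟ y)
  ... | yes hit = hit
  ... | no miss = contradiction
    (λ {x} {z} e → inj (Fin.punchOut-injective (avoid x) (avoid z) e))
    (Fin.<⇒notInjective {f = λ x → punchOut (avoid x)} (ℕ.n<1+n n))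
    where
    avoid : ∀ x → ¬ (y ≡ σ x)
    avoid x e = miss (x , ≡.sym e)

  injective⇒permutation : ∀ {n} {σ : Fin n → Fin n} → Injective _≡_ _≡_ σ → ∃ λ (π : Permutation′ n) → ∀ i → π ⟨$⟩ʳ i ≡ σ i
  injective⇒permutation {σ = σ} inj = permutation σ (proj₁ ∘ surj) (proj₂ ∘ surj) (λ x → inj (proj₂ (surj (σ x)))) , λ _ → ≡.refl
    where surj = injective⇒surjective inj

  -- Multiplication by a unit permutes the residues

  module _ {f : ℕ} .{{f≢0 : NonZero f}} (m : ℤ) (m⊥f : ℤ.Coprime m (+ f)) where

    scale : Fin f → Fin f
    scale i = fromℕ< (n%ℕd<d (m ℤ.* + toℕ i) f)

    -- f divides m(a - b), hence a - b by coprimality, and a - b < f. With b ≤ a truncated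
    -- subtraction is the true one.
    residue-cancel : ∀ {a b} → a ℕ.< f → b ℕ.≤ a → (m ℤ.* + a) ℤ.%ℕ f ≡ (m ℤ.* + b) ℤ.%ℕ f → a ≡ b
    residue-cancel {a} {b} a<f b≤a e = ℕ.≤-antisym (ℕ.m∸n≡0⇒m≤n (zero-below (a ℕ.∸ b) f∣a∸b (ℕ.≤-<-trans (ℕ.m∸n≤m a b) a<f))) b≤a
      where
      zero-below : ∀ k → f ℕ.∣ k → k ℕ.< f → k ≡ 0
      zero-below zero    _   _   = ≡.refl
      zero-below (suc k) f∣k k<f = contradiction f∣k (ℕ.>⇒∤ k<f)
      qa qb ρ : ℤ
      qa = (m ℤ.* + a) ℤ./ℕ f
      qb = (m ℤ.* + b) ℤ./ℕ f
      ρ = + ((m ℤ.* + b) ℤ.%ℕ f)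
      ma≡ : m ℤ.* + a ≡ ρ ℤ.+ qa ℤ.* + f
      ma≡ = ≡.trans (a≡a%ℕn+[a/ℕn]*n (m ℤ.* + a) f) (≡.cong (λ k → + k ℤ.+ qa ℤ.* + f) e)
      quotient : m ℤ.* + (a ℕ.∸ b) ≡ (qa ℤ.- qb) ℤ.* + f
      quotient = ≡.trans (≡.cong (m ℤ.*_) (≡.sym (≡.trans (ℤ.m-n≡m⊖n a b) (ℤ.⊖-≥ b≤a))))
        (≡.trans (solveℤ 3 (λ m a b → m ⊠ (a ⊟ b) ≣ m ⊠ a ⊟ m ⊠ b) ≡.refl m (+ a) (+ b))
          (≡.trans (≡.cong₂ ℤ._-_ ma≡ (a≡a%ℕn+[a/ℕn]*n (m ℤ.* + b) f))
            (solveℤ 4 (λ ρ x y f → (ρ ⊞ x ⊠ f) ⊟ (ρ ⊞ y ⊠ f) ≣ (x ⊟ y) ⊠ f) ≡.refl ρ qa qb (+ f))))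
      f∣a∸b : f ℕ.∣ a ℕ.∸ b
      f∣a∸b = ℤ.coprime-divisor (+ f) m (+ (a ℕ.∸ b)) (ℤ.sym {m} {+ f} m⊥f)
        (ℕ.divides ℤ.∣ qa ℤ.- qb ∣ (≡.trans (≡.cong ℤ.∣_∣ quotient) (ℤ.abs-* (qa ℤ.- qb) (+ f))))

    scale-injective : Injective _≡_ _≡_ scale
    scale-injective {i} {j} e = Fin.toℕ-injective (go (ℕ.≤-total (toℕ j) (toℕ i)))
      where
      e′ : (m ℤ.* + toℕ i) ℤ.%ℕ f ≡ (m ℤ.* + toℕ j) ℤ.%ℕ f
      e′ = ≡.trans (≡.sym (Fin.toℕ-fromℕ< _)) (≡.trans (≡.cong toℕ e) (Fin.toℕ-fromℕ< _))
      go : toℕ j ℕ.≤ toℕ i ⊎ toℕ i ℕ.≤ toℕ j → toℕ i ≡ toℕ j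
      go (inj₁ j≤i) = residue-cancel (Fin.toℕ<n i) j≤i e′
      go (inj₂ i≤j) = ≡.sym (residue-cancel (Fin.toℕ<n j) i≤j (≡.sym e′))

  private
    module Sumᶜ = Algebra.Properties.CommutativeMonoid.Sum ℂᵣ.+-commutativeMonoid
    module Sumᶜ* = Algebra.Properties.Semiring.Sum ℂᵣ.semiring

  module _ {f : ℕ} .{{f≢0 : NonZero f}} (χ : DirichletCharacter f) where

    character-sum : ℂ
    character-sum = ∑ℂ {f} (λ i → ⟦ χ ⟧ (+ toℕ i))

    character-cong : ∀ {m n} → m ≡ n → ⟦ χ ⟧ m ≈ᶜ ⟦ χ ⟧ n
    character-cong ≡.refl = ℂᵣ.refl

    character-+* : ∀ m (k : ℕ) → ⟦ χ ⟧ (m ℤ.+ + k ℤ.* + f) ≈ᶜ ⟦ χ ⟧ m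
    character-+* m zero    = character-cong (ℤ.+-identityʳ m)
    character-+* m (suc k) = ℂᵣ.trans (character-cong {m ℤ.+ + suc k ℤ.* + f} {(m ℤ.+ + k ℤ.* + f) ℤ.+ + f}
        (≡.trans (≡.cong (λ j → m ℤ.+ j) (ℤ.suc-* (+ k) (+ f))) (solveℤ 3 (λ m k f → m ⊞ (f ⊞ k) ≣ (m ⊞ k) ⊞ f) ≡.refl m
                (+ k ℤ.* + f) (+ f))))
      (ℂᵣ.trans (DirichletCharacter.periodic χ (m ℤ.+ + k ℤ.* + f)) (character-+* m k))

    character-periodic : ∀ m (k : ℤ) → ⟦ χ ⟧ (m ℤ.+ k ℤ.* + f) ≈ᶜ ⟦ χ ⟧ m
    character-periodic m (+ k)    = character-+* m k
    character-periodic m -[1+ k ] = ℂᵣ.sym (ℂᵣ.trans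
      (character-cong (solveℤ 3 (λ m k f → m ≣ (m ⊟ k ⊠ f) ⊞ k ⊠ f) ≡.refl m (+ suc k) (+ f)))
      (ℂᵣ.trans (character-+* (m ℤ.- + suc k ℤ.* + f) (suc k)) (character-cong
              (≡.cong (λ j → m ℤ.+ j) (ℤ.neg-distribˡ-* (+ suc k) (+ f))))))

    character-% : ∀ m → ⟦ χ ⟧ m ≈ᶜ ⟦ χ ⟧ (+ (m ℤ.%ℕ f))
    character-% m = ℂᵣ.trans (character-cong (a≡a%ℕn+[a/ℕn]*n m f)) (character-periodic (+ (m ℤ.%ℕ f)) (m ℤ./ℕ f))

    character-sum-invariant : ∀ m → ℤ.Coprime m (+ f) → ⟦ χ ⟧ m *ᶜ character-sum ≈ᶜ character-sum
    character-sum-invariant m m⊥f = go (injective⇒permutation {σ = scale m m⊥f} (scale-injective m m⊥f))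
      where
      go : (∃ λ (π : Permutation′ f) → ∀ i → π ⟨$⟩ʳ i ≡ scale m m⊥f i) → ⟦ χ ⟧ m *ᶜ character-sum ≈ᶜ character-sum
      go (π , π≡) =
        ℂᵣ.trans (Sumᶜ*.*-distribˡ-sum {f} (⟦ χ ⟧ m) (λ i → ⟦ χ ⟧ (+ toℕ i)))
          (ℂᵣ.trans (Sumᶜ.sum-cong-≋ {f} (λ i → ℂᵣ.trans (ℂᵣ.sym (homo-* χ m (+ toℕ i))) (ℂᵣ.trans (character-% (m ℤ.* + toℕ i))
              (character-cong (≡.cong +_ (≡.trans (≡.sym (Fin.toℕ-fromℕ< (n%ℕd<d (m ℤ.* + toℕ i) f)))
                      (≡.cong toℕ (≡.sym (π≡ i)))))))))
            (ℂᵣ.sym (Sumᶜ.sum-permute {f} {f} (λ i → ⟦ χ ⟧ (+ toℕ i)) π)))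

  -- From (w - 1)z = 0, multiplication by the conjugate of z gives |z|²(w - 1) = 0; the two
  -- computations are its real and imaginary parts.
  nonzero-multiplier : ∀ {w z : ℂ} → w *ᶜ z ≈ᶜ z → 0# < re z * re z + im z * im z → w ≈ᶜ 1ᶜ
  nonzero-multiplier {a +i b} {p +i q} e 0<N =
    x-y≈0⇒x≈y (*-cancelˡ-pos 0<N (begin-equality
      (p * p + q * q) * (a - 1#)
        ≈⟨ solve 4 (λ a b p q → (p :* p :+ q :* q) :* (a :- :1) := p :* ((a :* p :- b :* q) :- p) :+ q :*
                ((a :* q :+ b :* p) :- q)) refl a b p q ⟩
      p * ((a * p - b * q) - p) + q * ((a * q + b * p) - q)
        ≈⟨ +-cong (*-congˡ (difference≈0 (re≈ e))) (*-congˡ (difference≈0 (im≈ e))) ⟩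
      p * 0# + q * 0#
        ≈⟨ solve 3 (λ p q n → p :* :0 :+ q :* :0 := n :* :0) refl p q _ ⟩
      (p * p + q * q) * 0# ∎)) ,
    *-cancelˡ-pos 0<N (begin-equality
      (p * p + q * q) * b
        ≈⟨ solve 4 (λ a b p q → (p :* p :+ q :* q) :* b := p :* ((a :* q :+ b :* p) :- q) :- q :*
                ((a :* p :- b :* q) :- p)) refl a b p q ⟩
      p * ((a * q + b * p) - q) - q * ((a * p - b * q) - p)
        ≈⟨ +-cong (*-congˡ (difference≈0 (im≈ e))) (-‿cong (*-congˡ (difference≈0 (re≈ e)))) ⟩
      p * 0# - q * 0#
        ≈⟨ solve 3 (λ p q n → p :* :0 :- q :* :0 := n :* :0) refl p q _ ⟩
      (p * p + q * q) * 0# ∎)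
    where
    difference≈0 : ∀ {x y} → x ≈ y → x - y ≈ 0#
    difference≈0 x≈y = trans (+-congʳ x≈y) (ℝᵣ.-‿inverseʳ _)

  #0⇒square-pos : ∀ {x} → x < 0# ⊎ 0# < x → 0# < x * x
  #0⇒square-pos (inj₁ x<0) = <-respʳ (solve 1 (λ x → :- x :* :- x := x :* x) refl _) (*-pos (x<0⇒0<-x x<0) (x<0⇒0<-x x<0))
  #0⇒square-pos (inj₂ 0<x) = *-pos 0<x 0<x

  square-nonneg : ∀ x → 0# ≤ x * x
  square-nonneg x = ≤-cases (0# ≤ x) (λ 0≤x → *-nonneg 0≤x 0≤x) (λ x≱0 →
    let 0≤-x = λ -x<0 → x≱0 (λ x<0 → <.irrefl refl (<.trans -x<0 (x<0⇒0<-x x<0)))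
    in ≤-resp refl (solve 1 (λ x → :- x :* :- x := x :* x) refl x) (*-nonneg 0≤-x 0≤-x))

  trivial-character : DirichletCharacter 1
  trivial-character = record
    { χ           = λ _ → 1ᶜ
    ; periodic    = λ _ → ℂᵣ.refl
    ; χ1≈1        = ℂᵣ.refl
    ; homo-*      = λ _ _ → ℂᵣ.sym (ℂᵣ.*-identityˡ 1ᶜ)
    ; zero-noncop = λ m m⊥̸1 → contradiction (λ {d} → ℕ.sym (ℕ.1-coprimeTo ℤ.∣ m ∣) {d}) m⊥̸1
    }

  -- If the sum were apart from 0, its invariance would force χ(m) = 1 for every m coprime to f.
  -- Then χ is induced by the character modulo 1, so f = 1 by primitivity, every m is coprime to f,
  -- and χ is principal. Tightness of the apartness turns this refutation into an equation.
  character-sum-zero : ∀ {f} .{{_ : NonZero f}} (χ : DirichletCharacter f) → Primitive χ → Nonprincipal χ → character-sum χ ≈ᶜ 0ᶜ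
  character-sum-zero {f} χ prim nonprincipal =
    proj₁ (tight _ _) (λ p → not-pos (<-≤-trans (#0⇒square-pos p) (x≤x+y (square-nonneg (im S))))) ,
    proj₁ (tight _ _) (λ p → not-pos (<-≤-trans (#0⇒square-pos p) (x≤y+x (square-nonneg (re S)))))
    where
    S = character-sum χ
    not-pos : ¬ (0# < re S * re S + im S * im S)
    not-pos 0<N = nonprincipal λ m → trivial m (≡.subst (λ g → ℕ.Coprime ℤ.∣ m ∣ g) 1≡f (ℕ.sym (ℕ.1-coprimeTo ℤ.∣ m ∣)))
      where
      trivial : ∀ m → ℤ.Coprime m (+ f) → ⟦ χ ⟧ m ≈ᶜ 1ᶜ
      trivial m m⊥f = nonzero-multiplier (character-sum-invariant χ m m⊥f) 0<N
      1≡f : 1 ≡ f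
      1≡f = prim 1 (ℕ.1∣ f) trivial-character trivial

  -- Real and imaginary parts, and the Bernoulli coefficients

  -- The two sides contain the same application of exp up to syntax, so that Agda does not unfold it.
  G₂-term≡ : ∀ {f} (χ : DirichletCharacter f) b (r : ℕ) .{{_ : NonZero r}} θ n →
    G₂-term χ b r θ n ≡ e^ (- ((fromℕ-ℝ n + b /ℕ r) ^ r * θ)) · ⟦ χ ⟧ (+ n)
  G₂-term≡ χ b r θ n = ≡.sym (≡.cong (λ y → y · ⟦ χ ⟧ (+ n)) (e^≡exp (- ((fromℕ-ℝ n + b /ℕ r) ^ r * θ))))

  -- What `re` and `im` share, so that the real expansion is transferred once for both. `conj-conj`
  -- enters because `B` conjugates the values of its character and is taken at the conjugate
  -- character.
  record IsComponent (π : ℂ → ℝ) : Set (c ⊔ ℓ₁) where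
    field
      cong      : ∀ {z w} → z ≈ᶜ w → π z ≈ π w
      zero-homo : π 0ᶜ ≈ 0#
      +-homo    : ∀ z w → π (z +ᶜ w) ≈ π z + π w
      neg-homo  : ∀ z → π (-ᶜ z) ≈ - π z
      ·-homo    : ∀ y z → π (y · z) ≈ y * π z
      conj-conj : ∀ z → π (conj (conj z)) ≈ π z

    ∑-homo : ∀ n a → π (∑ℂ {n} (a ∘ toℕ)) ≈ ∑ n (π ∘ a)
    ∑-homo zero    a = zero-homo
    ∑-homo (suc n) a = trans (+-homo _ _) (trans (+-congˡ (∑-homo n (a ∘ suc))) (sym (∑-cons n (π ∘ a))))

    -- Each step of the long division removes b₀ d and shifts, leaving the product of the shifted b
    -- with d. Agreement is asked only up to n, since the recursion for `L` is available only below
    -- the order of differencing.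
    divideSeries-unique : ∀ {d u} → d 0 * u ≈ 1# → ∀ n {a b} → (∀ k → k ℕ.≤ n → π (a k) ≈ conv b d k) → π
            (divideSeries d u a n) ≈ b n
    divideSeries-unique {d} {u} du≈1 zero {a} {b} e = trans (·-homo u (a 0)) (trans (*-congˡ (e 0 z≤n)) (inverse-cancel (b 0)))
      where
      inverse-cancel : ∀ y → u * (y * d 0) ≈ y
      inverse-cancel y = trans (solve 3 (λ u y d → u :* (y :* d) := d :* u :* y) refl u y (d 0))
              (trans (*-congʳ du≈1) (ℝᵣ.*-identityˡ y))
    divideSeries-unique {d} {u} du≈1 (suc n) {a} {b} e = divideSeries-unique du≈1 n {b = b ∘ suc} λ k k≤n → begin-equality
      π (a (suc k) -ᶜ d (suc k) · u · a 0)
        ≈⟨ trans (+-homo _ _) (+-congˡ (trans (neg-homo _) (-‿cong (trans (·-homo _ _)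
                (*-congˡ (divideSeries-unique {d} {u} du≈1 zero {a} {b} (λ { zero z≤n → e 0 z≤n }))))))) ⟩
      π (a (suc k)) - d (suc k) * b 0
        ≈⟨ +-congʳ (e (suc k) (s≤s k≤n)) ⟩
      (b 0 * d (suc k) + conv (b ∘ suc) d k) - d (suc k) * b 0
        ≈⟨ solve 3 (λ b d c → (b :* d :+ c) :- d :* b := c) refl _ _ _ ⟩
      conv (b ∘ suc) d k ∎

  re-component : IsComponent re
  re-component = record
    { cong = re≈ ; zero-homo = refl ; +-homo = λ _ _ → refl ; neg-homo = λ _ → refl ; ·-homo = λ _ _ → refl ; conj-conj = λ _ → refl }

  im-component : IsComponent im
  im-component = record
    { cong = im≈ ; zero-homo = refl ; +-homo = λ _ _ → refl ; neg-homo = λ _ → refl ; ·-homo = λ _ _ → refl ; conj-conj = λ z → ⁻¹-involutive (im z) }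

  -- From x² + y² ≤ (x + y)²; the cruder bound avoids a square root and affects only the constant.
  ∣∣≤-components : ∀ {z x y} → re z ≼ x → im z ≼ y → ∣ z ∣≤ (x + y)
  ∣∣≤-components {z} {x} {y} p q = +-nonneg 0≤x 0≤y , ≤-trans
    (+-mono-≤ (upper (≼-* p p)) (upper (≼-* q q)))
    (≤-by (x * y + x * y) (+-nonneg (*-nonneg 0≤x 0≤y) (*-nonneg 0≤x 0≤y))
      (solve 2 (λ x y → x :* x :+ y :* y :+ (x :* y :+ x :* y) := (x :+ y) :* (x :+ y)) refl x y))
    where
    0≤x = ≼-nonneg p
    0≤y = ≼-nonneg q

  ∣∣≤-resp : ∀ {z x y} → x ≈ y → ∣ z ∣≤ x → ∣ z ∣≤ y
  ∣∣≤-resp e (p , q) = ≤-resp refl e p , ≤-resp refl (*-cong e e) q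

  converges⇒≼ : ∀ {s l} → ConvergesTo s l → ∀ {ε} → 0# < ε → ∃ λ N → ∀ n → N ℕ.≤ n → s n - l ≼ ε
  converges⇒≼ {s} {l} s→l {ε} 0<ε = let N , near = s→l ε 0<ε in N , λ n N≤n →
    let s<l+ε , l<s+ε = near n N≤n in
    ≤-resp refl (solve 2 (λ l e → l :+ e :- l := e) refl l ε) (+-monoˡ-≤ (- l) (<⇒≤ s<l+ε)) &
    ≤-resp (solve 2 (λ l s → l :- s := :- (s :- l)) refl l (s n)) (solve 2 (λ s e → s :+ e :- s := e) refl (s n) ε)
            (+-monoˡ-≤ (- s n) (<⇒≤ l<s+ε))

  module Component {π : ℂ → ℝ} (component : IsComponent π) {f : ℕ} .{{f≢0 : NonZero f}} (χ : DirichletCharacter f)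
          (χ-sum≈0 : character-sum χ ≈ᶜ 0ᶜ)
    (r′ : ℕ) .(r≢0 : NonZero (suc r′)) {b : ℝ} (0≤b : 0# ≤ b) where

    open IsComponent component

    X : ℕ → ℝ
    X n = π (⟦ χ ⟧ (+ n))

    x : ℝ
    x = _/ℕ_ b (suc r′) {{r≢0}}

    0≤x : 0# ≤ x
    0≤x = *-nonneg 0≤b (0≤recip (suc r′))

    osc : Oscillating f X
    osc = record
      { recurs   = λ n → cong (DirichletCharacter.periodic χ (+ n))
      ; balanced = trans (sym (∑-homo f (λ n → ⟦ χ ⟧ (+ n)))) (trans (cong χ-sum≈0) zero-homo)
      }

    open Growth 0≤x using (t)
    open Damping 0≤x r′ using (r; F; order)
    open Expansion osc 0≤x r′

    G₂-term-component : ∀ θ n → π (G₂-term χ b (suc r′) {{r≢0}} θ n) ≈ term θ n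
    G₂-term-component θ n = trans (ℝᵣ.reflexive (≡.cong π (G₂-term≡ χ b (suc r′) {{r≢0}} θ n)))
            (trans (·-homo _ _) (ℝᵣ.*-comm _ _))

    partial-sum-component : ∀ θ n → π (∑ℂ {n} (λ i → G₂-term χ b (suc r′) {{r≢0}} θ (toℕ i))) ≈ ∑ n (term θ)
    partial-sum-component θ n = trans (∑-homo n (G₂-term χ b (suc r′) {{r≢0}} θ)) (∑-cong n (G₂-term-component θ))

    characterSeries-component : ∀ k → π (characterSeries (conjugate χ) x k) ≈ ∑ f (λ m → X m * expSeries (t m) k)
    characterSeries-component k = trans (∑-homo f (λ m → expSeries (t m) k · conj (conj (⟦ χ ⟧ (+ m)))))
      (∑-cong f (λ m → trans (·-homo _ _) (trans (*-congˡ (conj-conj _)) (ℝᵣ.*-comm _ _))))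

    bernoulli-component : ∀ q k → suc (suc k) ℕ.≤ order q → π (bernoulliCoefficient (conjugate χ) x (suc k)) ≈ - L q k
    bernoulli-component q k 2+k≤K = divideSeries-unique {d = d} d₀u≈1 (suc k) {b = β} coefficients
      where
      d : ℕ → ℝ
      d n = expSeries (fromℕ-ℝ f) (suc n)
      d₀u≈1 : d 0 * recip f ≈ 1#
      d₀u≈1 = trans (*-congʳ (trans (*-congˡ (trans (sym (ℝᵣ.*-identityˡ _)) (expSeries-0 0#)))
              (solve 1 (λ a → a :* :1 :* :1 := a) refl (fromℕ-ℝ f)))) (fromℕ*recip f)
      -- The quotient starts with 0 because X sums to zero over a period; after that its index runs
      -- one ahead of that of `L`.
      β : ℕ → ℝ
      β zero    = 0#
      β (suc k) = - L q k
      conv-neg : ∀ k → conv (β ∘ suc) d k ≈ - conv (L q) d k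
      conv-neg k = trans (conv-cong (λ i → solve 1 (λ l → :- l := :- :1 :* l) refl (L q i)) (λ _ → refl) k)
        (trans (conv-*ˡ (- 1#) (L q) d k) (solve 1 (λ s → :- :1 :* s := :- s) refl _))
      coefficients : ∀ j → j ℕ.≤ suc k → π (characterSeries (conjugate χ) x j) ≈ conv β d j
      coefficients zero    _         = trans (characterSeries-component 0)
        (trans (∑-cong f (λ m → trans (*-congˡ (expSeries-0 (t m))) (ℝᵣ.*-identityʳ _)))
                (trans (Oscillating.balanced osc) (sym (ℝᵣ.zeroˡ _))))
      coefficients (suc j) (s≤s j≤k) = trans (characterSeries-component (suc j))
        (trans (L-recursion q j (ℕ.≤-trans (s≤s (s≤s j≤k)) 2+k≤K))
          (sym (trans (+-cong (ℝᵣ.zeroˡ _) (conv-neg j)) (ℝᵣ.+-identityˡ _))))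

    coefficient-component : ∀ q n → n ℕ.< q → ∀ θ →
      π (((- 1#) ^ n * recip (suc (r ℕ.* n)) * recip (n !) {{n ℕ.!≢0}} * θ ^ n) · B (suc (r ℕ.* n))
              (conjugate χ) x) ≈ - coefficient q n θ
    coefficient-component q n n<q θ = begin-equality
      π (s · B (suc k) (conjugate χ) x)
        ≈⟨ trans (·-homo s _) (*-congˡ (trans (·-homo _ (bernoulliCoefficient (conjugate χ) x (suc k)))
                (*-cong (×1-homo-* (suc k) (k !)) (bernoulli-component q k 2+k≤K)))) ⟩
      s * (fromℕ-ℝ (suc k) * fromℕ-ℝ (k !) * - L q k)
        ≈⟨ solve 7 (λ e i j p m g l → e :* i :* j :* p :* (m :* g :* :- l) := :- ((m :* i) :* (e :* p :* j :* g :* l))) refl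
             ((- 1#) ^ n) (recip (suc k)) (recip (n !) {{n ℕ.!≢0}}) (θ ^ n) (fromℕ-ℝ (suc k)) (fromℕ-ℝ (k !)) (L q k) ⟩
      - (fromℕ-ℝ (suc k) * recip (suc k) * ((- 1#) ^ n * θ ^ n * recip (n !) {{n ℕ.!≢0}} * fromℕ-ℝ (k !) * L q k))
        -- The factor rn + 1 of (rn+1)! cancels the denominator of the expansion and leaves the
        -- (rn)! of `coefficient`.
        ≈⟨ -‿cong (trans (*-congʳ (fromℕ*recip (suc k))) (trans (ℝᵣ.*-identityˡ _) (*-congʳ (*-congʳ (*-congʳ
             (trans (sym (^-distrib-* (- 1#) θ n)) (^-congˡ n (solve 1 (λ θ → :- :1 :* θ := :- θ) refl θ)))))))) ⟩
      - coefficient q n θ ∎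
      where
      k = r ℕ.* n
      s = (- 1#) ^ n * recip (suc k) * recip (n !) {{n ℕ.!≢0}} * θ ^ n
      2+k≤K : suc (suc k) ℕ.≤ order q
      2+k≤K = ℕ.≤-trans (ℕ.≤-reflexive (ℕ.+-comm 2 k)) (ℕ.≤-trans (ℕ.+-monoˡ-≤ 2 (ℕ.*-monoʳ-≤ r (ℕ.<⇒≤ n<q)))
        (ℕ.≤-reflexive (ℕ.+-assoc q (r′ ℕ.* q) 2)))

    G₂-expansion-component : ∀ N θ → π (G₂-expansion χ b (suc r′) {{r≢0}} N θ) ≈ fromℕ-ℝ r * ∑ (suc N)
            (λ n → coefficient (suc N) n θ)
    G₂-expansion-component N θ = trans (neg-homo _) (trans (-‿cong (trans (·-homo (fromℕ-ℝ r) _) (*-congˡ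
        (trans (∑-homo (suc N) _) (trans (∑-cong< (suc N) (λ n n<q → coefficient-component (suc N) n n<q θ))
                (∑-neg (suc N) _))))))
      (solve 2 (λ r s → :- (r :* :- s) := r :* s) refl (fromℕ-ℝ r) _))

  module _ {f : ℕ} .{{f≢0 : NonZero f}} (χ : DirichletCharacter f) (χ-sum≈0 : character-sum χ ≈ᶜ 0ᶜ)
          (r′ : ℕ) .(r≢0 : NonZero (suc r′)) {b : ℝ} (0≤b : 0# ≤ b) where

    private
      module Re = Component re-component χ χ-sum≈0 r′ r≢0 0≤b
      module Im = Component im-component χ χ-sum≈0 r′ r≢0 0≤b
      module ReExp = Expansion Re.osc Re.0≤x r′
      module ImExp = Expansion Im.osc Im.0≤x r′
      r = suc r′

    -- abstract, since comparing two copies of the sum would unfold its proof of convergence.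
    abstract
      sum-of-components : ∀ θ → 0# < θ → ℂ
      sum-of-components θ 0<θ = proj₁ (ReExp.term-summable 0<θ) +i proj₁ (ImExp.term-summable 0<θ)

      G₂-summable : ∀ θ → 0# < θ → Summable (G₂-term χ b (suc r′) {{r≢0}} θ)
      G₂-summable θ 0<θ = sum-of-components θ 0<θ , λ ε 0<ε →
        let 0<εh = *-pos 0<ε (0<recip 2)
            N , p = converges⇒≼ (proj₂ (ReExp.term-summable 0<θ)) 0<εh
            M , q = converges⇒≼ (proj₂ (ImExp.term-summable 0<θ)) 0<εh
        in N ℕ.⊔ M , λ n N⊔M≤n → ∣∣≤-resp
          (trans (sym (ℝᵣ.distribˡ ε h h)) (trans (*-congˡ h+h≈1) (ℝᵣ.*-identityʳ ε)))
          (∣∣≤-components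
            (≼-respˡ (+-congʳ (sym (Re.partial-sum-component θ n))) (p n (ℕ.≤-trans (ℕ.m≤m⊔n N M) N⊔M≤n)))
            (≼-respˡ (+-congʳ (sym (Im.partial-sum-component θ n))) (q n (ℕ.≤-trans (ℕ.m≤n⊔m N M) N⊔M≤n))))

      G₂-asymptotic : ∀ N → IsBigO⁺ (λ θ θ>0 → G₂ χ b (suc r′) {{r≢0}} θ (G₂-summable θ θ>0) -ᶜ G₂-expansion χ b (suc r′)
              {{r≢0}} N θ) (suc N)
      G₂-asymptotic N =
        let C , 0≤C , p = ReExp.expansion (suc N)
            D , 0≤D , q = ImExp.expansion (suc N)
        -- The damping estimates hold for θ ≤ 1, whence δ = 1; q = N + 1 is both the number of terms
        -- kept and the exponent of the error.
        in fromℕ-ℝ r * C + fromℕ-ℝ r * D , 1# , 0<1 , λ θ 0<θ θ<1 →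
          let p′ = p 0<θ (<⇒≤ θ<1) (proj₂ (ReExp.term-summable 0<θ))
              q′ = q 0<θ (<⇒≤ θ<1) (proj₂ (ImExp.term-summable 0<θ))
          in ∣∣≤-resp (sym (ℝᵣ.distribʳ _ _ _))
            (∣∣≤-components
              (≼-resp (trans (solve 3 (λ r l s → r :* (l :- s) := r :* l :- r :* s) refl _ _ _)
                      (+-congˡ (-‿cong (sym (Re.G₂-expansion-component N θ))))) (sym (ℝᵣ.*-assoc _ _ _)) (≼-scale (0≤fromℕ r) p′))
              (≼-resp (trans (solve 3 (λ r l s → r :* (l :- s) := r :* l :- r :* s) refl _ _ _)
                      (+-congˡ (-‿cong (sym (Im.G₂-expansion-component N θ))))) (sym (ℝᵣ.*-assoc _ _ _)) (≼-scale
                      (0≤fromℕ r) q′)))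

theorem1p1 : ∀ {c ℓ₁ ℓ₂} (R : RealField c ℓ₁ ℓ₂) →
    let open Analysis R in
    ∀ {f : ℕ} .{{_ : NonZero f}} (χ : DirichletCharacter f) →
    Primitive χ → Nonprincipal χ →
    ∀ (r : ℕ) .{{_ : NonZero r}} (b : ℝ) → 0# ≤ b →
    Σ (∀ θ → 0# < θ → Summable (G₂-term χ b r θ)) λ conv →
    ∀ (N : ℕ) →
    IsBigO⁺ (λ θ θ>0 → G₂ χ b r θ (conv θ θ>0) -ᶜ G₂-expansion χ b r N θ) (suc N)
theorem1p1 R χ prim nonprincipal (suc r′) {{r≢0}} b 0≤b =
  Expansions.G₂-summable R χ (Expansions.character-sum-zero R χ prim nonprincipal) r′ r≢0 0≤b ,
  Expansions.G₂-asymptotic R χ (Expansions.character-sum-zero R χ prim nonprincipal) r′ r≢0 0≤b
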